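{- Let $k\in\mathbb{N}$. If a connected graph $G$ contains no $(\ge k)$-subdivision of $K^3$ as a geodesic subgraph and no $(\ge 3k)$-subdivision of the wrench graph $W$ as a $3$-quasi-geodesic subgraph, then there is a subdivided star $S$ such that $G$ admits an honest $S$-decomposition of radial width at most $58k+9$ and radial spread at most $30k+7$. Moreover, there exists $C_k\in\mathbb{N}$, depending only on $k$, such that for every such $G$ some subdivided star is $(1,C_k)$-quasi-isometric to $G$.
   Context: All graphs are finite and simple; $\mathbb{N}=\{0,1,2,\dots\}$. $d_G$ denotes the distance in $G$. The wrench graph $W$ is the tree on six vertices consisting of two adjacent vertices of degree $3$, each of which has two further neighbours that are leaves. A subdivided star is a graph obtained from a star $K_{1,m}$ ($m\ge 0$) by subdividing edges; equivalently a tree with at most one vertex of degree at least $3$ (so every path, including the one-vertex path, is a subdivided star). A $(\ge k)$-subdivision of a graph $X$ is a graph obtained from $X$ by replacing every edge with a path of length at least $k+1$ (new paths being internally disjoint from each other and from $V(X)$). A subgraph $Y$ of $G$ is $c$-quasi-geodesic in $G$ if $d_Y(u,v)\le c\cdot d_G(u,v)$ for all $u,v\in V(Y)$; it is geodesic if it is $1$-quasi-geodesic. Graph-decompositions: an $H$-decomposition of $G$ is a pair $(H,(V_h)_{h\in V(H)})$ with $H$ a graph and $V_h\subseteq V(G)$ (the bags) such that $\bigcup_{h}G[V_h]=G$ and, for every $v\in V(G)$, the graph $H_v:=H[\{h: v\in V_h\}]$ is connected. It is honest if all bags are non-empty and $V_h\cap V_{h'}\ne\emptyset$ for every edge $hh'$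 of $H$. The radius $\mathrm{rad}(G)$ of a graph is the least $r\in\mathbb N$ such that some vertex has distance at most $r$ to all vertices ($\infty$ if the graph is disconnected). The radial width of the decomposition is $\max_h \mathrm{rad}(G[V_h])$ and its radial spread is $\max_{v\in V(G)}\mathrm{rad}(H_v)$. Quasi-isometry: for integers $L\ge1$, $C\ge0$, a graph $A$ is $(L,C)$-quasi-isometric to a graph $B$ if there is a map $\varphi:V(A)\to V(B)$ such that for all $a,a'\in V(A)$: $d_A(a,a')\le L\,d_B(\varphi(a),\varphi(a'))+LC$ and $d_B(\varphi(a),\varphi(a'))\le L\,d_A(a,a')+C$; and every $b\in V(B)$ satisfies $d_B(b,\varphi(a))\le C$ for some $a\in V(A)$. -}

module Defs where

open import Data.Bool.Base using (Bool; true; false; not; _∨_; T)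
open import Data.Bool.Properties using (∨-comm)
open import Data.Fin.Base using (Fin; zero; suc; toℕ; _<_)
open import Data.Fin.Patterns using (0F; 1F; 2F; 3F; 4F; 5F)
open import Data.Fin.Properties using (_≟_)
open import Data.Fin.Subset using (Subset; _∈_; _∩_; Nonempty)
open import Data.Nat.Base using (ℕ; zero; suc; _+_; _*_; _≤_)
open import Data.Product.Base using (Σ; Σ-syntax; ∃; ∃-syntax; _×_; _,_)
open import Data.Refinement.Base using (Refinement-syntax; value)
open import Data.Sum.Base using (_⊎_; inj₁; inj₂)
open import Function.Base using (_∘_; _on_)
open import Function.Bundles using (_↔_; _⇔_; mk⇔; module Inverse)
open import Function.Definitions using (Injective)
open import Relation.Binary.PropositionalEquality using (_≡_; refl; sym; cong)
open import Relation.Nullary.Decidable using (does; dec-true; does-⇔)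

-- Adjacency is Boolean so that it is decidable and proof-irrelevant.  The
-- vertex type is a parameter; the finite graphs are those with vertex type
-- Fin n, up to isomorphism.
record Graph (V : Set) : Set where
  field
    adj        : V → V → Bool
    adj-sym    : ∀ u v → adj u v ≡ adj v u
    adj-irrefl : ∀ v → adj v v ≡ false

  infix 4 _~_
  _~_ : V → V → Set
  u ~ v = T (adj u v)

module _ {V : Set} (G : Graph V) where
  open Graph G

  data Walk : V → V → ℕ → Set where
    []  : ∀ {v} → Walk v v 0
    _∷_ : ∀ {u v w n} → u ~ v → Walk v w n → Walk u w (suc n)

  -- d(u,v) = d.  No d satisfies this when d(u,v) = ∞.
  Dist : V → V → ℕ → Set
  Dist u v d = Walk u v d × (∀ {m} → Walk u v m → d ≤ m)

  -- d(u,v) ≤ r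
  Dist≤ : V → V → ℕ → Set
  Dist≤ u v r = ∃[ d ] Dist u v d × d ≤ r

  -- Connected graphs are non-empty.
  Connected : Set
  Connected = V × (∀ u v → ∃[ d ] Walk u v d)

  HasCentre : ℕ → Set
  HasCentre r = ∃[ c ] ∀ v → Dist≤ c v r

  -- rad(G) = r.  No r satisfies this when rad(G) = ∞.
  Radius : ℕ → Set
  Radius r = HasCentre r × (∀ {s} → HasCentre s → r ≤ s)

  -- rad(G) ≤ w
  Radius≤ : ℕ → Set
  Radius≤ w = ∃[ r ] Radius r × r ≤ w

  -- Membership proofs in a refinement type are irrelevant, so each vertex
  -- satisfying P occurs exactly once.
  induced : (P : V → Set) → Graph [ v ∈ V ∣ P v ]
  induced P = record
    { adj        = adj on value
    ; adj-sym    = λ u v → adj-sym (value u) (value v)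
    ; adj-irrefl = λ v → adj-irrefl (value v)
    }

complete : ∀ n → Graph (Fin n)
complete n = record
  { adj        = λ u v → not (does (u ≟ v))
  ; adj-sym    = λ u v → cong not (does-⇔ (mk⇔ sym sym) (u ≟ v) (v ≟ u))
  ; adj-irrefl = λ v → cong not (dec-true (v ≟ v) refl)
  }

K³ : Graph (Fin 3)
K³ = complete 3

-- K_{1,m}, with centre zero.
star : ∀ m → Graph (Fin (suc m))
star m = record { adj = a ; adj-sym = a-sym ; adj-irrefl = a-irrefl }
  where
  a : Fin (suc m) → Fin (suc m) → Bool
  a zero    zero    = false
  a zero    (suc _) = true
  a (suc _) zero    = true
  a (suc _) (suc _) = false

  a-sym : ∀ u v → a u v ≡ a v u
  a-sym zero    zero    = refl
  a-sym zero    (suc _) = refl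
  a-sym (suc _) zero    = refl
  a-sym (suc _) (suc _) = refl

  a-irrefl : ∀ v → a v v ≡ false
  a-irrefl zero    = refl
  a-irrefl (suc _) = refl

-- The vertices of degree 3 are 0F and 1F.
wrench : Graph (Fin 6)
wrench = record
  { adj        = λ u v → e u v ∨ e v u
  ; adj-sym    = λ u v → ∨-comm (e u v) (e v u)
  ; adj-irrefl = irrefl
  }
  where
  e : Fin 6 → Fin 6 → Bool
  e 0F 1F = true
  e 0F 2F = true
  e 0F 3F = true
  e 1F 4F = true
  e 1F 5F = true
  e _  _  = false

  irrefl : ∀ v → e v v ∨ e v v ≡ false
  irrefl 0F = refl
  irrefl 1F = refl
  irrefl 2F = refl
  irrefl 3F = refl
  irrefl 4F = refl
  irrefl 5F = refl

-- Each undirected edge is represented once, oriented from its smaller end to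
-- its larger end.
record Edge {n : ℕ} (X : Graph (Fin n)) : Set where
  constructor edge
  open Graph X
  field
    src tgt   : Fin n
    .ordered  : src < tgt
    .adjacent : src ~ tgt

open Edge public using (src; tgt)

-- The graph obtained from X by replacing each edge e with a path with ℓ e
-- inner vertices, that is, of length 1 + ℓ e.
module _ {n : ℕ} (X : Graph (Fin n)) (ℓ : Edge X → ℕ) where

  Point : Set
  Point = Fin n ⊎ Σ[ e ∈ Edge X ] Fin (ℓ e)

  -- At e i p : p is the i-th vertex of the path replacing e.
  data At (e : Edge X) : ℕ → Point → Set where
    source : At e 0 (inj₁ (src e))
    inner  : ∀ j → At e (suc (toℕ j)) (inj₂ (e , j))
    target : At e (suc (ℓ e)) (inj₁ (tgt e))

  Next : Point → Point → Set
  Next p q = ∃[ e ] ∃[ i ] At e i p × At e (suc i) q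

-- Y is, up to isomorphism, a (≥ k)-subdivision of X; in particular Y is finite.
record Subdivision {n : ℕ} {W : Set} (k : ℕ) (X : Graph (Fin n)) (Y : Graph W) : Set where
  open Graph Y
  field
    ℓ        : Edge X → ℕ
    k≤ℓ      : ∀ e → k ≤ ℓ e
    vertices : Point X ℓ ↔ W
  open Inverse vertices using (to)
  field
    edges    : ∀ p q → to p ~ to q ⇔ (Next X ℓ p q ⊎ Next X ℓ q p)

SubdividedStar : {W : Set} → Graph W → Set
SubdividedStar S = ∃[ m ] Subdivision 0 (star m) S

-- A subgraph of G isomorphic to Y.
record Subgraph {W V : Set} (Y : Graph W) (G : Graph V) : Set where
  open Graph
  field
    ι           : W → V
    ι-injective : Injective _≡_ _≡_ ι
    ι-adj       : ∀ {u v} → _~_ Y u v → _~_ G (ι u) (ι v)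

-- d_Y(u,v) ≤ c · d_G(u,v), which is vacuous when d_G(u,v) = ∞.
QuasiGeodesic : {W V : Set} {Y : Graph W} {G : Graph V} → ℕ → Subgraph Y G → Set
QuasiGeodesic {Y = Y} {G} c Y⊆G =
  ∀ u v {d} → Dist G (ι u) (ι v) d → Dist≤ Y u v (c * d)
  where open Subgraph Y⊆G

Geodesic : {W V : Set} {Y : Graph W} {G : Graph V} → Subgraph Y G → Set
Geodesic = QuasiGeodesic 1

ContainsGeodesicSubdivision : {n : ℕ} {V : Set} → ℕ → Graph (Fin n) → Graph V → Set₁
ContainsGeodesicSubdivision k X G =
  Σ[ W ∈ Set ] Σ[ Y ∈ Graph W ] Subdivision k X Y × Σ[ Y⊆G ∈ Subgraph Y G ] Geodesic Y⊆G

ContainsQuasiGeodesicSubdivision : {n : ℕ} {V : Set} → ℕ → ℕ → Graph (Fin n) → Graph V → Set₁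
ContainsQuasiGeodesicSubdivision c k X G =
  Σ[ W ∈ Set ] Σ[ Y ∈ Graph W ] Subdivision k X Y × Σ[ Y⊆G ∈ Subgraph Y G ] QuasiGeodesic c Y⊆G

-- The two cover conditions say that the graphs G[V_h] have union G.
record Decomposition {I : Set} {n : ℕ} (H : Graph I) (G : Graph (Fin n)) : Set where
  open Graph
  field
    bag : I → Subset n

  part : (h : I) → Graph [ v ∈ Fin n ∣ v ∈ bag h ]
  part h = induced G (λ v → v ∈ bag h)

  copart : (v : Fin n) → Graph [ h ∈ I ∣ v ∈ bag h ]
  copart v = induced H (λ h → v ∈ bag h)

  field
    vertex-cover     : ∀ v → ∃[ h ] v ∈ bag h
    edge-cover       : ∀ u v → _~_ G u v → ∃[ h ] u ∈ bag h × v ∈ bag h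
    copart-connected : ∀ v → Connected (copart v)

  Honest : Set
  Honest = (∀ h → Nonempty (bag h)) ×
           (∀ h h′ → _~_ H h h′ → Nonempty (bag h ∩ bag h′))

  RadialWidth≤ : ℕ → Set
  RadialWidth≤ w = ∀ h → Radius≤ (part h) w

  RadialSpread≤ : ℕ → Set
  RadialSpread≤ s = ∀ v → Radius≤ (copart v) s

-- A is (L , C)-quasi-isometric to B; distances may be infinite.
record QuasiIsometric {V W : Set} (L C : ℕ) (A : Graph V) (B : Graph W) : Set where
  field
    φ     : V → W
    lower : ∀ a a′ {d} → Dist B (φ a) (φ a′) d → Dist≤ A a a′ (L * d + L * C)
    upper : ∀ a a′ {d} → Dist A a a′ d → Dist≤ B (φ a) (φ a′) (L * d + C)
    dense : ∀ b → ∃[ a ] Dist≤ B b (φ a) C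

-- Let u be an end of a diametral pair and let all heights be distances from u.
-- Take a geodesic Q from u.  Mark the edges between heights j and j + 1 within
-- distance 3k of Q.  If all closed walks of length at most 3k + 2 cross marked
-- edges an even number of times, then so do all closed walks, since a shortest
-- odd one is a geodesic cycle.  In that case the marked edges separate G.  Short
-- closed walks are even unless some vertex at distance exactly 3k + 1 from Q is
-- close to height j.  If its nearest vertex on Q is at distance at least 3k + 1
-- from both ends of Q, call this nearest vertex a branch.  Two branches at
-- distance at least 4 (3k + 1) on the same geodesic span a 3-quasi-geodesic
-- wrench.
--
-- Let a be the largest height of a branch on any of these geodesics.  Above
-- height R = a + 6k + 1 every geodesic can be cut wherever it is not close to its
-- end.  Hence a vertex z above R that is separated from u by the cut at height R
-- of the geodesic to some v no lower than z lies within 13k of this geodesic.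
-- Selecting such v greedily from the highest vertex downwards yields pairwise
-- distant legs.  If a is small then u is a centre from which they emanate.
-- Otherwise cut the geodesic Q with the topmost branch below its lowest branch.
-- The vertex of Q at the cut is the centre, and since u is an end of a diametral
-- pair, the part of G below the cut stays close to Q, which gives one more leg.
-- Balls along the legs and around the centre are the bags, and the legs, glued
-- at the centre, form a quasi-isometric star.

module Submission where

-- Two lengths are dictated by the forbidden graphs: a cycle of length at least `3 k + 3` splits
-- into three paths of length at least `k + 1`, and the edges of a `(≥ 3 k)`-subdivision become
-- paths of length at least `3 k + 1`. Most margins come from one estimate. If a closed walk of
-- length at most `3 k + 2` through a marked edge strays from the geodesic, it does so at a vertex
-- at most `(3 k + 1) / 2` steps from an end of that edge, whose nearest vertex on the geodesic is
-- `3 k + 1` away. So the height of the latter differs from `j` by at most `(9 k + 5) / 2`. For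
-- `k = 0` there is no such vertex; for `k ≥ 1` this yields the margins `6 k + 1`, `10 k + 1`,
-- `9 k + 1` and `5 k + 3`, all tight at `k = 1`. The distance `13 k` from a leg is `10 k` down to a
-- cut and `3 k` from there to the geodesic. A branch counts as high from
-- `26 k + 7 = (9 k + 1) + (17 k + 6)` on; if there is none, then `R = (26 k + 6) + (6 k + 1)`, and
-- `R + 26 k + 2 = 58 k + 9` is the radius of the central bag. The pieces of the legs are so long
-- that each vertex has a bag touching all its other bags, so the spread is at most 1.

open import Defs
open import Data.Bool.Base using (Bool; true; false; if_then_else_; T; not; _xor_; _∧_)
open import Data.Bool.Properties as Bool using (T?; xor-assoc; xor-comm; xor-same; xor-identityʳ; ∧-comm)
open import Data.Empty using (⊥; ⊥-elim)
open import Data.Empty.Irrelevant renaming (⊥-elim to ⊥-elim-irr)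
open import Data.Fin.Base as Fin using (Fin; zero; suc; toℕ; fromℕ<)
open import Data.Fin.Patterns using (0F; 1F; 2F; 3F; 4F; 5F)
import Data.Fin.Properties as Fin
open import Data.Fin.Subset as Subset using (Subset)
open import Data.Fin.Subset.Properties using (x∈p∩q⁺; _∈?_)
open import Data.Integer.Base as ℤ using (ℤ)
open import Data.Irrelevant using ([_])
open import Data.List.Base as List using (List; []; _∷_)
open import Data.Nat.Base
open import Data.Nat.DivMod using (_/_; m≡m%n+[m/n]*n; m%n<n; /-monoˡ-≤; m/n*n≤m)
open import Data.Nat.Properties
open import Algebra.Properties.CommutativeSemigroup +-commutativeSemigroup using (interchange)
open import Data.Product.Base
import Data.Product.Properties as Product
open import Data.Refinement.Base using (Refinement-syntax; value; _,_)
open import Data.Sum.Base as Sum using (_⊎_; inj₁; inj₂; [_,_]′)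
import Data.Sum.Properties as Sum
open import Data.Unit.Base using (⊤; tt)
open import Data.Vec.Base using (tabulate)
open import Data.Vec.Properties using (lookup∘tabulate; lookup⇒[]=; []=⇒lookup)
open import Function.Base using (_∘_; id; case_of_)
open import Function.Bundles using (mk⇔)
open import Function.Construct.Identity using (↔-id)
open import Relation.Binary.Definitions using (DecidableEquality; tri<; tri≈; tri>)
open import Relation.Binary.PropositionalEquality
open import Relation.Nullary.Decidable hiding (map)
open import Relation.Nullary.Negation.Core using (¬_)

-- Linear arithmetic over ℕ

infixl 6 _⊕_
infixl 7 _·_
infix 4 _≼_ _≺_ _≐_
infixr 3 _⇒_

data Lin : Set where
  var : ℕ → Lin
  κ   : ℕ → Lin
  _⊕_ : Lin → Lin → Lin
  _·_ : ℕ → Lin → Lin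

data Claim : Set where
  _≼_ _≺_ _≐_ : Lin → Lin → Claim

data Problem : Set where
  goal  : Claim → Problem
  false : Problem
  _⇒_   : Claim → Problem → Problem

lookup₀ : List ℕ → ℕ → ℕ
lookup₀ []      _       = 0
lookup₀ (x ∷ _) zero    = x
lookup₀ (_ ∷ ρ) (suc i) = lookup₀ ρ i

⟦_⟧ : Lin → List ℕ → ℕ
⟦ var i ⟧ ρ = lookup₀ ρ i
⟦ κ n   ⟧ ρ = n
⟦ a ⊕ b ⟧ ρ = ⟦ a ⟧ ρ + ⟦ b ⟧ ρ
⟦ n · a ⟧ ρ = n * ⟦ a ⟧ ρ

⟦_⟧ᶜ : Claim → List ℕ → Set
⟦ a ≼ b ⟧ᶜ ρ = ⟦ a ⟧ ρ ≤ ⟦ b ⟧ ρ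
⟦ a ≺ b ⟧ᶜ ρ = ⟦ a ⟧ ρ < ⟦ b ⟧ ρ
⟦ a ≐ b ⟧ᶜ ρ = ⟦ a ⟧ ρ ≡ ⟦ b ⟧ ρ

⟦_⟧ᵖ : Problem → List ℕ → Set
⟦ goal c ⟧ᵖ ρ = ⟦ c ⟧ᶜ ρ
⟦ false  ⟧ᵖ ρ = ⊥
⟦ c ⇒ p  ⟧ᵖ ρ = ⟦ c ⟧ᶜ ρ → ⟦ p ⟧ᵖ ρ

-- The coefficient vector of a linear form; its head is the constant term.
Coeffs : Set
Coeffs = List ℕ

infixl 6 _⊞_
_⊞_ : Coeffs → Coeffs → Coeffs
[]       ⊞ ys       = ys
(x ∷ xs) ⊞ []       = x ∷ xs
(x ∷ xs) ⊞ (y ∷ ys) = x + y ∷ xs ⊞ ys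

scale : ℕ → Coeffs → Coeffs
scale n = List.map (n *_)

unit : ℕ → Coeffs
unit zero    = 1 ∷ []
unit (suc i) = 0 ∷ unit i

coeffs : Lin → Coeffs
coeffs (var i) = unit (suc i)
coeffs (κ n)   = n ∷ []
coeffs (a ⊕ b) = coeffs a ⊞ coeffs b
coeffs (n · a) = scale n (coeffs a)

dot : Coeffs → List ℕ → ℕ
dot []       _       = 0
dot (c ∷ cs) []      = 0
dot (c ∷ cs) (x ∷ ρ) = c * x + dot cs ρ

⊞-dot : ∀ xs ys ρ → dot (xs ⊞ ys) ρ ≡ dot xs ρ + dot ys ρ
⊞-dot []       ys       ρ       = refl
⊞-dot (x ∷ xs) []       ρ       = sym (+-identityʳ _)
⊞-dot (x ∷ xs) (y ∷ ys) []      = refl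
⊞-dot (x ∷ xs) (y ∷ ys) (z ∷ ρ) = begin
  (x + y) * z + dot (xs ⊞ ys) ρ              ≡⟨ cong₂ _+_ (*-distribʳ-+ z x y) (⊞-dot xs ys ρ) ⟩
  (x * z + y * z) + (dot xs ρ + dot ys ρ)    ≡⟨ interchange (x * z) (y * z) (dot xs ρ) (dot ys ρ) ⟩
  (x * z + dot xs ρ) + (y * z + dot ys ρ)    ∎
  where open ≡-Reasoning

scale-dot : ∀ n xs ρ → dot (scale n xs) ρ ≡ n * dot xs ρ
scale-dot n []       ρ       = sym (*-zeroʳ n)
scale-dot n (x ∷ xs) []      = sym (*-zeroʳ n)
scale-dot n (x ∷ xs) (z ∷ ρ) =
  trans (cong₂ _+_ (*-assoc n x z) (scale-dot n xs ρ)) (sym (*-distribˡ-+ n (x * z) (dot xs ρ)))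

unit-dot : ∀ i ρ → dot (unit i) ρ ≡ lookup₀ ρ i
unit-dot zero    []      = refl
unit-dot zero    (x ∷ ρ) = trans (+-identityʳ _) (+-identityʳ _)
unit-dot (suc i) []      = refl
unit-dot (suc i) (x ∷ ρ) = unit-dot i ρ

coeffs-dot : ∀ a ρ → dot (coeffs a) (1 ∷ ρ) ≡ ⟦ a ⟧ ρ
coeffs-dot (var i) ρ = unit-dot i ρ
coeffs-dot (κ n)   ρ = trans (+-identityʳ _) (*-identityʳ n)
coeffs-dot (a ⊕ b) ρ =
  trans (⊞-dot (coeffs a) (coeffs b) (1 ∷ ρ)) (cong₂ _+_ (coeffs-dot a ρ) (coeffs-dot b ρ))
coeffs-dot (n · a) ρ =
  trans (scale-dot n (coeffs a) (1 ∷ ρ)) (cong (n *_) (coeffs-dot a ρ))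

infix 4 _≤ᵛ_
_≤ᵛ_ : Coeffs → Coeffs → Bool
[]       ≤ᵛ ys       = true
(x ∷ xs) ≤ᵛ []       = (x ≤ᵇ 0) ∧ (xs ≤ᵛ [])
(x ∷ xs) ≤ᵛ (y ∷ ys) = (x ≤ᵇ y) ∧ (xs ≤ᵛ ys)

∧-split : ∀ {a b} → T (a ∧ b) → T a × T b
∧-split {true} {true} _ = tt , tt

≤ᵛ-dot : ∀ xs ys ρ → T (xs ≤ᵛ ys) → dot xs ρ ≤ dot ys ρ
≤ᵛ-dot []       ys       ρ       p = z≤n
≤ᵛ-dot (x ∷ xs) ys       []      p = z≤n
≤ᵛ-dot (x ∷ xs) []       (z ∷ ρ) p with ∧-split {x ≤ᵇ 0} p
... | x≤0 , q = +-mono-≤ (*-monoˡ-≤ z (≤ᵇ⇒≤ x 0 x≤0)) (≤ᵛ-dot xs [] ρ q)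
≤ᵛ-dot (x ∷ xs) (y ∷ ys) (z ∷ ρ) p with ∧-split {x ≤ᵇ y} p
... | x≤y , q = +-mono-≤ (*-monoˡ-≤ z (≤ᵇ⇒≤ x y x≤y)) (≤ᵛ-dot xs ys ρ q)

Row : Set
Row = Coeffs × Coeffs

Holds : List ℕ → Row → Set
Holds ρ (l , r) = dot l (1 ∷ ρ) ≤ dot r (1 ∷ ρ)

AllHold : List ℕ → List Row → Set
AllHold ρ []       = ⊤
AllHold ρ (h ∷ hs) = Holds ρ h × AllHold ρ hs

combine : List ℕ → List Row → Row
combine []       _              = [] , []
combine (_ ∷ _)  []             = [] , []
combine (c ∷ cs) ((l , r) ∷ hs) with combine cs hs
... | L , R = scale c l ⊞ L , scale c r ⊞ R

combine-holds : ∀ ρ cs hs → AllHold ρ hs → Holds ρ (combine cs hs)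
combine-holds ρ []       hs             _        = z≤n
combine-holds ρ (c ∷ cs) []             _        = z≤n
combine-holds ρ (c ∷ cs) ((l , r) ∷ hs) (p , ps)
  rewrite ⊞-dot (scale c l) (proj₁ (combine cs hs)) (1 ∷ ρ)
        | ⊞-dot (scale c r) (proj₂ (combine cs hs)) (1 ∷ ρ)
        | scale-dot c l (1 ∷ ρ) | scale-dot c r (1 ∷ ρ) =
  +-mono-≤ (*-monoʳ-≤ c p) (combine-holds ρ cs hs ps)

-- Farkas certificates: the weighted sum L ≤ R of the rows is absurd when R
-- is coefficientwise smaller than L.
refutes : List ℕ → List Row → Bool
refutes cs hs = (1 ∷ []) ⊞ proj₂ (combine cs hs) ≤ᵛ proj₁ (combine cs hs)

refutes-sound : ∀ ρ cs hs → T (refutes cs hs) → AllHold ρ hs → ⊥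
refutes-sound ρ cs hs t ps = <-irrefl refl (≤-trans
  (≤-trans (≤-reflexive (sym (⊞-dot (1 ∷ []) (proj₂ (combine cs hs)) (1 ∷ ρ))))
           (≤ᵛ-dot ((1 ∷ []) ⊞ proj₂ (combine cs hs)) (proj₁ (combine cs hs)) (1 ∷ ρ) t))
  (combine-holds ρ cs hs ps))

-- Unverified search for Farkas certificates

module FourierMotzkin where
  record Ineq : Set where
    constructor ineq
    field
      constant : ℤ
      linear   : List ℤ
      weights  : List ℕ
  open Ineq

  subtract : Coeffs → Coeffs → List ℤ
  subtract []       []       = []
  subtract (x ∷ xs) []       = ℤ.+ x ∷ subtract xs []
  subtract []       (y ∷ ys) = ℤ.- (ℤ.+ y) ∷ subtract [] ys
  subtract (x ∷ xs) (y ∷ ys) = x ℤ.⊖ y ∷ subtract xs ys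

  fromList : List ℤ → List ℕ → Ineq
  fromList []       ws = ineq (ℤ.+ 0) [] ws
  fromList (c ∷ cs) ws = ineq c cs ws

  number : ℕ → List Row → List Ineq
  number i []             = []
  number i ((l , r) ∷ hs) = fromList (subtract l r) (unit i) ∷ number (suc i) hs

  coeff : ℕ → Ineq → ℤ
  coeff i q = go i (linear q)
    where
    go : ℕ → List ℤ → ℤ
    go _       []       = ℤ.+ 0
    go zero    (x ∷ _)  = x
    go (suc i) (_ ∷ xs) = go i xs

  -- The weight of such a row is stored behind those of the `m` hypotheses, where `combine` drops
  -- it: the coefficientwise comparison in `refutes` already accounts for variables being natural
  -- numbers.
  nonNegative : ℕ → ℕ → Ineq
  nonNegative m i = ineq (ℤ.+ 0) (go i) (unit (m + i))
    where
    go : ℕ → List ℤ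
    go zero    = ℤ.-[1+ 0 ] ∷ []
    go (suc i) = ℤ.+ 0 ∷ go i

  addℤ : ℕ → List ℤ → ℕ → List ℤ → List ℤ
  addℤ a []       b ys       = List.map (λ y → ℤ.+ b ℤ.* y) ys
  addℤ a (x ∷ xs) b []       = List.map (λ x → ℤ.+ a ℤ.* x) (x ∷ xs)
  addℤ a (x ∷ xs) b (y ∷ ys) = (ℤ.+ a ℤ.* x ℤ.+ ℤ.+ b ℤ.* y) ∷ addℤ a xs b ys

  cross : ℕ → Ineq → Ineq → Ineq
  cross i p q = ineq (ℤ.+ a ℤ.* constant p ℤ.+ ℤ.+ b ℤ.* constant q)
                     (addℤ a (linear p) b (linear q))
                     (scale a (weights p) ⊞ scale b (weights q))
    where
    a = ℤ.∣ coeff i q ∣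
    b = ℤ.∣ coeff i p ∣

  positive negative zeroes : ℕ → List Ineq → List Ineq
  positive i = List.filterᵇ (λ q → ℤ.+ 1 ℤ.≤ᵇ coeff i q)
  negative i = List.filterᵇ (λ q → coeff i q ℤ.≤ᵇ ℤ.-[1+ 0 ])
  zeroes   i = List.filterᵇ (λ q → (ℤ.+ 0 ℤ.≤ᵇ coeff i q) ∧ (coeff i q ℤ.≤ᵇ ℤ.+ 0))

  support : Ineq → ℕ
  support q = List.length (List.filterᵇ (1 ≤ᵇ_) (weights q))

  -- After c eliminations, combinations of more than c + 1 rows are redundant.
  eliminate : ℕ → ℕ → List Ineq → List Ineq
  eliminate c i qs = List.filterᵇ (λ q → support q ≤ᵇ suc c)
                       (List.cartesianProductWith (cross i) (positive i qs) (negative i qs))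
                     List.++ zeroes i qs

  cost : List Ineq → ℕ → ℕ
  cost qs i = List.length (positive i qs) * List.length (negative i qs)

  cheapest : List Ineq → List ℕ → ℕ → ℕ → ℕ
  cheapest qs []       best c = best
  cheapest qs (i ∷ is) best c =
    if cost qs i <ᵇ c then cheapest qs is i (cost qs i) else cheapest qs is best c

  contradiction : List Ineq → List ℕ
  contradiction []       = []
  contradiction (q ∷ qs) = if ℤ.+ 1 ℤ.≤ᵇ constant q then weights q else contradiction qs

  remove : ℕ → List ℕ → List ℕ
  remove i = List.filterᵇ (λ j → not (i ≡ᵇ j))

  -- The first argument bounds the number of eliminations still to do, the
  -- second one counts those done.
  solve : ℕ → ℕ → List ℕ → List Ineq → List ℕ
  solve zero    c is       qs = contradiction qs
  solve (suc n) c []       qs = contradiction qs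
  solve (suc n) c (i ∷ is) qs = solve n (suc c) (remove j (i ∷ is)) (eliminate (suc c) j qs)
    where j = cheapest qs is i (cost qs i)

  certificate : ℕ → List Row → List ℕ
  certificate n hs = solve n 0 (List.upTo n)
    (List.map (nonNegative (List.length hs)) (List.upTo n) List.++ number 0 hs)

rows : Claim → List Row
rows (a ≼ b) = (coeffs a , coeffs b) ∷ []
rows (a ≺ b) = ((1 ∷ []) ⊞ coeffs a , coeffs b) ∷ []
rows (a ≐ b) = (coeffs a , coeffs b) ∷ (coeffs b , coeffs a) ∷ []

rows-hold : ∀ c ρ hs → ⟦ c ⟧ᶜ ρ → AllHold ρ hs → AllHold ρ (rows c List.++ hs)
rows-hold (a ≼ b) ρ hs p ps = subst₂ _≤_ (sym (coeffs-dot a ρ)) (sym (coeffs-dot b ρ)) p , ps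
rows-hold (a ≺ b) ρ hs p ps = subst₂ _≤_ (sym (trans (⊞-dot (1 ∷ []) (coeffs a) (1 ∷ ρ)) (cong suc (coeffs-dot a ρ)))) (sym (coeffs-dot b ρ)) p , ps
rows-hold (a ≐ b) ρ hs p ps =
  subst₂ _≤_ (sym (coeffs-dot a ρ)) (sym (coeffs-dot b ρ)) (≤-reflexive p) ,
  subst₂ _≤_ (sym (coeffs-dot b ρ)) (sym (coeffs-dot a ρ)) (≤-reflexive (sym p)) , ps

-- The certificate is checked after it is found, so soundness rests on `refutes-sound` alone; a
-- failed search merely makes the test false.
refuted : ℕ → List Row → Bool
refuted n hs = refutes (FourierMotzkin.certificate n hs) hs

provable : ℕ → List Row → Problem → Bool
provable n hs (c ⇒ p)        = provable n (rows c List.++ hs) p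
provable n hs false          = refuted n hs
provable n hs (goal (a ≼ b)) = refuted n (rows (b ≺ a) List.++ hs)
provable n hs (goal (a ≺ b)) = refuted n (rows (b ≼ a) List.++ hs)
provable n hs (goal (a ≐ b)) = refuted n (rows (b ≺ a) List.++ hs) ∧ refuted n (rows (a ≺ b) List.++ hs)

refuted-sound : ∀ n ρ c hs → T (refuted n (rows c List.++ hs)) → AllHold ρ hs → ¬ ⟦ c ⟧ᶜ ρ
refuted-sound n ρ c hs t ps h =
  refutes-sound ρ (FourierMotzkin.certificate n (rows c List.++ hs)) (rows c List.++ hs) t (rows-hold c ρ hs h ps)

provable-sound : ∀ n ρ hs p → T (provable n hs p) → AllHold ρ hs → ⟦ p ⟧ᵖ ρ
provable-sound n ρ hs (c ⇒ p)        t ps = λ h →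
  provable-sound n ρ (rows c List.++ hs) p t (rows-hold c ρ hs h ps)
provable-sound n ρ hs false          t ps = refutes-sound ρ (FourierMotzkin.certificate n hs) hs t ps
provable-sound n ρ hs (goal (a ≼ b)) t ps = ≮⇒≥ (refuted-sound n ρ (b ≺ a) hs t ps)
provable-sound n ρ hs (goal (a ≺ b)) t ps = ≰⇒> (refuted-sound n ρ (b ≼ a) hs t ps)
provable-sound n ρ hs (goal (a ≐ b)) t ps with ∧-split {refuted n (rows (b ≺ a) List.++ hs)} t
... | t₁ , t₂ = ≤-antisym (≮⇒≥ (refuted-sound n ρ (b ≺ a) hs t₁ ps)) (≮⇒≥ (refuted-sound n ρ (a ≺ b) hs t₂ ps))

-- Higher-order syntax: a problem is written with bound Agda variables, for which `instantiate`
-- substitutes numbered ones.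
Abstracted : ℕ → Set
Abstracted zero    = Problem
Abstracted (suc n) = Lin → Abstracted n

instantiate : ∀ n → ℕ → Abstracted n → Problem
instantiate zero    i p = p
instantiate (suc n) i f = instantiate n (suc i) (f (var i))

Universally : ∀ (n : ℕ) → (List ℕ → Set) → Set
Universally zero    P = P []
Universally (suc n) P = (x : ℕ) → Universally n (λ ρ → P (x ∷ ρ))

universally : ∀ (n : ℕ) {P} → (∀ ρ → P ρ) → Universally n P
universally zero    p = p []
universally (suc n) p = λ x → universally n (λ ρ → p (x ∷ ρ))

-- Abstract, so that proofs are not unfolded when types are normalised.
abstract
  lin : ∀ n (f : Abstracted n) {_ : T (provable n [] (instantiate n 0 f))} →
        Universally n ⟦ instantiate n 0 f ⟧ᵖ
  lin n f {t} = universally n λ ρ → provable-sound n ρ [] (instantiate n 0 f) t tt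

-- Searching, selecting and walking in finite graphs

least : {P : ℕ → Set} → (∀ n → Dec (P n)) → ∀ n → P n → ∃[ m ] P m × m ≤ n × (∀ j → P j → m ≤ j)
least P? zero    p = 0 , p , z≤n , λ _ _ → z≤n
least P? (suc n) p with P? 0
... | yes p₀ = 0 , p₀ , z≤n , λ _ _ → z≤n
... | no ¬p₀ with least (P? ∘ suc) n p
...   | m , pₘ , m≤n , min = suc m , pₘ , s≤s m≤n , λ where
  zero    q → ⊥-elim (¬p₀ q)
  (suc j) q → s≤s (min j q)

data Between (i j : ℕ) : Set where
  up   : ∀ l → j ≡ i + l → Between i j
  down : ∀ l → i ≡ j + l → Between i j

between : ∀ i j → Between i j
between i j with ≤-total i j
... | inj₁ i≤j = let l , eq = m≤n⇒∃[o]m+o≡n i≤j in up l (sym eq)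
... | inj₂ j≤i = let l , eq = m≤n⇒∃[o]m+o≡n j≤i in down l (sym eq)

greatest : {P : ℕ → Set} → (∀ n → Dec (P n)) → ∀ b → (∀ j → P j → j ≤ b) → ∃ P →
           ∃[ m ] P m × (∀ j → P j → j ≤ m)
greatest {P} P? b bound (n , p) with P? b
... | yes pb = b , pb , bound
... | no ¬pb with b
...   | zero   = ⊥-elim (¬pb (subst P (n≤0⇒n≡0 (bound n p)) p))
...   | suc b′ = greatest P? b′ (λ j q → ≤-pred (≤∧≢⇒< (bound j q) λ { refl → ¬pb q })) (n , p)

argmax : ∀ {n} (f : Fin (suc n) → ℕ) → ∃[ m ] ∀ v → f v ≤ f m
argmax {zero}  f = zero , λ { zero → ≤-refl }
argmax {suc n} f with argmax (f ∘ suc)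
... | m , max with ≤-total (f zero) (f (suc m))
...   | inj₁ le = suc m , λ { zero → le ; (suc v) → max v }
...   | inj₂ ge = zero , λ { zero → ≤-refl ; (suc v) → ≤-trans (max v) ge }

record Enumeration {n : ℕ} (b : Fin n → Bool) : Set where
  field
    size       : ℕ
    item       : Fin size → Fin n
    injective  : ∀ i j → item i ≡ item j → i ≡ j
    sound      : ∀ i → T (b (item i))
    covers     : ∀ x → T (b x) → ∃[ i ] item i ≡ x

enumerate : ∀ {n} (b : Fin n → Bool) → Enumeration b
enumerate {zero}  b = record
  { size = 0 ; item = λ () ; injective = λ () ; sound = λ () ; covers = λ () }
enumerate {suc n} b with enumerate (b ∘ suc) | b zero in b₀
... | E | false = record
  { size      = size
  ; item      = suc ∘ item
  ; injective = λ i j eq → injective i j (Fin.suc-injective eq)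
  ; sound     = sound
  ; covers    = λ { zero t → ⊥-elim (subst T b₀ t)
                  ; (suc x) t → map₂ (cong suc) (covers x t) }
  }
  where open Enumeration E
... | E | true = record
  { size      = suc size
  ; item      = item′
  ; injective = injective′
  ; sound     = λ { zero → subst T (sym b₀) tt ; (suc i) → sound i }
  ; covers    = λ { zero t → zero , refl
                  ; (suc x) t → map suc (cong suc) (covers x t) }
  }
  where
  open Enumeration E
  item′ : Fin (suc size) → Fin (suc n)
  item′ zero    = zero
  item′ (suc i) = suc (item i)
  injective′ : ∀ i j → item′ i ≡ item′ j → i ≡ j
  injective′ zero    zero    eq = refl
  injective′ (suc i) (suc j) eq = cong suc (injective i j (Fin.suc-injective eq))

Search : Set → Set₁
Search A = {P : A → Set} → (∀ a → Dec (P a)) → Dec (∃ P)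

search-all : ∀ {A} → Search A → {P : A → Set} → (∀ a → Dec (P a)) → Dec (∀ a → P a)
search-all search P? = map′ (λ ¬∃¬ a → decidable-stable (P? a) λ ¬p → ¬∃¬ (a , ¬p))
                            (λ all (a , ¬p) → ¬p (all a))
                            (¬? (search (¬? ∘ P?)))

search-⊎ : ∀ {A B} → Search A → Search B → Search (A ⊎ B)
search-⊎ sA sB P? = map′ [ map inj₁ id , map inj₂ id ]′
                         (λ { (inj₁ a , p) → inj₁ (a , p) ; (inj₂ b , p) → inj₂ (b , p) })
                         (sA (P? ∘ inj₁) ⊎-dec sB (P? ∘ inj₂))

search-Σ : ∀ {A} {B : A → Set} → Search A → (∀ a → Search (B a)) → Search (Σ A B)
search-Σ sA sB P? = map′ (λ (a , b , p) → (a , b) , p) (λ ((a , b) , p) → a , b , p)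
                         (sA λ a → sB a λ b → P? (a , b))

search-refinement : ∀ {A : Set} {Q : A → Set} → Search A → (∀ a → Dec (Q a)) → Search [ a ∈ A ∣ Q a ]
search-refinement {A} {Q} sA Q? {P} P? = map′
  (λ (a , q , p) → (a , [ q ]) , p)
  (λ ((a , [ q ]) , p) → a , recompute (Q? a) q , p)
  (sA {λ a → Σ[ q ∈ Q a ] P (a , [ q ])} λ a → both a (Q? a))
  where
  both : ∀ a → Dec (Q a) → Dec (Σ[ q ∈ Q a ] P (a , [ q ]))
  both a (yes q) = map′ (q ,_) proj₂ (P? (a , [ q ]))
  both a (no ¬q) = no λ (q , _) → ¬q q

refinement-≟ : ∀ {A : Set} {Q : A → Set} → DecidableEquality A → DecidableEquality [ a ∈ A ∣ Q a ]
refinement-≟ _≟_ (a , p) (b , q) with a ≟ b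
... | yes refl = yes refl
... | no a≢b   = no λ eq → a≢b (cong value eq)

-- Walks and sequences of vertices

module _ {V : Set} {G : Graph V} where
  open Graph G

  ~-sym : ∀ {u v} → u ~ v → v ~ u
  ~-sym {u} {v} = subst T (adj-sym u v)

  infixr 5 _++_
  _++_ : ∀ {u v w a b} → Walk G u v a → Walk G v w b → Walk G u w (a + b)
  []      ++ q = q
  (e ∷ p) ++ q = e ∷ (p ++ q)

  snoc : ∀ {u v w a} → Walk G u v a → v ~ w → Walk G u w (suc a)
  snoc []      e = e ∷ []
  snoc (d ∷ p) e = d ∷ snoc p e

  reverse : ∀ {u v a} → Walk G u v a → Walk G v u a
  reverse []      = []
  reverse (e ∷ p) = snoc (reverse p) (~-sym e)

  at : ∀ {u v a} → Walk G u v a → ℕ → V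
  at {u} _       zero    = u
  at {u} []      (suc i) = u
  at     (e ∷ p) (suc i) = at p i

  at-end : ∀ {u v a} (p : Walk G u v a) → at p a ≡ v
  at-end []      = refl
  at-end (e ∷ p) = at-end p

  at-step : ∀ {u v a} (p : Walk G u v a) i → i < a → at p i ~ at p (suc i)
  at-step (e ∷ p)       (suc i) (s≤s i<a) = at-step p i i<a
  at-step (e ∷ [])      zero    i<a = e
  at-step (e ∷ (_ ∷ _)) zero    i<a = e

  prefix : ∀ {u v a} (p : Walk G u v a) i → i ≤ a → Walk G u (at p i) i
  prefix p       zero    _         = []
  prefix (e ∷ p) (suc i) (s≤s i≤a) = e ∷ prefix p i i≤a

  suffix : ∀ {u v a} (p : Walk G u v a) i → i ≤ a → ∃[ j ] i + j ≡ a × Walk G (at p i) v j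
  suffix p       zero    _         = _ , refl , p
  suffix (e ∷ p) (suc i) (s≤s i≤a) = let j , eq , q = suffix p i i≤a in j , cong suc eq , q

  Steps : (ℕ → V) → ℕ → ℕ → Set
  Steps q a b = ∀ i → a ≤ i → i < b → q i ~ q (suc i)

  segment : ∀ (q : ℕ → V) a d → Steps q a (a + d) → Walk G (q a) (q (a + d)) d
  segment q a zero    h = subst (λ x → Walk G (q a) (q x) 0) (sym (+-identityʳ a)) []
  segment q a (suc d) h = subst (λ x → Walk G (q a) (q x) (suc d)) (sym (+-suc a d))
    (snoc (segment q a d λ i a≤i i<a+d → h i a≤i (<-trans i<a+d (subst (a + d <_) (sym (+-suc a d)) (n<1+n _))))
          (h (a + d) (m≤m+n a d) (subst (a + d <_) (sym (+-suc a d)) (n<1+n _))))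

  segment-≤ : ∀ (q : ℕ → V) {a b} → a ≤ b → Steps q a b → ∃[ d ] a + d ≡ b × Walk G (q a) (q b) d
  segment-≤ q {a} {b} a≤b h with m≤n⇒∃[o]m+o≡n a≤b
  ... | d , refl = d , refl , segment q a d h

module Decide {V : Set} (G : Graph V) (search : Search V) (_≟ⱽ_ : DecidableEquality V) where
  open Graph G

  walk? : ∀ n u v → Dec (Walk G u v n)
  walk? zero u v = map′ (λ { refl → [] }) (λ { [] → refl }) (u ≟ⱽ v)
  walk? (suc n) u v = map′ (λ (x , e , p) → e ∷ p) (λ { (e ∷ p) → _ , e , p })
                           (search λ x → T? (adj u x) ×-dec walk? n x v)

  walk⇒dist≤ : ∀ {u v n r} → Walk G u v n → n ≤ r → Dist≤ G u v r
  walk⇒dist≤ {u} {v} {n} p n≤r with least (λ d → walk? d u v) n p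
  ... | d , q , d≤n , min = d , (q , min _) , ≤-trans d≤n n≤r

  dist≤? : ∀ u v r → Dec (Dist≤ G u v r)
  dist≤? u v r = map′ (λ (d , d<1+r , p) → walk⇒dist≤ p (≤-pred d<1+r))
                      (λ (d , (p , _) , d≤r) → d , s≤s d≤r , p)
                      (anyUpTo? (λ d → walk? d u v) (suc r))

  centre⇒radius≤ : ∀ {w} → HasCentre G w → Radius≤ G w
  centre⇒radius≤ {w} c with least (λ s → search λ c → search-all search λ v → dist≤? c v s) w c
  ... | r , c′ , r≤w , min = r , (c′ , min _) , r≤w

-- An element is taken if it satisfies `A` and has no `↝` to an element taken before it. Values of
-- `selected` at ranks from `b` on carry no meaning, hence the guards; elements of equal rank are
-- never compared.
record Greedy {n : ℕ} (A : Fin n → Set) (_↝_ : Fin n → Fin n → Set) (rank : Fin n → ℕ) (b : ℕ) : Set where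
  field
    selected    : Fin n → Bool
    sound       : ∀ v → rank v < b → T (selected v) → A v
    independent : ∀ v v′ → rank v < b → T (selected v) → T (selected v′) → rank v′ < rank v → ¬ v ↝ v′
    dominating  : ∀ v → rank v < b → A v →
                  T (selected v) ⊎ ∃[ v′ ] T (selected v′) × rank v′ < rank v × v ↝ v′

greedy : ∀ {n} {A : Fin n → Set} {_↝_ : Fin n → Fin n → Set} (rank : Fin n → ℕ) →
         (∀ v → Dec (A v)) → (∀ v v′ → Dec (v ↝ v′)) → ∀ b → Greedy A _↝_ rank b
greedy rank A? _↝?_ zero = record
  { selected = λ _ → false ; sound = λ _ () ; independent = λ _ _ () ; dominating = λ _ () }
greedy {n} {A} {_↝_} rank A? _↝?_ (suc b) = record
  { selected    = selected′
  ; sound       = λ v rk t → case split v rk of λ where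
      (inj₁ lt) → sound v lt (subst T (old v lt) t)
      (inj₂ eq) → proj₁ (toWitness (subst T (new v eq) t))
  ; independent = λ v v′ rk t t′ lt′ v↝v′ → case split v rk of λ where
      (inj₁ lt) → independent v v′ lt (subst T (old v lt) t) (subst T (old v′ (<-trans lt′ lt)) t′) lt′ v↝v′
      (inj₂ eq) → proj₂ (toWitness (subst T (new v eq) t))
                    (v′ , subst T (old v′ (subst (rank v′ <_) eq lt′)) t′ , lt′ , v↝v′)
  ; dominating  = λ v rk a → case split v rk of λ where
      (inj₁ lt) → case dominating v lt a of λ where
        (inj₁ t) → inj₁ (subst T (sym (old v lt)) t)
        (inj₂ (v′ , t′ , lt′ , r)) → inj₂ (v′ , subst T (sym (old v′ (<-trans lt′ lt))) t′ , lt′ , r)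
      (inj₂ eq) → case earlier? v of λ where
        (yes (v′ , t′ , lt′ , r)) → inj₂ (v′ , subst T (sym (old v′ (subst (rank v′ <_) eq lt′))) t′ , lt′ , r)
        (no none) → inj₁ (subst T (sym (new v eq)) (fromWitness (a , none)))
  }
  where
  open Greedy (greedy {_↝_ = _↝_} rank A? _↝?_ b)
  earlier? : ∀ v → Dec (∃[ v′ ] T (selected v′) × rank v′ < rank v × v ↝ v′)
  earlier? v = Fin.any? λ v′ → T? (selected v′) ×-dec (rank v′ <? rank v) ×-dec (v ↝? v′)
  select? : ∀ v → Dec (A v × ¬ (∃[ v′ ] T (selected v′) × rank v′ < rank v × v ↝ v′))
  select? v = A? v ×-dec ¬? (earlier? v)
  selected′ : Fin n → Bool
  selected′ v = if does (rank v <? b) then selected v else ⌊ select? v ⌋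
  old : ∀ v → rank v < b → selected′ v ≡ selected v
  old v lt rewrite dec-true (rank v <? b) lt = refl
  new : ∀ v → rank v ≡ b → selected′ v ≡ ⌊ select? v ⌋
  new v eq rewrite dec-false (rank v <? b) (λ lt → <-irrefl eq lt) = refl
  split : ∀ v → rank v < suc b → rank v < b ⊎ rank v ≡ b
  split v rk = m≤n⇒m<n∨m≡n (≤-pred rk)

-- Subdivisions

does⁺ : ∀ {A : Set} (A? : Dec A) → A → T (does A?)
does⁺ A? a = subst T (sym (dec-true A? a)) tt

does⁻ : ∀ {A : Set} (A? : Dec A) → T (does A?) → A
does⁻ (yes a) _ = a

-- The sequence g 0, …, g (a - 1), h 0, h 1, ….
join : {A : Set} → ℕ → (ℕ → A) → (ℕ → A) → ℕ → A
join zero    g h i       = h i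
join (suc a) g h zero    = g zero
join (suc a) g h (suc i) = join a (g ∘ suc) h i

module _ {A : Set} where
  join-≥ : ∀ a (g h : ℕ → A) i → join a g h (a + i) ≡ h i
  join-≥ zero    g h i = refl
  join-≥ (suc a) g h i = join-≥ a (g ∘ suc) h i

  join-≤ : ∀ a (g h : ℕ → A) → g a ≡ h 0 → ∀ i → i ≤ a → join a g h i ≡ g i
  join-≤ zero    g h eq zero    _         = sym eq
  join-≤ (suc a) g h eq zero    _         = refl
  join-≤ (suc a) g h eq (suc i) (s≤s i≤a) = join-≤ a (g ∘ suc) h eq i i≤a

  join-step : ∀ (R : A → A → Set) a b (g h : ℕ → A) → g a ≡ h 0 →
              (∀ i → i < a → R (g i) (g (suc i))) → (∀ i → i < b → R (h i) (h (suc i))) →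
              ∀ i → i < a + b → R (join a g h i) (join a g h (suc i))
  join-step R zero    b g h eq G H i       i<b         = H i i<b
  join-step R (suc a) b g h eq G H zero    _           =
    subst (R (g 0)) (sym (join-≤ a (g ∘ suc) h eq 0 z≤n)) (G 0 z<s)
  join-step R (suc a) b g h eq G H (suc i) (s≤s i<a+b) =
    join-step R a b (g ∘ suc) h eq (λ i i<a → G (suc i) (s≤s i<a)) H i i<a+b

  join-all : ∀ (P : ℕ → A → Set) a b (g h : ℕ → A) →
             (∀ i → i ≤ a → P i (g i)) → (∀ i → i ≤ b → P (a + i) (h i)) →
             ∀ i → i ≤ a + b → P i (join a g h i)
  join-all P zero    b g h G H i       i≤b         = H i i≤b
  join-all P (suc a) b g h G H zero    _           = G 0 z≤n
  join-all P (suc a) b g h G H (suc i) (s≤s i≤a+b) =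
    join-all (P ∘ suc) a b (g ∘ suc) h (λ i i≤a → G (suc i) (s≤s i≤a)) H i i≤a+b

∸-step : ∀ {n i} → i < n → n ∸ i ≡ suc (n ∸ suc i)
∸-step {n} {i} i<n = +-∸-assoc 1 {n} {suc i} i<n

module _ {n : ℕ} {X : Graph (Fin n)} where
  edge-≟ : DecidableEquality (Edge X)
  edge-≟ (edge s t _ _) (edge s′ t′ _ _) with s Fin.≟ s′ | t Fin.≟ t′
  ... | yes refl | yes refl = yes refl
  ... | no s≢s′  | _        = no λ eq → s≢s′ (cong src eq)
  ... | yes _    | no t≢t′  = no λ eq → t≢t′ (cong tgt eq)

  search-edge : Search (Edge X)
  search-edge {P} P? = map′
    (λ (s , t , o , a , p) → edge s t o a , p)
    (λ (edge s t o a , p) → s , t , recompute (s Fin.<? t) o , recompute (T? (Graph.adj X s t)) a , p)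
    (Fin.any? λ s → Fin.any? λ t → both s t (s Fin.<? t) (T? (Graph.adj X s t)))
    where
    both : ∀ s t → Dec (s Fin.< t) → Dec (Graph._~_ X s t) →
           Dec (Σ[ o ∈ s Fin.< t ] Σ[ a ∈ Graph._~_ X s t ] P (edge s t o a))
    both s t (yes o) (yes a) = map′ (λ p → o , a , p) (λ (_ , _ , p) → p) (P? (edge s t o a))
    both s t (no ¬o) _       = no λ (o , _) → ¬o o
    both s t _       (no ¬a) = no λ (_ , a , _) → ¬a a

module Subdivide {n : ℕ} (X : Graph (Fin n)) (ℓ : Edge X → ℕ) where
  Vertex : Set
  Vertex = Point X ℓ

  search-vertex : Search Vertex
  search-vertex = search-⊎ Fin.any? (search-Σ search-edge λ e → Fin.any?)

  vertex-≟ : DecidableEquality Vertex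
  vertex-≟ = Sum.≡-dec Fin._≟_ (Product.≡-dec edge-≟ Fin._≟_)

  -- The relation `At` as a function: the paths of the subdivision become sequences, to which
  -- `segment` and `join` apply.
  pt : Edge X → ℕ → Vertex
  pt e zero = inj₁ (src e)
  pt e (suc i) with i <? ℓ e
  ... | yes i<ℓ = inj₂ (e , fromℕ< i<ℓ)
  ... | no  _   = inj₁ (tgt e)

  pt-at : ∀ e i → i ≤ suc (ℓ e) → At X ℓ e i (pt e i)
  pt-at e zero    _ = source
  pt-at e (suc i) (s≤s i≤ℓ) with i <? ℓ e
  ... | yes i<ℓ = subst (λ j → At X ℓ e (suc j) (inj₂ (e , fromℕ< i<ℓ))) (Fin.toℕ-fromℕ< i<ℓ) (inner (fromℕ< i<ℓ))
  ... | no  i≮ℓ rewrite ≤-antisym i≤ℓ (≮⇒≥ i≮ℓ) = target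

  at⇒pt : ∀ {e i p} → At X ℓ e i p → p ≡ pt e i
  at⇒pt source = refl
  at⇒pt {e} (inner j) with toℕ j <? ℓ e
  ... | yes j<ℓ = cong (λ j → inj₂ (e , j)) (sym (Fin.fromℕ<-toℕ j j<ℓ))
  ... | no  j≮ℓ = ⊥-elim (j≮ℓ (Fin.toℕ<n j))
  at⇒pt {e} target with ℓ e <? ℓ e
  ... | yes ℓ<ℓ = ⊥-elim (<-irrefl refl ℓ<ℓ)
  ... | no  _   = refl

  at-bound : ∀ {e i p} → At X ℓ e i p → i ≤ suc (ℓ e)
  at-bound source    = z≤n
  at-bound (inner j) = s≤s (<⇒≤ (Fin.toℕ<n j))
  at-bound target    = ≤-refl

  next : ∀ e i → i ≤ ℓ e → Next X ℓ (pt e i) (pt e (suc i))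
  next e i i≤ℓ = e , i , pt-at e i (≤-trans i≤ℓ (n≤1+n _)) , pt-at e (suc i) (s≤s i≤ℓ)

  next? : ∀ p q → Dec (Next X ℓ p q)
  next? p q = map′
    (λ { (e , i , s≤s i≤ℓ , refl , refl) → next e i i≤ℓ })
    (λ (e , i , a , b) → e , i , at-bound b , at⇒pt a , at⇒pt b)
    (search-edge λ e → anyUpTo? (λ i → vertex-≟ p (pt e i) ×-dec vertex-≟ q (pt e (suc i))) (suc (ℓ e)))

  next-irrefl : ∀ p → ¬ Next X ℓ p p
  next-irrefl (inj₁ v) (edge s t o a , i , at₀ , at₁) with end at₀ | end at₁
    where
    end : ∀ {e i v} → At X ℓ e i (inj₁ v) → (i ≡ 0 × v ≡ src e) ⊎ (i ≡ suc (ℓ e) × v ≡ tgt e)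
    end source = inj₁ (refl , refl)
    end target = inj₂ (refl , refl)
  ... | inj₁ (refl , v≡s) | inj₂ (_ , v≡t) = ⊥-elim-irr (Fin.<-irrefl (trans (sym v≡s) v≡t) o)
  ... | inj₂ (refl , _)   | _              = <-irrefl refl (at-bound at₁)
  next-irrefl (inj₂ x) (e , i , at₀ , at₁) = <-irrefl (trans (index at₀) (sym (index at₁))) (n<1+n i)
    where
    index : ∀ {e i x} → At X ℓ e i (inj₂ x) → i ≡ suc (toℕ (proj₂ x))
    index (inner j) = refl

  adjacent? : ∀ p q → Dec (Next X ℓ p q ⊎ Next X ℓ q p)
  adjacent? p q = next? p q ⊎-dec next? q p

  -- Abstract, since unfolding the decision procedure for adjacency is expensive.
  abstract
    graph : Graph Vertex
    graph = record
      { adj        = λ p q → does (adjacent? p q)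
      ; adj-sym    = λ p q → does-⇔ (mk⇔ Sum.swap Sum.swap) (adjacent? p q) (adjacent? q p)
      ; adj-irrefl = λ p → dec-false (adjacent? p p) [ next-irrefl p , next-irrefl p ]′
      }

    next⇒~ : ∀ {p q} → Next X ℓ p q → Graph._~_ graph p q
    next⇒~ {p} {q} nx = does⁺ (adjacent? p q) (inj₁ nx)

    ~⇒next : ∀ {p q} → Graph._~_ graph p q → Next X ℓ p q ⊎ Next X ℓ q p
    ~⇒next {p} {q} = does⁻ (adjacent? p q)

  open Graph graph using (_~_)

  pt-step : ∀ e i → i ≤ ℓ e → pt e i ~ pt e (suc i)
  pt-step e i i≤ℓ = next⇒~ (next e i i≤ℓ)

  isSubdivision : ∀ {k} → (∀ e → k ≤ ℓ e) → Subdivision k X graph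
  isSubdivision k≤ℓ = record
    { ℓ        = ℓ
    ; k≤ℓ      = k≤ℓ
    ; vertices = ↔-id Vertex
    ; edges    = λ p q → mk⇔ ~⇒next [ next⇒~ , ~-sym {G = graph} ∘ next⇒~ ]′
    }

  located : ∀ p → (∃[ v ] p ≡ inj₁ v) ⊎ (∃[ e ] ∃[ i ] i ≤ ℓ e × p ≡ pt e i)
  located (inj₁ v)       = inj₁ (v , refl)
  located (inj₂ (e , j)) = inj₂ (e , suc (toℕ j) , Fin.toℕ<n j , at⇒pt (inner j))

  module Embedding {V : Set} (G : Graph V) (ι₀ : Fin n → V) (γ : Edge X → ℕ → V)
    (γ-src : ∀ e → γ e 0 ≡ ι₀ (src e))
    (γ-tgt : ∀ e → γ e (suc (ℓ e)) ≡ ι₀ (tgt e))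
    (γ-step : ∀ e i → i ≤ ℓ e → Graph._~_ G (γ e i) (γ e (suc i)))
    where

    ι : Vertex → V
    ι (inj₁ v)       = ι₀ v
    ι (inj₂ (e , j)) = γ e (suc (toℕ j))

    ι-at : ∀ {e i p} → At X ℓ e i p → ι p ≡ γ e i
    ι-at source    = sym (γ-src _)
    ι-at (inner j) = refl
    ι-at target    = sym (γ-tgt _)

    ι-pt : ∀ e i → i ≤ suc (ℓ e) → ι (pt e i) ≡ γ e i
    ι-pt e i i≤ = ι-at (pt-at e i i≤)

    ι-next : ∀ {p q} → Next X ℓ p q → Graph._~_ G (ι p) (ι q)
    ι-next (e , i , a , b) =
      subst₂ (Graph._~_ G) (sym (ι-at a)) (sym (ι-at b)) (γ-step e i (≤-pred (at-bound b)))

    ι-adj : ∀ {p q} → p ~ q → Graph._~_ G (ι p) (ι q)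
    ι-adj t with ~⇒next t
    ... | inj₁ nx = ι-next nx
    ... | inj₂ nx = ~-sym {G = G} (ι-next nx)

    -- Quantifying over all walks avoids distances in `G`. The case of length 0 also yields the
    -- injectivity of `ι`, so that `contains` need not ask for it.
    Stretched : ℕ → Vertex → Vertex → Set
    Stretched c p q = ∀ {d} → Walk G (ι p) (ι q) d → ∃[ a ] Walk graph p q a × a ≤ c * d

    stretched-sym : ∀ {c p q} → Stretched c p q → Stretched c q p
    stretched-sym s w = let a , w′ , a≤ = s (reverse w) in a , reverse w′ , a≤

    contains : ∀ {k} c → (∀ e → k ≤ ℓ e) → (∀ p q → Stretched c p q) →
               ContainsQuasiGeodesicSubdivision c k X G
    contains c k≤ℓ stretched = Vertex , graph , isSubdivision k≤ℓ , subgraph , quasigeodesic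
      where
      collapse : ∀ {p q a} → Walk graph p q a → a ≤ c * 0 → p ≡ q
      collapse []      _  = refl
      collapse (_ ∷ _) le = ⊥-elim (n≮0 (≤-trans le (≤-reflexive (*-zeroʳ c))))
      subgraph : Subgraph graph G
      subgraph = record
        { ι = ι
        ; ι-injective = λ {p} {q} eq →
            let a , w , a≤ = stretched p q (subst (λ v → Walk G (ι p) v 0) eq []) in collapse w a≤
        ; ι-adj = ι-adj
        }
      quasigeodesic : QuasiGeodesic c subgraph
      quasigeodesic p q (w , _) =
        let a , w′ , a≤ = stretched p q w in Decide.walk⇒dist≤ graph search-vertex vertex-≟ w′ a≤

-- Geodesic cycles and parities of closed walks

-- Two sides of the triangle get length `k + 1`; the third absorbs the surplus `x`. The alternative
-- in `isometric` is that of the two arcs between two vertices of a cycle: one of them is no longer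
-- than the given walk.
module GeodesicCycle (k x : ℕ) {V : Set} (G : Graph V) (c : ℕ → V)
  (closed : c 0 ≡ c (suc k + (suc k + suc (k + x))))
  (c-step : ∀ i → i < suc k + (suc k + suc (k + x)) → Graph._~_ G (c i) (c (suc i)))
  (isometric : ∀ i l {d} → i + l ≤ suc k + (suc k + suc (k + x)) → Walk G (c i) (c (i + l)) d → l ≤ d ⊎ suc k + (suc k + suc (k + x)) ≤ l + d)
  where

  N : ℕ
  N = suc k + (suc k + suc (k + x))

  01ᵉ 12ᵉ 02ᵉ : Edge K³
  01ᵉ = edge 0F 1F (s≤s z≤n) tt
  12ᵉ = edge 1F 2F (s≤s (s≤s z≤n)) tt
  02ᵉ = edge 0F 2F (s≤s z≤n) tt

  edges : (P : Edge K³ → Set) → P 01ᵉ → P 12ᵉ → P 02ᵉ → ∀ e → P e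
  edges P p q r (edge 0F 0F _ ())
  edges P p q r (edge 0F 1F _ _) = p
  edges P p q r (edge 0F 2F _ _) = r
  edges P p q r (edge 1F 0F () _)
  edges P p q r (edge 1F 1F _ ())
  edges P p q r (edge 1F 2F _ _) = q
  edges P p q r (edge 2F 0F () _)
  edges P p q r (edge 2F 1F o _) = ⊥-elim-irr (case o of λ { (s≤s ()) })
  edges P p q r (edge 2F 2F _ ())

  ℓ : Edge K³ → ℕ
  ℓ (edge 0F 2F _ _) = k + x
  ℓ _                = k

  corner : Fin 3 → V
  corner 0F = c 0
  corner 1F = c (suc k)
  corner 2F = c (suc k + suc k)

  γ : Edge K³ → ℕ → V
  γ (edge 0F 2F _ _) i = c (N ∸ i)
  γ (edge 1F 2F _ _) i = c (suc k + i)
  γ _                i = c i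

  far-side : N ∸ suc (k + x) ≡ suc k + suc k
  far-side = trans (cong (_∸ suc (k + x)) (sym (+-assoc (suc k) (suc k) (suc (k + x)))))
                   (m+n∸n≡m (suc k + suc k) (suc (k + x)))

  γ-step : ∀ e i → i ≤ ℓ e → Graph._~_ G (γ e i) (γ e (suc i))
  γ-step = edges (λ e → ∀ i → i ≤ ℓ e → Graph._~_ G (γ e i) (γ e (suc i)))
    (λ i i≤k → c-step i (≤-trans (s≤s i≤k) (m≤m+n (suc k) _)))
    (λ i i≤k → subst (Graph._~_ G (c (suc k + i)) ∘ c) (sym (+-suc (suc k) i))
      (c-step (suc k + i) (lin 3 (λ i k x → i ≼ k ⇒
        goal (κ 1 ⊕ k ⊕ i ≺ κ 1 ⊕ k ⊕ (κ 1 ⊕ k ⊕ (κ 1 ⊕ (k ⊕ x))))) i k x i≤k)))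
    (λ i i≤k+x → let i<N = lin 3 (λ i k x → i ≼ k ⊕ x ⇒
                                goal (i ≺ κ 1 ⊕ k ⊕ (κ 1 ⊕ k ⊕ (κ 1 ⊕ (k ⊕ x))))) i k x i≤k+x in
      ~-sym {G = G} (subst (λ j → Graph._~_ G (c (N ∸ suc i)) (c j)) (sym (∸-step i<N))
        (c-step (N ∸ suc i) (≤-trans (≤-reflexive (sym (∸-step i<N))) (m∸n≤m N i)))))

  γ-src : ∀ e → γ e 0 ≡ corner (src e)
  γ-src = edges _ refl (cong c (+-identityʳ (suc k))) (sym closed)

  γ-tgt : ∀ e → γ e (suc (ℓ e)) ≡ corner (tgt e)
  γ-tgt = edges _ refl refl (cong c far-side)

  open Subdivide K³ ℓ
  open Embedding G corner γ γ-src γ-tgt γ-step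

  -- One turn around the triangle, with `02ᵉ` traversed backwards, so that `ι` carries `θ` to `c`.
  back θ₁ θ : ℕ → Vertex
  back i = pt 02ᵉ (suc (k + x) ∸ i)
  θ₁ = join (suc k) (pt 12ᵉ) back
  θ  = join (suc k) (pt 01ᵉ) θ₁

  pt-end : ∀ e → pt e (suc (ℓ e)) ≡ inj₁ (tgt e)
  pt-end e = sym (at⇒pt target)

  θ₁-start : θ₁ 0 ≡ inj₁ 1F
  θ₁-start = join-≤ (suc k) (pt 12ᵉ) back (trans (pt-end 12ᵉ) (sym (pt-end 02ᵉ))) 0 z≤n

  θ-step : ∀ i → i < N → Graph._~_ graph (θ i) (θ (suc i))
  θ-step = join-step (Graph._~_ graph) (suc k) (suc k + suc (k + x)) (pt 01ᵉ) θ₁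
    (trans (pt-end 01ᵉ) (sym θ₁-start))
    (λ i i<1+k → pt-step 01ᵉ i (≤-pred i<1+k))
    (join-step (Graph._~_ graph) (suc k) (suc (k + x)) (pt 12ᵉ) back
      (trans (pt-end 12ᵉ) (sym (pt-end 02ᵉ)))
      (λ i i<1+k → pt-step 12ᵉ i (≤-pred i<1+k))
      (λ i i< → ~-sym {G = graph} (subst (λ j → Graph._~_ graph (back (suc i)) (pt 02ᵉ j)) (sym (∸-step i<))
        (pt-step 02ᵉ (k + x ∸ i) (m∸n≤m (k + x) i)))))

  θ-closed : θ N ≡ θ 0
  θ-closed = trans (join-≥ (suc k) (pt 01ᵉ) θ₁ (suc k + suc (k + x)))
            (trans (join-≥ (suc k) (pt 12ᵉ) back (suc (k + x)))
                   (cong (pt 02ᵉ) (n∸n≡0 (suc (k + x)))))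

  ι-θ : ∀ i → i ≤ N → ι (θ i) ≡ c i
  ι-θ = join-all (λ i p → ι p ≡ c i) (suc k) (suc k + suc (k + x)) (pt 01ᵉ) θ₁
    (λ i i≤ → ι-pt 01ᵉ i i≤)
    (join-all (λ i p → ι p ≡ c (suc k + i)) (suc k) (suc (k + x)) (pt 12ᵉ) back
      (λ i i≤ → ι-pt 12ᵉ i i≤)
      (λ i i≤ → trans (ι-pt 02ᵉ (suc (k + x) ∸ i) (m∸n≤m (suc (k + x)) i))
        (cong c (reflected i i≤))))
    where
    reflected : ∀ i → i ≤ suc (k + x) → N ∸ (suc (k + x) ∸ i) ≡ suc k + (suc k + i)
    reflected i i≤ = +-cancelʳ-≡ (suc (k + x) ∸ i) _ _ (trans
      (m∸n+n≡m (≤-trans (m∸n≤m (suc (k + x)) i) (≤-trans (m≤n+m _ (suc k)) (m≤n+m _ (suc k)))))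
      (lin 4 (λ k x i j → j ⊕ i ≐ κ 1 ⊕ (k ⊕ x) ⇒
         goal (κ 1 ⊕ k ⊕ (κ 1 ⊕ k ⊕ (κ 1 ⊕ (k ⊕ x))) ≐ κ 1 ⊕ k ⊕ (κ 1 ⊕ k ⊕ i) ⊕ j))
         k x i (suc (k + x) ∸ i) (m∸n+n≡m i≤)))

  θ-onto : ∀ p → ∃[ i ] i ≤ N × p ≡ θ i
  θ-onto p with located p
  ... | inj₁ (0F , refl) = 0 , z≤n , refl
  ... | inj₁ (1F , refl) = suc k + 0 , +-monoʳ-≤ (suc k) z≤n ,
    sym (trans (join-≥ (suc k) (pt 01ᵉ) θ₁ 0) θ₁-start)
  ... | inj₁ (2F , refl) = suc k + (suc k + 0) , +-monoʳ-≤ (suc k) (+-monoʳ-≤ (suc k) z≤n) ,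
    sym (trans (join-≥ (suc k) (pt 01ᵉ) θ₁ (suc k + 0))
        (trans (join-≥ (suc k) (pt 12ᵉ) back 0) (pt-end 02ᵉ)))
  ... | inj₂ (e , i , i≤ℓ , refl) = edges (λ e → ∀ i → i ≤ ℓ e → ∃[ j ] j ≤ N × pt e i ≡ θ j)
    (λ i i≤k → i , ≤-trans i≤k (≤-trans (n≤1+n k) (m≤m+n (suc k) _)) ,
      sym (join-≤ (suc k) (pt 01ᵉ) θ₁ (trans (pt-end 01ᵉ) (sym θ₁-start)) i (m≤n⇒m≤1+n i≤k)))
    (λ i i≤k → suc k + i , +-monoʳ-≤ (suc k) (≤-trans (m≤n⇒m≤1+n i≤k) (m≤m+n (suc k) _)) ,
      sym (trans (join-≥ (suc k) (pt 01ᵉ) θ₁ i)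
        (join-≤ (suc k) (pt 12ᵉ) back (trans (pt-end 12ᵉ) (sym (pt-end 02ᵉ))) i (m≤n⇒m≤1+n i≤k))))
    (λ i i≤k+x → suc k + (suc k + (suc (k + x) ∸ i)) ,
      +-monoʳ-≤ (suc k) (+-monoʳ-≤ (suc k) (m∸n≤m (suc (k + x)) i)) ,
      sym (trans (join-≥ (suc k) (pt 01ᵉ) θ₁ (suc k + (suc (k + x) ∸ i)))
          (trans (join-≥ (suc k) (pt 12ᵉ) back (suc (k + x) ∸ i))
                 (cong (pt 02ᵉ) (m∸[m∸n]≡n (m≤n⇒m≤1+n i≤k+x))))))
    e i i≤ℓ

  stretched-≤ : ∀ i l → i + l ≤ N → Stretched 1 (θ i) (θ (i + l))
  stretched-≤ i l i+l≤N {d} w with isometric i l i+l≤N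
      (subst₂ (λ u v → Walk G u v d) (ι-θ i (≤-trans (m≤m+n i l) i+l≤N)) (ι-θ (i + l) i+l≤N) w)
  ... | inj₁ l≤d = l , segment θ i l (λ j _ j< → θ-step j (≤-trans j< i+l≤N)) ,
                   ≤-trans l≤d (≤-reflexive (sym (*-identityˡ d)))
  -- The complementary arc, through the common vertex `θ 0` and `θ N`, has length `N - l ≤ d`.
  ... | inj₂ N≤l+d with segment-≤ {G = graph} θ i+l≤N (λ j _ j< → θ-step j j<)
  ...   | r , i+l+r≡N , w₁ = i + r ,
    reverse (segment θ 0 i λ j _ j< → θ-step j (≤-trans j< (≤-trans (m≤m+n i l) i+l≤N)))
      ++ subst (λ v → Walk graph v (θ (i + l)) r) θ-closed (reverse w₁) ,
    lin 5 (λ i l r N d → i ⊕ l ⊕ r ≐ N ⇒ N ≼ l ⊕ d ⇒ goal (i ⊕ r ≼ 1 · d)) i l r N d i+l+r≡N N≤l+d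

  stretched-θ : ∀ i j → i ≤ N → j ≤ N → Stretched 1 (θ i) (θ j)
  stretched-θ i j i≤N j≤N with between i j
  ... | up l refl   = stretched-≤ i l j≤N
  ... | down l refl = stretched-sym {1} {θ j} {θ (j + l)} (stretched-≤ j l i≤N)

  stretched : ∀ p q → Stretched 1 p q
  stretched p q = let i , i≤N , p≡ = θ-onto p ; j , j≤N , q≡ = θ-onto q in
    subst₂ (Stretched 1) (sym p≡) (sym q≡) (stretched-θ i j i≤N j≤N)

  contained : ContainsGeodesicSubdivision k K³ G
  contained = contains 1 (edges (λ e → k ≤ ℓ e) ≤-refl ≤-refl (m≤m+n k x)) stretched

xor-false⇒≡ : ∀ {a b} → a xor b ≡ false → a ≡ b
xor-false⇒≡ {false} {b}    eq = sym eq
xor-false⇒≡ {true}  {true} _  = refl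

xor-cancelˡ : ∀ a b → a xor (a xor b) ≡ b
xor-cancelˡ a b = trans (sym (xor-assoc a a b)) (cong (_xor b) (xor-same a))

module Marking {V : Set} (G : Graph V) (c : V → V → Bool) (c-sym : ∀ u v → c u v ≡ c v u) where
  open Graph G

  par : ∀ {u v n} → Walk G u v n → Bool
  par [] = false
  par (_∷_ {u} {v} e p) = c u v xor par p

  par-++ : ∀ {u v w a b} (p : Walk G u v a) (q : Walk G v w b) → par (p ++ q) ≡ par p xor par q
  par-++ []      q = refl
  par-++ (_∷_ {u} {v} e p) q = trans (cong (c u v xor_) (par-++ p q)) (sym (xor-assoc (c u v) (par p) (par q)))

  par-snoc : ∀ {u v w a} (p : Walk G u v a) (e : v ~ w) → par (snoc p e) ≡ par p xor c v w
  par-snoc {v = v} {w} [] e = xor-identityʳ (c v w)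
  par-snoc {w = w} (_∷_ {u} {v} d p) e = trans (cong (c u v xor_) (par-snoc p e)) (sym (xor-assoc (c u v) (par p) _))

  par-reverse : ∀ {u v a} (p : Walk G u v a) → par (reverse p) ≡ par p
  par-reverse [] = refl
  par-reverse (_∷_ {u} {v} e p) = trans (par-snoc (reverse p) (~-sym {G = G} e))
    (trans (cong₂ _xor_ (par-reverse p) (c-sym v u)) (xor-comm (par p) (c u v)))

  cut-walk : ∀ {u v n} (w : Walk G u v n) i → i ≤ n →
             ∃[ j ] i + j ≡ n × Σ[ p ∈ Walk G u (at w i) i ] Σ[ q ∈ Walk G (at w i) v j ]
               par w ≡ par p xor par q × (∀ l → at q l ≡ at w (i + l))
  cut-walk w       zero    _         = _ , refl , [] , w , refl , λ _ → refl
  cut-walk (_∷_ {u} {v} e w) (suc i) (s≤s i≤n) with cut-walk w i i≤n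
  ... | j , eq , p , q , par≡ , at≡ =
    j , cong suc eq , e ∷ p , q ,
    trans (cong (c u v xor_) par≡) (sym (xor-assoc (c u v) (par p) (par q))) , at≡

  module _ (search : Search V) (_≟ⱽ_ : DecidableEquality V) where
    -- Decidability for each length lets `least` find a shortest odd closed walk.
    parity? : ∀ n u v b → Dec (Σ[ w ∈ Walk G u v n ] par w ≡ b)
    parity? zero u v b = map′ (λ { (refl , eq) → [] , eq }) (λ { ([] , eq) → refl , eq })
                              ((u ≟ⱽ v) ×-dec (false Bool.≟ b))
    parity? (suc n) u v b = map′
      (λ (x , e , w , eq) → e ∷ w , trans (cong (c u x xor_) eq) (xor-cancelˡ (c u x) b))
      (λ { (_∷_ {v = x} e w , eq) → x , e , w , trans (sym (xor-cancelˡ (c u x) (par w))) (cong (c u x xor_) eq) })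
      (search λ x → T? (adj u x) ×-dec parity? n x v (c u x xor b))

    -- A shortest closed walk of odd parity is a geodesic cycle: a shortcut
    -- would split it into two shorter closed walks, one of them odd.
    all-even : ∀ k → ¬ ContainsGeodesicSubdivision k K³ G →
               (∀ {v n} (w : Walk G v v n) → n ≤ 3 * k + 2 → par w ≡ false) →
               ∀ {v n} (w : Walk G v v n) → par w ≡ false
    all-even k no-cycle short {v} {n} w with par w in odd
    ... | false = refl
    ... | true with least (λ n → search λ v → parity? n v v true) n (v , w , odd)
    ...   | N , (v₀ , w₀ , odd₀) , _ , minimal =
      ⊥-elim (contradiction (3 * k + 3 ≤? N))
      where
      even : ∀ {v n} (p : Walk G v v n) → n < N → par p ≡ false
      even p n<N with par p in eq
      ... | false = refl
      ... | true  = ⊥-elim (<⇒≱ n<N (minimal _ (_ , p , eq)))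

      isometric : ∀ i l {d} → i + l ≤ N → Walk G (at w₀ i) (at w₀ (i + l)) d → l ≤ d ⊎ N ≤ l + d
      isometric i l {d} i+l≤N g₀ with l ≤? d | N ≤? l + d
      ... | yes l≤d | _         = inj₁ l≤d
      ... | no  _   | yes N≤l+d = inj₂ N≤l+d
      ... | no  l≰d | no  N≰l+d with cut-walk w₀ i (≤-trans (m≤m+n i l) i+l≤N)
      ...   | j , i+j≡N , p , q , par₀ , at-q
        with cut-walk q l (lin 4 (λ i j l N → i ⊕ l ≼ N ⇒ i ⊕ j ≐ N ⇒ goal (l ≼ j)) i j l N i+l≤N i+j≡N)
      ...     | j′ , l+j′≡j , q₁ , q₂ , par₁ , _ = ⊥-elim (case trans (sym odd₀) even₀ of λ ())
        where
        g = subst (λ x → Walk G (at w₀ i) x d) (sym (at-q l)) g₀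
        detour : par q₁ ≡ par g
        detour = xor-false⇒≡ (trans (cong (par q₁ xor_) (sym (par-reverse g)))
          (trans (sym (par-++ q₁ (reverse g))) (even (q₁ ++ reverse g) (≰⇒> N≰l+d))))
        shortened : par p xor (par g xor par q₂) ≡ false
        shortened = trans (cong (par p xor_) (sym (par-++ g q₂))) (trans (sym (par-++ p (g ++ q₂)))
          (even (p ++ (g ++ q₂)) (lin 6 (λ i j j′ l d N → i ⊕ j ≐ N ⇒ l ⊕ j′ ≐ j ⇒ d ≺ l ⇒
            goal (i ⊕ (d ⊕ j′) ≺ N)) i j j′ l d N i+j≡N l+j′≡j (≰⇒> l≰d))))
        even₀ : par w₀ ≡ false
        even₀ = trans par₀ (trans (cong (par p xor_) (trans par₁ (cong (_xor par q₂) detour))) shortened)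

      contradiction : Dec (3 * k + 3 ≤ N) → ⊥
      contradiction (no N≱) = case trans (sym odd₀) (short w₀
        (lin 2 (λ k N → N ≺ 3 · k ⊕ κ 3 ⇒ goal (N ≼ 3 · k ⊕ κ 2)) k N (≰⇒> N≱))) of λ ()
      contradiction (yes N≥) with m≤n⇒∃[o]m+o≡n N≥
      ... | x , eq = no-cycle (GeodesicCycle.contained k x G (at w₀)
          (sym (trans (cong (at w₀) N≡) (at-end w₀)))
          (λ i i< → at-step w₀ i (subst (i <_) N≡ i<))
          (λ i l i+l≤ g → subst (λ N → l ≤ _ ⊎ N ≤ l + _) (sym N≡) (isometric i l (subst (i + l ≤_) N≡ i+l≤) g)))
        where
        N≡ : suc k + (suc k + suc (k + x)) ≡ N
        N≡ = lin 3 (λ k x N → 3 · k ⊕ κ 3 ⊕ x ≐ N ⇒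
          goal (κ 1 ⊕ k ⊕ (κ 1 ⊕ k ⊕ (κ 1 ⊕ (k ⊕ x))) ≐ N)) k x N eq

-- Wrenches

-- σ is a geodesic and τ, τ′ are shortest paths to it that end at distance
-- suc g from each other and at distance suc h from the ends of σ.
module QuasiGeodesicWrench (h g : ℕ) (4h≤g : 4 * suc h ≤ suc g) {V : Set} (G : Graph V) (σ τ τ′ : ℕ → V)
  (σ-step : ∀ i → i < suc h + (suc g + suc h) → Graph._~_ G (σ i) (σ (suc i)))
  (σ-geodesic : ∀ i l {d} → i + l ≤ suc h + (suc g + suc h) → Walk G (σ i) (σ (i + l)) d → l ≤ d)
  (τ-start : τ 0 ≡ σ (suc h))
  (τ-step : ∀ a → a < suc h → Graph._~_ G (τ a) (τ (suc a)))
  (τ-geodesic : ∀ a l {d} → a + l ≤ suc h → Walk G (τ a) (τ (a + l)) d → l ≤ d)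
  (τ-shortest : ∀ a i {d} → a ≤ suc h → i ≤ suc h + (suc g + suc h) → Walk G (τ a) (σ i) d → a ≤ d)
  (τ′-start : τ′ 0 ≡ σ (suc h + suc g))
  (τ′-step : ∀ a → a < suc h → Graph._~_ G (τ′ a) (τ′ (suc a)))
  (τ′-geodesic : ∀ a l {d} → a + l ≤ suc h → Walk G (τ′ a) (τ′ (a + l)) d → l ≤ d)
  (τ′-shortest : ∀ a i {d} → a ≤ suc h → i ≤ suc h + (suc g + suc h) → Walk G (τ′ a) (σ i) d → a ≤ d)
  where

  N : ℕ
  N = suc h + (suc g + suc h)

  01ᵉ 02ᵉ 03ᵉ 14ᵉ 15ᵉ : Edge wrench
  01ᵉ = edge 0F 1F (s≤s z≤n) tt
  02ᵉ = edge 0F 2F (s≤s z≤n) tt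
  03ᵉ = edge 0F 3F (s≤s z≤n) tt
  14ᵉ = edge 1F 4F (s≤s (s≤s z≤n)) tt
  15ᵉ = edge 1F 5F (s≤s (s≤s z≤n)) tt

  edges : (P : Edge wrench → Set) → P 01ᵉ → P 02ᵉ → P 03ᵉ → P 14ᵉ → P 15ᵉ → ∀ e → P e
  edges P p q r s t (edge 0F 0F _ ())
  edges P p q r s t (edge 0F 1F _ _) = p
  edges P p q r s t (edge 0F 2F _ _) = q
  edges P p q r s t (edge 0F 3F _ _) = r
  edges P p q r s t (edge 0F 4F _ ())
  edges P p q r s t (edge 0F 5F _ ())
  edges P p q r s t (edge 1F 0F () _)
  edges P p q r s t (edge 1F 1F _ ())
  edges P p q r s t (edge 1F 2F _ ())
  edges P p q r s t (edge 1F 3F _ ())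
  edges P p q r s t (edge 1F 4F _ _) = s
  edges P p q r s t (edge 1F 5F _ _) = t
  edges P p q r s t (edge 2F 0F () _)
  edges P p q r s t (edge 2F 1F _ ())
  edges P p q r s t (edge 2F 2F _ ())
  edges P p q r s t (edge 2F 3F _ ())
  edges P p q r s t (edge 2F 4F _ ())
  edges P p q r s t (edge 2F 5F _ ())
  edges P p q r s t (edge 3F 0F () _)
  edges P p q r s t (edge 3F 1F _ ())
  edges P p q r s t (edge 3F 2F _ ())
  edges P p q r s t (edge 3F 3F _ ())
  edges P p q r s t (edge 3F 4F _ ())
  edges P p q r s t (edge 3F 5F _ ())
  edges P p q r s t (edge 4F 0F _ ())
  edges P p q r s t (edge 4F 1F o _) = ⊥-elim-irr (case o of λ { (s≤s ()) })
  edges P p q r s t (edge 4F 2F _ ())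
  edges P p q r s t (edge 4F 3F _ ())
  edges P p q r s t (edge 4F 4F _ ())
  edges P p q r s t (edge 4F 5F _ ())
  edges P p q r s t (edge 5F 0F _ ())
  edges P p q r s t (edge 5F 1F o _) = ⊥-elim-irr (case o of λ { (s≤s ()) })
  edges P p q r s t (edge 5F 2F _ ())
  edges P p q r s t (edge 5F 3F _ ())
  edges P p q r s t (edge 5F 4F _ ())
  edges P p q r s t (edge 5F 5F _ ())

  ℓ : Edge wrench → ℕ
  ℓ (edge 0F 1F _ _) = g
  ℓ _                = h

  corner : Fin 6 → V
  corner 0F = σ (suc h)
  corner 1F = σ (suc h + suc g)
  corner 2F = σ 0
  corner 3F = τ (suc h)
  corner 4F = σ N
  corner 5F = τ′ (suc h)

  γ : Edge wrench → ℕ → V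
  γ (edge 0F 1F _ _) i = σ (suc h + i)
  γ (edge 0F 2F _ _) i = σ (suc h ∸ i)
  γ (edge 0F 3F _ _) i = τ i
  γ (edge 1F 4F _ _) i = σ (suc h + (suc g + i))
  γ _                i = τ′ i

  private
    _~_ : V → V → Set
    _~_ = Graph._~_ G

  γ-step : ∀ e i → i ≤ ℓ e → γ e i ~ γ e (suc i)
  γ-step = edges (λ e → ∀ i → i ≤ ℓ e → γ e i ~ γ e (suc i))
    (λ i i≤g → subst (λ j → σ (suc h + i) ~ σ j) (sym (+-suc (suc h) i))
      (σ-step (suc h + i) (lin 3 (λ i g h → i ≼ g ⇒ goal (κ 1 ⊕ h ⊕ i ≺ κ 1 ⊕ h ⊕ (κ 1 ⊕ g ⊕ (κ 1 ⊕ h))))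
        i g h i≤g)))
    (λ i i≤h → ~-sym {G = G} (subst (λ j → σ (h ∸ i) ~ σ j) (sym (∸-step (s≤s i≤h)))
      (σ-step (h ∸ i) (s≤s (≤-trans (m∸n≤m h i) (m≤m+n h _))))))
    (λ i i≤h → τ-step i (s≤s i≤h))
    (λ i i≤h → subst (λ j → σ (suc h + (suc g + i)) ~ σ j)
      (sym (trans (cong (suc h +_) (+-suc (suc g) i)) (+-suc (suc h) (suc g + i))))
      (σ-step (suc h + (suc g + i)) (lin 3 (λ i g h → i ≼ h ⇒
        goal (κ 1 ⊕ h ⊕ (κ 1 ⊕ g ⊕ i) ≺ κ 1 ⊕ h ⊕ (κ 1 ⊕ g ⊕ (κ 1 ⊕ h)))) i g h i≤h)))
    (λ i i≤h → τ′-step i (s≤s i≤h))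

  γ-src : ∀ e → γ e 0 ≡ corner (src e)
  γ-src = edges _ (cong σ (+-identityʳ (suc h))) refl τ-start
    (cong (λ j → σ (suc h + j)) (+-identityʳ (suc g))) τ′-start

  γ-tgt : ∀ e → γ e (suc (ℓ e)) ≡ corner (tgt e)
  γ-tgt = edges _ refl (cong σ (n∸n≡0 (suc h))) refl refl refl

  open Subdivide wrench ℓ
  open Embedding G corner γ γ-src γ-tgt γ-step

  -- The spine from corner `2F` over `0F` and `1F` to `4F`, parametrised so that `ι` carries `θ` to
  -- `σ`.
  back θ₁ θ : ℕ → Vertex
  back i = pt 02ᵉ (suc h ∸ i)
  θ₁ = join (suc g) (pt 01ᵉ) (pt 14ᵉ)
  θ  = join (suc h) back θ₁

  pt-end : ∀ e → pt e (suc (ℓ e)) ≡ inj₁ (tgt e)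
  pt-end e = sym (at⇒pt target)

  back-end : back (suc h) ≡ inj₁ 0F
  back-end = cong (pt 02ᵉ) (n∸n≡0 (suc h))

  θ₁-≤ : ∀ i → i ≤ suc g → θ₁ i ≡ pt 01ᵉ i
  θ₁-≤ = join-≤ (suc g) (pt 01ᵉ) (pt 14ᵉ) (pt-end 01ᵉ)

  back-θ₁ : back (suc h) ≡ θ₁ 0
  back-θ₁ = trans back-end (sym (θ₁-≤ 0 z≤n))

  θ-step : ∀ i → i < N → Graph._~_ graph (θ i) (θ (suc i))
  θ-step = join-step (Graph._~_ graph) (suc h) (suc g + suc h) back θ₁ back-θ₁
    (λ i i< → ~-sym {G = graph} (subst (λ j → Graph._~_ graph (back (suc i)) (pt 02ᵉ j)) (sym (∸-step i<))
        (pt-step 02ᵉ (h ∸ i) (m∸n≤m h i))))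
    (join-step (Graph._~_ graph) (suc g) (suc h) (pt 01ᵉ) (pt 14ᵉ) (pt-end 01ᵉ)
      (λ i i< → pt-step 01ᵉ i (≤-pred i<))
      (λ i i< → pt-step 14ᵉ i (≤-pred i<)))

  ι-θ : ∀ i → i ≤ N → ι (θ i) ≡ σ i
  ι-θ = join-all (λ i p → ι p ≡ σ i) (suc h) (suc g + suc h) back θ₁
    (λ i i≤ → trans (ι-pt 02ᵉ (suc h ∸ i) (m∸n≤m (suc h) i)) (cong σ (m∸[m∸n]≡n i≤)))
    (join-all (λ i p → ι p ≡ σ (suc h + i)) (suc g) (suc h) (pt 01ᵉ) (pt 14ᵉ)
      (λ i i≤ → ι-pt 01ᵉ i i≤)
      (λ i i≤ → ι-pt 14ᵉ i i≤))

  data Place (p : Vertex) : Set where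
    on-σ  : ∀ i → i ≤ N → p ≡ θ i → Place p
    on-τ  : ∀ a → a ≤ suc h → p ≡ pt 03ᵉ a → Place p
    on-τ′ : ∀ a → a ≤ suc h → p ≡ pt 15ᵉ a → Place p

  centre₀ : θ (suc h) ≡ inj₁ 0F
  centre₀ = trans (join-≤ (suc h) back θ₁ back-θ₁ (suc h) ≤-refl) back-end

  θ-right : ∀ i → θ (suc h + (suc g + i)) ≡ pt 14ᵉ i
  θ-right i = trans (join-≥ (suc h) back θ₁ (suc g + i)) (join-≥ (suc g) (pt 01ᵉ) (pt 14ᵉ) i)

  centre₁ : θ (suc h + suc g) ≡ inj₁ 1F
  centre₁ = trans (join-≥ (suc h) back θ₁ (suc g)) (trans (θ₁-≤ (suc g) ≤-refl) (pt-end 01ᵉ))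

  right-≤ : ∀ i → i ≤ suc h → suc h + (suc g + i) ≤ N
  right-≤ i i≤ = +-monoʳ-≤ (suc h) (+-monoʳ-≤ (suc g) i≤)

  centre₁-≤ : suc h + suc g ≤ N
  centre₁-≤ = +-monoʳ-≤ (suc h) (m≤m+n (suc g) (suc h))

  place : ∀ p → Place p
  place p with located p
  ... | inj₁ (0F , refl) = on-σ (suc h) (m≤m+n (suc h) _) (sym centre₀)
  ... | inj₁ (1F , refl) = on-σ (suc h + suc g) centre₁-≤ (sym centre₁)
  ... | inj₁ (2F , refl) = on-σ 0 z≤n (sym (trans (join-≤ (suc h) back θ₁ back-θ₁ 0 z≤n) (pt-end 02ᵉ)))
  ... | inj₁ (3F , refl) = on-τ (suc h) ≤-refl (sym (pt-end 03ᵉ))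
  ... | inj₁ (4F , refl) = on-σ N ≤-refl (sym (trans (θ-right (suc h)) (pt-end 14ᵉ)))
  ... | inj₁ (5F , refl) = on-τ′ (suc h) ≤-refl (sym (pt-end 15ᵉ))
  ... | inj₂ (e , i , i≤ℓ , refl) = edges (λ e → ∀ i → i ≤ ℓ e → Place (pt e i))
    (λ i i≤g → on-σ (suc h + i) (+-monoʳ-≤ (suc h) (m≤n⇒m≤1+n (≤-trans i≤g (m≤m+n g (suc h)))))
      (sym (trans (join-≥ (suc h) back θ₁ i) (θ₁-≤ i (m≤n⇒m≤1+n i≤g)))))
    (λ i i≤h → on-σ (suc h ∸ i) (≤-trans (m∸n≤m (suc h) i) (m≤m+n (suc h) _))
      (sym (trans (join-≤ (suc h) back θ₁ back-θ₁ (suc h ∸ i) (m∸n≤m (suc h) i))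
                  (cong (pt 02ᵉ) (m∸[m∸n]≡n (m≤n⇒m≤1+n i≤h))))))
    (λ i i≤h → on-τ i (m≤n⇒m≤1+n i≤h) refl)
    (λ i i≤h → on-σ (suc h + (suc g + i)) (right-≤ i (m≤n⇒m≤1+n i≤h)) (sym (θ-right i)))
    (λ i i≤h → on-τ′ i (m≤n⇒m≤1+n i≤h) refl)
    e i i≤ℓ

  θ-walk : ∀ i l → i + l ≤ N → Walk graph (θ i) (θ (i + l)) l
  θ-walk i l i+l≤N = segment θ i l λ j _ j< → θ-step j (≤-trans j< i+l≤N)

  leg-walk : ∀ e {L} → ℓ e ≡ L → ∀ i l → i + l ≤ suc L → Walk graph (pt e i) (pt e (i + l)) l
  leg-walk e refl i l i+l≤ = segment (pt e) i l λ j _ j< → pt-step e j (≤-pred (≤-trans j< i+l≤))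

  θ-distance : ∀ i j {d} → i ≤ N → j ≤ N → Walk G (σ i) (σ j) d → ∃[ a ] Walk graph (θ i) (θ j) a × a ≤ d
  θ-distance i j i≤N j≤N w with between i j
  ... | up   l refl = l , θ-walk i l j≤N , σ-geodesic i l j≤N w
  ... | down l refl = l , reverse (θ-walk j l i≤N) , σ-geodesic j l i≤N (reverse w)

  widen : ∀ {a d} → a ≤ d → a ≤ 3 * d
  widen {a} {d} = lin 2 (λ a d → a ≼ d ⇒ goal (a ≼ 3 · d)) a d

  leg-stretched : ∀ e → ℓ e ≡ h → (∀ a l {d} → a + l ≤ suc h → Walk G (γ e a) (γ e (a + l)) d → l ≤ d) →
                  ∀ a b → a ≤ suc h → b ≤ suc h → Stretched 3 (pt e a) (pt e b)
  leg-stretched e eq geodesic a b a≤ b≤ {d} w with between a b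
  ... | up l refl = l , leg-walk e eq a l b≤ , widen (geodesic a l b≤
          (subst₂ (λ u v → Walk G u v d) (ι-pt e a (subst (λ x → a ≤ suc x) (sym eq) a≤)) (ι-pt e (a + l) (subst (λ x → a + l ≤ suc x) (sym eq) b≤)) w))
  ... | down l refl = l , reverse (leg-walk e eq b l a≤) , widen (geodesic b l a≤
          (subst₂ (λ u v → Walk G u v d) (ι-pt e b (subst (λ x → b ≤ suc x) (sym eq) b≤)) (ι-pt e (b + l) (subst (λ x → b + l ≤ suc x) (sym eq) a≤)) (reverse w)))

  -- The leg attached at θ s: a walk from its a-th vertex to the spine is at
  -- least a long, so replacing its end by the foot of the leg at most doubles it.
  spine-stretched : ∀ e s → s ≤ N → ℓ e ≡ h → pt e 0 ≡ θ s → γ e 0 ≡ σ s →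
                    (∀ a → a < suc h → γ e a ~ γ e (suc a)) →
                    (∀ a i {d} → a ≤ suc h → i ≤ N → Walk G (γ e a) (σ i) d → a ≤ d) →
                    ∀ a i → a ≤ suc h → i ≤ N → Stretched 3 (pt e a) (θ i)
  spine-stretched e s s≤N eq foot γ-foot γ-steps shortest a i a≤ i≤N {d} w =
    let w′ = subst₂ (λ u v → Walk G u v d) (ι-pt e a (subst (λ x → a ≤ suc x) (sym eq) a≤)) (ι-θ i i≤N) w
        down-walk = segment (γ e) 0 a (λ j _ j< → γ-steps j (≤-trans j< a≤))
        b , spine , b≤ = θ-distance s i s≤N i≤N (subst (λ u → Walk G u (γ e a) a) γ-foot down-walk ++ w′)
        leg = subst (λ p → Walk graph p (pt e a) a) foot (leg-walk e eq 0 a a≤)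
    in a + b , reverse leg ++ spine ,
       lin 3 (λ a b d → a ≼ d ⇒ b ≼ a ⊕ d ⇒ goal (a ⊕ b ≼ 3 · d)) a b d (shortest a i a≤ i≤N w′) b≤

  -- The feet of the legs are `suc g` apart, so `d ≥ suc g - (a + b)`. As
  -- `a + b ≤ 2 (h + 1) ≤ suc g / 2` by `4h≤g`, this is at least `suc g / 2`, while the route
  -- through both feet has length at most three halves of `suc g`.
  legs-stretched : ∀ a b → a ≤ suc h → b ≤ suc h → Stretched 3 (pt 03ᵉ a) (pt 15ᵉ b)
  legs-stretched a b a≤ b≤ {d} w =
    a + (suc g + b) ,
    reverse (leg-walk 03ᵉ refl 0 a a≤)
      ++ subst₂ (λ p q → Walk graph p q (suc g)) centre₀ centre₁ (θ-walk (suc h) (suc g) centre₁-≤)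
      ++ leg-walk 15ᵉ refl 0 b b≤ ,
    lin 5 (λ a b g h d → a ≼ κ 1 ⊕ h ⇒ b ≼ κ 1 ⊕ h ⇒ 4 · (κ 1 ⊕ h) ≼ κ 1 ⊕ g ⇒ κ 1 ⊕ g ≼ a ⊕ (d ⊕ b) ⇒
      goal (a ⊕ (κ 1 ⊕ g ⊕ b) ≼ 3 · d)) a b g h d a≤ b≤ 4h≤g
      (σ-geodesic (suc h) (suc g) centre₁-≤
        (subst₂ (λ u v → Walk G u v (a + (d + b))) τ-start τ′-start
          (segment τ 0 a (λ j _ j< → τ-step j (≤-trans j< a≤))
            ++ subst₂ (λ u v → Walk G u v d) (ι-pt 03ᵉ a a≤) (ι-pt 15ᵉ b b≤) w
            ++ reverse (segment τ′ 0 b (λ j _ j< → τ′-step j (≤-trans j< b≤))))))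

  τσ : ∀ a i → a ≤ suc h → i ≤ N → Stretched 3 (pt 03ᵉ a) (θ i)
  τσ = spine-stretched 03ᵉ (suc h) (m≤m+n (suc h) _) refl (sym centre₀) τ-start τ-step τ-shortest

  τ′σ : ∀ a i → a ≤ suc h → i ≤ N → Stretched 3 (pt 15ᵉ a) (θ i)
  τ′σ = spine-stretched 15ᵉ (suc h + suc g) centre₁-≤ refl (sym centre₁) τ′-start τ′-step τ′-shortest

  stretched : ∀ {p q} → Place p → Place q → Stretched 3 p q
  stretched (on-σ i i≤ refl)  (on-σ j j≤ refl) {d} w =
    let a , w′ , a≤d = θ-distance i j i≤ j≤ (subst₂ (λ u v → Walk G u v d) (ι-θ i i≤) (ι-θ j j≤) w)
    in a , w′ , widen a≤d
  stretched (on-τ a a≤ refl)  (on-τ b b≤ refl)  = leg-stretched 03ᵉ refl τ-geodesic a b a≤ b≤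
  stretched (on-τ′ a a≤ refl) (on-τ′ b b≤ refl) = leg-stretched 15ᵉ refl τ′-geodesic a b a≤ b≤
  stretched (on-τ a a≤ refl)  (on-σ i i≤ refl)  = τσ a i a≤ i≤
  stretched (on-σ i i≤ refl)  (on-τ a a≤ refl)  = stretched-sym {3} {pt 03ᵉ a} {θ i} (τσ a i a≤ i≤)
  stretched (on-τ′ a a≤ refl) (on-σ i i≤ refl)  = τ′σ a i a≤ i≤
  stretched (on-σ i i≤ refl)  (on-τ′ a a≤ refl) = stretched-sym {3} {pt 15ᵉ a} {θ i} (τ′σ a i a≤ i≤)
  stretched (on-τ a a≤ refl)  (on-τ′ b b≤ refl) = legs-stretched a b a≤ b≤
  stretched (on-τ′ b b≤ refl) (on-τ a a≤ refl)  = stretched-sym {3} {pt 03ᵉ a} {pt 15ᵉ b} (legs-stretched a b a≤ b≤)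

  contained : ContainsQuasiGeodesicSubdivision 3 h wrench G
  contained = contains 3 (edges (λ e → h ≤ ℓ e)
      (lin 2 (λ h g → 4 · (κ 1 ⊕ h) ≼ κ 1 ⊕ g ⇒ goal (h ≼ g)) h g 4h≤g) ≤-refl ≤-refl ≤-refl ≤-refl)
    λ p q → stretched (place p) (place q)

-- Distances and cuts

module Distances {V : Set} (G : Graph V) (search : Search V) (_≟ⱽ_ : DecidableEquality V)
                 (connected : ∀ u v → ∃[ d ] Walk G u v d) where
  open Graph G
  open Decide G search _≟ⱽ_ using (walk?)

  abstract
    δ : V → V → ℕ
    δ u v = proj₁ (least (λ n → walk? n u v) (proj₁ (connected u v)) (proj₂ (connected u v)))

    geodesic : ∀ u v → Walk G u v (δ u v)
    geodesic u v = proj₁ (proj₂ (least (λ n → walk? n u v) (proj₁ (connected u v)) (proj₂ (connected u v))))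

    δ-min : ∀ {u v n} → Walk G u v n → δ u v ≤ n
    δ-min {u} {v} {n} p = proj₂ (proj₂ (proj₂ (least (λ n → walk? n u v) (proj₁ (connected u v)) (proj₂ (connected u v))))) n p

  δ-refl : ∀ v → δ v v ≡ 0
  δ-refl v = n≤0⇒n≡0 (δ-min [])

  δ-sym : ∀ u v → δ u v ≡ δ v u
  δ-sym u v = ≤-antisym (δ-min (reverse (geodesic v u))) (δ-min (reverse (geodesic u v)))

  δ-tri : ∀ u v w → δ u w ≤ δ u v + δ v w
  δ-tri u v w = δ-min (geodesic u v ++ geodesic v w)

  δ-step : ∀ w {u v} → u ~ v → δ w v ≤ suc (δ w u)
  δ-step w {u} e = δ-min (snoc (geodesic w u) e)

  δ-step′ : ∀ w {u v} → u ~ v → δ v w ≤ suc (δ u w)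
  δ-step′ w {u} e = δ-min (~-sym {G = G} e ∷ geodesic u w)

  δ-at : ∀ u v i → i ≤ δ u v → δ u (at (geodesic u v) i) ≡ i
  δ-at u v i i≤ = let j , i+j≡ , q = suffix (geodesic u v) i i≤ ; x = at (geodesic u v) i in
    lin 5 (λ i j uv ux xv → i ⊕ j ≐ uv ⇒ ux ≼ i ⇒ xv ≼ j ⇒ uv ≼ ux ⊕ xv ⇒ goal (ux ≐ i))
      i j (δ u v) (δ u x) (δ x v) i+j≡ (δ-min (prefix (geodesic u v) i i≤)) (δ-min q) (δ-tri u x v)

  δ-at′ : ∀ u v i → i ≤ δ u v → i + δ (at (geodesic u v) i) v ≡ δ u v
  δ-at′ u v i i≤ = let j , i+j≡ , q = suffix (geodesic u v) i i≤ ; x = at (geodesic u v) i in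
    lin 5 (λ i j uv ux xv → i ⊕ j ≐ uv ⇒ ux ≐ i ⇒ xv ≼ j ⇒ uv ≼ ux ⊕ xv ⇒ goal (i ⊕ xv ≐ uv))
      i j (δ u v) (δ u x) (δ x v) i+j≡ (δ-at u v i i≤) (δ-min q) (δ-tri u x v)

  -- Cuts across geodesics from a root

  module Rooted (root : V) (k : ℕ) where
    height : V → ℕ
    height = δ root

    q : V → ℕ → V
    q v = at (geodesic root v)

    q-height : ∀ v i → i ≤ height v → height (q v i) ≡ i
    q-height v = δ-at root v

    q-step : ∀ v i → i < height v → q v i ~ q v (suc i)
    q-step v = at-step (geodesic root v)

    q-end : ∀ v → q v (height v) ≡ v
    q-end v = at-end (geodesic root v)

    height-root : height root ≡ 0
    height-root = δ-refl root

    height-tri : ∀ x y → height x ≤ height y + δ x y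
    height-tri x y = subst (λ d → height x ≤ height y + d) (δ-sym y x) (δ-tri root y x)

    Near : V → V → Set
    Near v x = ∃[ i ] i ≤ height v × δ x (q v i) ≤ 3 * k

    abstract
      near? : ∀ v x → Dec (Near v x)
      near? v x = map′ (λ (i , i< , le) → i , ≤-pred i< , le) (λ (i , i≤ , le) → i , s≤s i≤ , le)
                       (anyUpTo? (λ i → δ x (q v i) ≤? 3 * k) (suc (height v)))

    record Exact (v z : V) (i : ℕ) : Set where
      field
        bounded  : i ≤ height v
        distance : δ z (q v i) ≡ suc (3 * k)
        far      : ∀ i′ → i′ ≤ height v → suc (3 * k) ≤ δ z (q v i′)

    exact? : ∀ v z i → Dec (Exact v z i)
    exact? v z i = map′
      (λ (b , d , f) → record { bounded = b ; distance = d ; far = λ i′ i′≤ → f (s≤s i′≤) })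
      (λ E → let open Exact E in bounded , distance , λ {i′} i′< → far i′ (≤-pred i′<))
      ((i ≤? height v) ×-dec (δ z (q v i) ≟ suc (3 * k))
        ×-dec allUpTo? (λ i′ → suc (3 * k) ≤? δ z (q v i′)) (suc (height v)))

    -- One step raises the distance to `q v i` by at most one, so a neighbour of `Near v` outside it
    -- is just one step too far from the geodesic.
    exact : ∀ {v z z′ i} → z′ ~ z → i ≤ height v → δ z′ (q v i) ≤ 3 * k → ¬ Near v z → Exact v z i
    exact {v} {z} {z′} {i} e i≤ d ¬near = record
      { bounded  = i≤
      ; distance = ≤-antisym (≤-trans (δ-step′ (q v i) e) (s≤s d)) (far i i≤)
      ; far      = far
      }
      where
      far : ∀ i′ → i′ ≤ height v → suc (3 * k) ≤ δ z (q v i′)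
      far i′ i′≤ = ≰⇒> λ le → ¬near (i′ , i′≤ , le)

    -- The first vertex at which a closed walk of length at most 3 k + 2 through
    -- an edge of Near v between heights j and suc j leaves Near v would be such a z.
    Clear : V → ℕ → Set
    Clear v j = ∀ e z i → 1 ≤ k → 2 * e ≤ 3 * k + 1 → Exact v z i → j ≤ height z + e → height z ≤ suc j + e → ⊥

    -- This is what it means that the marked edges separate `G`: they are the only edges between the
    -- two sides, and close to the geodesic the sides agree with the heights.
    record Cut (v : V) (j : ℕ) : Set where
      field
        side      : V → Bool
        near-side : ∀ x → Near v x → side x ≡ does (j <? height x)
        crossing  : ∀ {x y} → x ~ y → side x ≡ false → side y ≡ true →
                    Near v x × Near v y × height x ≡ j × height y ≡ suc j

      high : ∀ {x} → Near v x → j < height x → side x ≡ true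
      high {x} nx lt = trans (near-side x nx) (dec-true (j <? height x) lt)

      low : ∀ {x} → Near v x → height x ≤ j → side x ≡ false
      low {x} nx le = trans (near-side x nx) (dec-false (j <? height x) (≤⇒≯ le))

      near-high : ∀ {x} → Near v x → side x ≡ true → j < height x
      near-high {x} nx s with j <? height x
      ... | yes lt = lt
      ... | no ¬lt = case trans (sym s) (low nx (≮⇒≥ ¬lt)) of λ ()

      near-low : ∀ {x} → Near v x → side x ≡ false → height x ≤ j
      near-low {x} nx s with height x ≤? j
      ... | yes le = le
      ... | no ¬le = case trans (sym s) (high nx (≰⇒> ¬le)) of λ ()

      far-step : ∀ {x y} → x ~ y → ¬ Near v x → side x ≡ side y
      far-step {x} {y} e ¬nx with side x in sx | side y in sy
      ... | false | false = refl
      ... | true  | true  = refl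
      ... | false | true  = ⊥-elim (¬nx (proj₁ (crossing e sx sy)))
      ... | true  | false = ⊥-elim (¬nx (proj₁ (proj₂ (crossing (~-sym {G = G} e) sy sx))))

      -- A crossing edge has an end at height exactly `j`, so whatever stays higher keeps its side,
      -- however far from the geodesic it is.
      high-step : ∀ {x y} → x ~ y → j < height x → j < height y → side x ≡ side y
      high-step {x} {y} e hx hy with side x in sx | side y in sy
      ... | false | false = refl
      ... | true  | true  = refl
      ... | false | true  = ⊥-elim (<⇒≢ hx (sym (proj₁ (proj₂ (proj₂ (crossing e sx sy))))))
      ... | true  | false = ⊥-elim (<⇒≢ hy (sym (proj₁ (proj₂ (proj₂ (crossing (~-sym {G = G} e) sy sx))))))

      record Crossing (x y : V) (n : ℕ) : Set where
        field
          {lower upper} : V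
          {before after} : ℕ
          walk-before  : Walk G x lower before
          walk-after   : Walk G upper y after
          total        : before + suc after ≡ n
          near-lower   : Near v lower
          near-upper   : Near v upper
          height-lower : height lower ≡ j
          height-upper : height upper ≡ suc j

      cross : ∀ {x y n} → Walk G x y n → side x ≡ false → side y ≡ true → Crossing x y n
      cross [] sx sy = case trans (sym sx) sy of λ ()
      cross (_∷_ {v = z} e p) sx sy with side z in sz
      ... | true  = let n₀ , n₁ , h₀ , h₁ = crossing e sx sz in record
        { walk-before = [] ; walk-after = p ; total = refl ; near-lower = n₀ ; near-upper = n₁
        ; height-lower = h₀ ; height-upper = h₁ }
      ... | false = let open Crossing (cross p sz sy) in record
        { walk-before = e ∷ walk-before ; walk-after = walk-after ; total = cong suc total
        ; near-lower = near-lower ; near-upper = near-upper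
        ; height-lower = height-lower ; height-upper = height-upper }

      side-root : side root ≡ false
      side-root = low (0 , z≤n , subst (_≤ 3 * k) (sym (δ-refl root)) z≤n) (subst (_≤ j) (sym height-root) z≤n)

      -- The geodesic from `root` to `x` has to cross the cut. The upper end of the crossing edge
      -- lies on it, whence an equality for the height of `x` and not just a bound.
      descend : ∀ x → side x ≡ true → ∃[ y ] Near v y × height y ≡ suc j × height x ≡ suc j + δ y x
      descend x sx = upper , near-upper , height-upper ,
        lin 6 (λ b a h y d j → b ⊕ (κ 1 ⊕ a) ≐ h ⇒ y ≐ κ 1 ⊕ j ⇒ d ≼ a ⇒ j ≼ b ⇒ h ≼ y ⊕ d ⇒ goal (h ≐ κ 1 ⊕ j ⊕ d))
          before after (height x) (height upper) (δ upper x) j total height-upper (δ-min walk-after)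
          (subst (_≤ before) height-lower (δ-min walk-before)) (δ-tri root upper x)
        where open Crossing (cross (geodesic root x) side-root sx)

    module MakeCut (no-cycle : ¬ ContainsGeodesicSubdivision k K³ G) (v : V) (j : ℕ) (clear : Clear v j) where
      hi nb : V → Bool
      hi x = does (j <? height x)
      nb x = does (near? v x)

      mark : V → V → Bool
      mark x y = (nb x ∧ nb y) ∧ (hi x xor hi y)

      mark-sym : ∀ x y → mark x y ≡ mark y x
      mark-sym x y = cong₂ _∧_ (∧-comm (nb x) (nb y)) (xor-comm (hi x) (hi y))

      open Marking G mark mark-sym

      mark-near : ∀ {x y} → Near v x → Near v y → mark x y ≡ hi x xor hi y
      mark-near {x} {y} nx ny = cong (_∧ (hi x xor hi y)) (cong₂ _∧_ (dec-true (near? v x) nx) (dec-true (near? v y) ny))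

      marked : ∀ {x y} → mark x y ≡ true → Near v x × Near v y × hi x xor hi y ≡ true
      marked {x} {y} eq with near? v x | near? v y
      ... | yes nx | yes ny = nx , ny , eq

      hi-split : ∀ x → (hi x ≡ true × j < height x) ⊎ (hi x ≡ false × height x ≤ j)
      hi-split x with j <? height x
      ... | yes lt = inj₁ (dec-true (j <? height x) lt , lt)
      ... | no ¬lt = inj₂ (dec-false (j <? height x) ¬lt , ≮⇒≥ ¬lt)

      straddle : ∀ {x y} → x ~ y → hi x xor hi y ≡ true → (j ≤ height x × height x ≤ suc j) × (j ≤ height y × height y ≤ suc j)
      straddle {x} {y} e eq with hi-split x | hi-split y
      ... | inj₁ (hx , _)  | inj₁ (hy , _)  = case trans (sym (cong₂ _xor_ hx hy)) eq of λ ()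
      ... | inj₂ (hx , _)  | inj₂ (hy , _)  = case trans (sym (cong₂ _xor_ hx hy)) eq of λ ()
      ... | inj₁ (_ , lt)  | inj₂ (_ , le)  = let st = δ-step root (~-sym {G = G} e) in
        (<⇒≤ lt , ≤-trans st (s≤s le)) , (≤-pred (≤-trans lt st) , ≤-trans le (n≤1+n j))
      ... | inj₂ (_ , le)  | inj₁ (_ , lt)  = let st = δ-step root e in
        (≤-pred (≤-trans lt st) , ≤-trans le (n≤1+n j)) , (<⇒≤ lt , ≤-trans st (s≤s le))

      -- The first vertex `z` outside `Near v` would be `suc s` steps from one end and `suc t` from
      -- the other. The smaller of these serves as `e` in `Clear`: twice it is at most `3 k + 1`. As
      -- both are positive, the walk has at least two steps, which forces `1 ≤ k`.
      stay : ∀ {x y n} (w : Walk G y x n) → n ≤ 3 * k + 1 → Near v y → Near v x →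
             j ≤ height y × height y ≤ suc j → j ≤ height x × height x ≤ suc j → ∀ s → s ≤ n → Near v (at w s)
      stay w n≤ ny nx hy hx zero    _ = ny
      stay {x} {y} {n} w n≤ ny nx (y₀ , y₁) (x₀ , x₁) (suc s) s<n with near? v (at w (suc s))
      ... | yes nz = nz
      ... | no ¬nz with stay w n≤ ny nx (y₀ , y₁) (x₀ , x₁) s (<⇒≤ s<n) | suffix w (suc s) s<n
      ...   | _             | zero , _ , rest   = ⊥-elim (¬nz (subst (Near v) (sym (trivial rest)) nx))
        where
        trivial : ∀ {a b} → Walk G a b 0 → a ≡ b
        trivial [] = refl
      stay {x} {y} {n} w n≤ ny nx (y₀ , y₁) (x₀ , x₁) (suc s) s<n | no ¬nz
            | i , i≤ , d≤   | suc t , eq , rest = ⊥-elim (absurd (≤-total (suc s) (suc t)))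
        where
        z = at w (suc s)
        E = exact (at-step w s s<n) i≤ d≤ ¬nz
        1≤k : 1 ≤ k
        1≤k = lin 4 (λ s t n k → κ 1 ⊕ s ⊕ (κ 1 ⊕ t) ≐ n ⇒ n ≼ 3 · k ⊕ κ 1 ⇒ goal (κ 1 ≼ k)) s t n k eq n≤
        zy : δ z y ≤ suc s
        zy = δ-min (reverse (prefix w (suc s) s<n))
        yz : δ y z ≤ suc s
        yz = δ-min (prefix w (suc s) s<n)
        absurd : suc s ≤ suc t ⊎ suc t ≤ suc s → ⊥
        absurd (inj₁ s≤t) = clear (suc s) z i 1≤k
          (lin 4 (λ s t n k → s ≼ t ⇒ s ⊕ t ≐ n ⇒ n ≼ 3 · k ⊕ κ 1 ⇒ goal (2 · s ≼ 3 · k ⊕ κ 1)) (suc s) (suc t) n k s≤t eq n≤) E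
          (≤-trans y₀ (≤-trans (height-tri y z) (+-monoʳ-≤ (height z) yz)))
          (≤-trans (height-tri z y) (+-mono-≤ y₁ zy))
        absurd (inj₂ t≤s) = clear (suc t) z i 1≤k
          (lin 4 (λ s t n k → t ≼ s ⇒ s ⊕ t ≐ n ⇒ n ≼ 3 · k ⊕ κ 1 ⇒ goal (2 · t ≼ 3 · k ⊕ κ 1)) (suc s) (suc t) n k t≤s eq n≤) E
          (≤-trans x₀ (≤-trans (height-tri x z) (+-monoʳ-≤ (height z) (δ-min (reverse rest)))))
          (≤-trans (height-tri z x) (+-mono-≤ x₁ (δ-min rest)))

      -- Inside `Near v` an edge is marked exactly when `hi` changes along it, so the parities
      -- telescope.
      near-par : ∀ {x y n} (w : Walk G x y n) → (∀ s → s ≤ n → Near v (at w s)) → par w ≡ hi x xor hi y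
      near-par {x} [] near = sym (xor-same (hi x))
      near-par {x} {y} (_∷_ {v = z} e p) near = begin
        mark x z xor par p                    ≡⟨ cong₂ _xor_ (mark-near (near 0 z≤n) (near 1 (s≤s z≤n)))
                                                              (near-par p λ s s≤ → near (suc s) (s≤s s≤)) ⟩
        (hi x xor hi z) xor (hi z xor hi y)   ≡⟨ xor-assoc (hi x) (hi z) _ ⟩
        hi x xor (hi z xor (hi z xor hi y))   ≡⟨ cong (hi x xor_) (xor-cancelˡ (hi z) (hi y)) ⟩
        hi x xor hi y                         ∎
        where open ≡-Reasoning

      record MarkedEdge {x y n} (w : Walk G x y n) : Set where
        field
          {x′ y′} : V
          {a b} : ℕ
          before : Walk G x x′ a
          after  : Walk G y′ y b
          link   : x′ ~ y′
          is-marked : mark x′ y′ ≡ true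
          total  : a + suc b ≡ n
          par-split : par w ≡ par before xor (mark x′ y′ xor par after)

      find-marked : ∀ {x y n} (w : Walk G x y n) → par w ≡ false ⊎ MarkedEdge w
      find-marked [] = inj₁ refl
      find-marked (_∷_ {x} {z} e p) with mark x z in eq
      ... | true = inj₂ (record { before = [] ; after = p ; link = e ; is-marked = eq ; total = refl
                                ; par-split = refl })
      ... | false with find-marked p
      ...   | inj₁ even = inj₁ even
      ...   | inj₂ M = let open MarkedEdge M in inj₂ (record
        { before = e ∷ before ; after = after ; link = link ; is-marked = is-marked ; total = cong suc total
        ; par-split = trans (cong (mark x z xor_) par-split) (sym (xor-assoc (mark x z) (par before) _)) })

      -- Rotated so as to begin with a marked edge, the closed walk has at most `3 k + 1` further
      -- steps. By `stay` these remain in `Near v`, where the parity depends on the ends only and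
      -- equals the mark of the first edge.
      short-even : ∀ {x n} (w : Walk G x x n) → n ≤ 3 * k + 2 → par w ≡ false
      short-even {n = n} w n≤ with find-marked w
      ... | inj₁ even = even
      ... | inj₂ M = begin
        par w                                                ≡⟨ par-split ⟩
        par before xor (mark x′ y′ xor par after)            ≡⟨ xor-comm (par before) _ ⟩
        (mark x′ y′ xor par after) xor par before            ≡⟨ xor-assoc (mark x′ y′) (par after) (par before) ⟩
        mark x′ y′ xor (par after xor par before)            ≡⟨ cong (mark x′ y′ xor_) (sym (par-++ after before)) ⟩
        mark x′ y′ xor par (after ++ before)                 ≡⟨ cong₂ _xor_ (mark-near nx ny) (near-par (after ++ before) near) ⟩
        (hi x′ xor hi y′) xor (hi y′ xor hi x′)              ≡⟨ cong ((hi x′ xor hi y′) xor_) (xor-comm (hi y′) (hi x′)) ⟩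
        (hi x′ xor hi y′) xor (hi x′ xor hi y′)              ≡⟨ xor-same (hi x′ xor hi y′) ⟩
        false                                                ∎
        where
        open ≡-Reasoning
        open MarkedEdge M
        nx = proj₁ (marked is-marked)
        ny = proj₁ (proj₂ (marked is-marked))
        hx,hy = straddle link (proj₂ (proj₂ (marked is-marked)))
        near = stay (after ++ before)
          (lin 4 (λ a b n k → a ⊕ (κ 1 ⊕ b) ≐ n ⇒ n ≼ 3 · k ⊕ κ 2 ⇒ goal (b ⊕ a ≼ 3 · k ⊕ κ 1)) a b n k total n≤)
          ny nx (proj₂ hx,hy) (proj₁ hx,hy)

      even : ∀ {x n} (w : Walk G x x n) → par w ≡ false
      even = all-even search _≟ⱽ_ k no-cycle short-even

      -- By `even` the parity is the same for all walks from `root`; the geodesic is merely a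
      -- choice.
      side : V → Bool
      side x = par (geodesic root x)

      side-walk : ∀ {x n} (w : Walk G root x n) → par w ≡ side x
      side-walk {x} w = xor-false⇒≡ (trans (cong (par w xor_) (sym (par-reverse (geodesic root x))))
        (trans (sym (par-++ w (reverse (geodesic root x)))) (even (w ++ reverse (geodesic root x)))))

      side-step : ∀ {x y} → x ~ y → side y ≡ side x xor mark x y
      side-step {x} e = trans (sym (side-walk (snoc (geodesic root x) e))) (par-snoc (geodesic root x) e)

      propagate : ∀ (p : ℕ → V) n → Steps {G = G} p 0 n → (∀ i → i ≤ n → Near v (p i)) →
                  side (p 0) ≡ hi (p 0) → ∀ i → i ≤ n → side (p i) ≡ hi (p i)
      propagate p n steps near base zero    _   = base
      propagate p n steps near base (suc i) i<n = begin
        side (p (suc i))                              ≡⟨ side-step (steps i z≤n i<n) ⟩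
        side (p i) xor mark (p i) (p (suc i))         ≡⟨ cong₂ _xor_ (propagate p n steps near base i (<⇒≤ i<n))
                                                                     (mark-near (near i (<⇒≤ i<n)) (near (suc i) i<n)) ⟩
        hi (p i) xor (hi (p i) xor hi (p (suc i)))    ≡⟨ xor-cancelˡ (hi (p i)) _ ⟩
        hi (p (suc i))                                ∎
        where open ≡-Reasoning

      -- Follow the geodesic of `v` up to `q v i` and then a shortest path to `x`. All of this lies
      -- in `Near v`, so `side` and `hi` change together, starting from `false` at the root.
      near-side : ∀ x → Near v x → side x ≡ hi x
      near-side x (i , i≤ , d≤) = subst (λ z → side z ≡ hi z) (at-end g)
        (propagate (at g) (δ (q v i) x) (λ l _ l< → at-step g l l<)
          (λ l l≤ → i , i≤ , subst (_≤ 3 * k) (trans (sym (δ-at (q v i) x l l≤)) (δ-sym (q v i) (at g l)))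
                               (≤-trans l≤ (subst (_≤ 3 * k) (δ-sym x (q v i)) d≤)))
          (propagate (q v) (height v) (λ l _ l< → q-step v l l<)
            (λ l l≤ → l , l≤ , subst (_≤ 3 * k) (sym (δ-refl (q v l))) z≤n)
            (trans (sym (side-walk [])) (sym (dec-false (j <? height root) (subst (λ h → ¬ j < h) (sym height-root) λ ()))))
            i i≤)
          (δ (q v i) x) ≤-refl)
        where g = geodesic (q v i) x

      crossing : ∀ {x y} → x ~ y → side x ≡ false → side y ≡ true →
                 Near v x × Near v y × height x ≡ j × height y ≡ suc j
      crossing {x} {y} e sx sy with marked {x} {y} (trans (sym (trans (side-step e) (cong (_xor mark x y) sx))) sy)
      ... | nx , ny , differ with hi-split x | hi-split y | straddle e differ
      ...   | inj₁ (hx , _) | _             | _ = case trans (sym sx) (trans (near-side x nx) hx) of λ ()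
      ...   | inj₂ _        | inj₂ (hy , _) | _ = case trans (sym sy) (trans (near-side y ny) hy) of λ ()
      ...   | inj₂ (_ , le) | inj₁ (_ , lt) | (x₀ , _) , (_ , y₁) = nx , ny , ≤-antisym le x₀ , ≤-antisym y₁ lt

      cut : Cut v j
      cut = record { side = side ; near-side = near-side ; crossing = crossing }

-- Legs around a centre

module Star {n : ℕ} (G : Graph (Fin n)) (connected : ∀ u v → ∃[ d ] Walk G u v d) where
  open Graph G
  open Distances G Fin.any? Fin._≟_ connected public

  -- The term `2 * r + 3` makes balls of radius `suc r` around different legs disjoint. In `cover`
  -- both radii are one less than those of the bags, so that a bag also receives the neighbours of
  -- the vertices covered. The predicate `active` allows legs to be indexed by all vertices at
  -- first.
  record LegSystem {N : ℕ} (active : Fin N → Bool) (r ρ : ℕ) : Set where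
    field
      centre   : Fin n
      len      : Fin N → ℕ
      leg      : Fin N → ℕ → Fin n
      step     : ∀ a → T (active a) → ∀ i → i < len a → leg a i ~ leg a (suc i)
      straight : ∀ a → T (active a) → ∀ i l → i + l ≤ len a → l ≤ δ (leg a i) (leg a (i + l))
      away     : ∀ a → T (active a) → ∀ i → i ≤ len a → i + suc r ≤ δ centre (leg a i)
      start    : ∀ a → T (active a) → δ centre (leg a 0) ≤ ρ
      apart    : ∀ a b → T (active a) → T (active b) → a ≢ b → ∀ i j → i ≤ len a → j ≤ len b →
                 i + j + (2 * r + 3) ≤ δ (leg a i) (leg b j)
      cover    : ∀ z → (∃[ a ] T (active a) × ∃[ i ] i ≤ len a × δ z (leg a i) ≤ r) ⊎ suc (δ centre z) ≤ ρ

  -- Branches and the choice of the legs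

  module Construction (k : ℕ)
    (no-cycle : ¬ ContainsGeodesicSubdivision k K³ G)
    (no-wrench : ¬ ContainsQuasiGeodesicSubdivision 3 (3 * k) wrench G)
    (root tip : Fin n) (diametral : ∀ x y → δ x y ≤ δ root tip)
    where
    open Rooted root k

    Branch : Fin n → ℕ → Set
    Branch v i = suc (3 * k) ≤ i × i + suc (3 * k) ≤ height v × ∃[ z ] Exact v z i

    branch? : ∀ v i → Dec (Branch v i)
    branch? v i = (suc (3 * k) ≤? i) ×-dec (i + suc (3 * k) ≤? height v) ×-dec Fin.any? λ z → exact? v z i

    near-height : ∀ {v x i} → i ≤ height v → δ x (q v i) ≤ 3 * k → height x ≤ i + 3 * k × i ≤ height x + 3 * k
    near-height {v} {x} {i} i≤ d≤ =
      ≤-trans (subst (λ h → height x ≤ h + δ x (q v i)) (q-height v i i≤) (height-tri x (q v i))) (+-monoʳ-≤ i d≤) ,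
      ≤-trans (subst (_≤ height x + δ x (q v i)) (q-height v i i≤) (δ-tri root x (q v i))) (+-monoʳ-≤ (height x) d≤)

    exact-height : ∀ {v z i} → Exact v z i → height z ≤ i + suc (3 * k) × i ≤ height z + suc (3 * k)
    exact-height {v} {z} {i} E =
      subst₂ (λ h d → height z ≤ h + d) (q-height v i bounded) distance (height-tri z (q v i)) ,
      subst₂ (λ h d → h ≤ height z + d) (q-height v i bounded) distance (δ-tri root z (q v i))
      where open Exact E

    q-near : ∀ v i → i ≤ height v → Near v (q v i)
    q-near v i i≤ = i , i≤ , subst (_≤ 3 * k) (sym (δ-refl (q v i))) z≤n

    self-near : ∀ v → Near v v
    self-near v = subst (Near v) (q-end v) (q-near v (height v) ≤-refl)

    q-distance : ∀ v i l → i + l ≤ height v → δ (q v i) (q v (i + l)) ≤ l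
    q-distance v i l i+l≤ = δ-min (segment {G = G} (q v) i l λ j _ j< → q-step v j (≤-trans j< i+l≤))

    q-straight : ∀ v i l → i + l ≤ height v → l ≤ δ (q v i) (q v (i + l))
    q-straight v i l i+l≤ = +-cancelˡ-≤ i l _
      (subst₂ (λ a b → b ≤ a + δ (q v i) (q v (i + l)))
        (q-height v i (≤-trans (m≤m+n i l) i+l≤)) (q-height v (i + l) i+l≤) (δ-tri root (q v i) (q v (i + l))))

    module Spur {v z i} (E : Exact v z i) where
      open Exact E

      length : δ (q v i) z ≡ suc (3 * k)
      length = trans (δ-sym (q v i) z) distance

      spur : ℕ → Fin n
      spur = at (geodesic (q v i) z)

      spur-step : ∀ a → a < suc (3 * k) → spur a ~ spur (suc a)
      spur-step a a< = at-step (geodesic (q v i) z) a (subst (a <_) (sym length) a<)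

      spur-geodesic : ∀ a l {d} → a + l ≤ suc (3 * k) → Walk G (spur a) (spur (a + l)) d → l ≤ d
      spur-geodesic a l {d} a+l≤ w = +-cancelˡ-≤ a l d (≤-trans
        (subst₂ (λ x y → y ≤ x + δ (spur a) (spur (a + l)))
          (δ-at (q v i) z a (subst (a ≤_) (sym length) (≤-trans (m≤m+n a l) a+l≤)))
          (δ-at (q v i) z (a + l) (subst (a + l ≤_) (sym length) a+l≤))
          (δ-tri (q v i) (spur a) (spur (a + l))))
        (+-monoʳ-≤ a (δ-min w)))

      spur-shortest : ∀ a i′ {d} → a ≤ suc (3 * k) → i′ ≤ height v → Walk G (spur a) (q v i′) d → a ≤ d
      spur-shortest a i′ {d} a≤ i′≤ w =
        lin 6 (λ a d m zq za aq → a ⊕ za ≐ m ⇒ m ≼ zq ⇒ zq ≼ za ⊕ aq ⇒ aq ≼ d ⇒ goal (a ≼ d))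
          a d (suc (3 * k)) (δ z (q v i′)) (δ (spur a) z) (δ (spur a) (q v i′))
          (trans (δ-at′ (q v i) z a (subst (a ≤_) (sym length) a≤)) length) (far i′ i′≤)
          (subst (λ x → δ z (q v i′) ≤ x + δ (spur a) (q v i′)) (δ-sym z (spur a)) (δ-tri z (spur a) (q v i′)))
          (δ-min w)

    -- Otherwise a wrench arises: its spine runs from `suc (3 * k)` below `i` to `suc (3 * k)` above
    -- `i′`, for which the height conditions in `Branch` leave room, and the spurs at both branches
    -- are its other legs. The surplus `o` lengthens the middle edge.
    window : ∀ v i i′ → Branch v i → Branch v i′ → i′ < i + 4 * suc (3 * k)
    window v i i′ (m≤i , _ , z , E) (_ , i′+m≤ , z′ , E′) with i′ <? i + 4 * suc (3 * k)
    ... | yes lt = lt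
    ... | no ¬lt with m≤n⇒∃[o]m+o≡n m≤i | m≤n⇒∃[o]m+o≡n (≮⇒≥ ¬lt)
    ...   | b , refl | o , refl = ⊥-elim (no-wrench (QuasiGeodesicWrench.contained h g (m≤m+n (4 * suc h) o) G σ spur S′.spur
        (λ i i<N → subst (λ x → q v (b + i) ~ q v x) (sym (+-suc b i)) (q-step v (b + i) (≤-trans (≤-reflexive (sym (+-suc b i))) (inside (suc i) i<N))))
        (λ i l {d} i+l≤N w → ≤-trans (q-straight v (b + i) l (subst (_≤ height v) (sym (+-assoc b i l)) (inside (i + l) i+l≤N)))
          (subst (λ x → δ (q v (b + i)) (q v x) ≤ d) (sym (+-assoc b i l)) (δ-min w)))
        (cong (q v) (+-comm (suc h) b)) spur-step spur-geodesic
        (λ a i a≤ i≤N → spur-shortest a (b + i) a≤ (inside i i≤N))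
        (cong (q v) (lin 3 (λ m b o → goal (m ⊕ b ⊕ 4 · m ⊕ o ≐ b ⊕ (m ⊕ (4 · m ⊕ o)))) (suc h) b o))
        S′.spur-step S′.spur-geodesic
        (λ a i a≤ i≤N → S′.spur-shortest a (b + i) a≤ (inside i i≤N))))
      where
      h = 3 * k
      g = h + 3 * suc h + o
      σ : ℕ → Fin n
      σ i = q v (b + i)
      open Spur E
      module S′ = Spur E′
      inside : ∀ i → i ≤ suc h + (suc g + suc h) → b + i ≤ height v
      inside i i≤ = lin 5 (λ m b o i l → i ≼ m ⊕ (4 · m ⊕ o ⊕ m) ⇒ m ⊕ b ⊕ 4 · m ⊕ o ⊕ m ≼ l ⇒ goal (b ⊕ i ≼ l))
        (suc h) b o i (height v) i≤ i′+m≤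

    -- On a walk from `z` to the geodesic, `gate` is the first vertex in `Near v` and `beyond` its
    -- predecessor. No cut of `v` is crossed before `gate`; `same-side` holds for all heights at
    -- once because two cuts will be compared.
    record Exit (v z : Fin n) : Set where
      field
        foot : ℕ
        beyond gate : Fin n
        foot≤   : foot ≤ height v
        exact-beyond : Exact v beyond foot
        near-gate  : δ gate (q v foot) ≤ 3 * k
        same-side   : ∀ {j} (C : Cut v j) → Cut.side C z ≡ Cut.side C gate

    exit : ∀ v {z y l} → Walk G z y l → Near v y → ¬ Near v z → Exit v z
    exit v [] ny ¬nz = ⊥-elim (¬nz ny)
    exit v {z} (_∷_ {v = x} e p) ny ¬nz with near? v x
    ... | yes (i , i≤ , d≤) = record
      { foot = i ; beyond = z ; gate = x ; foot≤ = i≤ ; exact-beyond = exact (~-sym {G = G} e) i≤ d≤ ¬nz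
      ; near-gate = d≤ ; same-side = λ C → Cut.far-step C e ¬nz }
    ... | no ¬nx = let X = exit v p ny ¬nx in record
      { Exit X ; same-side = λ C → trans (Cut.far-step C e ¬nz) (Exit.same-side X C) }

    leave : ∀ v z → ¬ Near v z → Exit v z
    leave v z = exit v (geodesic z v) (self-near v)

    -- Legs above all branches

    module Upper (R : ℕ) (R-large : 32 * k + 7 ≤ R) (branch-low : ∀ v i → Branch v i → i + (6 * k + 1) ≤ R) where
      -- A vertex violating `Clear` has its foot `i` at most `e + 3 k + 1` below `j` and at most
      -- `e + 3 k + 2` above it. The first bound puts `i + (6 k + 1)` above `R`, so `i` is no
      -- branch; but `i` is far from the root since `R` is large, and far from `v` by the margin
      -- `10 k + 1`.
      cut-at : ∀ v j → R ≤ j → j + suc (10 * k) ≤ height v → Cut v j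
      cut-at v j R≤j j≤ = MakeCut.cut no-cycle v j λ e z i 1≤k e≤ E lo hi →
        let z≤ , i≤ = exact-height E in
        lin 6 (λ k e i z j R → κ 1 ≼ k ⇒ 2 · e ≼ 3 · k ⊕ κ 1 ⇒ i ⊕ (6 · k ⊕ κ 1) ≼ R ⇒ R ≼ j ⇒ j ≼ z ⊕ e ⇒
            z ≼ i ⊕ (κ 1 ⊕ 3 · k) ⇒ false) k e i (height z) j R 1≤k e≤
          (branch-low v i
            ( lin 6 (λ k e i z j R → κ 1 ≼ k ⇒ 2 · e ≼ 3 · k ⊕ κ 1 ⇒ 32 · k ⊕ κ 7 ≼ R ⇒ R ≼ j ⇒ j ≼ z ⊕ e ⇒
                z ≼ i ⊕ (κ 1 ⊕ 3 · k) ⇒ goal (κ 1 ⊕ 3 · k ≼ i)) k e i (height z) j R 1≤k e≤ R-large R≤j lo z≤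
            , lin 6 (λ k e i z j l → κ 1 ≼ k ⇒ 2 · e ≼ 3 · k ⊕ κ 1 ⇒ j ⊕ (κ 1 ⊕ 10 · k) ≼ l ⇒ z ≼ κ 1 ⊕ j ⊕ e ⇒
                i ≼ z ⊕ (κ 1 ⊕ 3 · k) ⇒ goal (i ⊕ (κ 1 ⊕ 3 · k) ≼ l)) k e i (height z) j (height v) 1≤k e≤ j≤ hi i≤
            , z , E))
          R≤j lo z≤

      -- A walk between two legs passes the cut at height `R` and so has at least
      -- `(13 k + 2) + 1 + (13 k + 1)` steps. Starting one lower would miss the `2 * r + 3` of
      -- `apart` by one.
      base : ℕ
      base = R + (13 * k + 2)

      Tall : Fin n → Set
      Tall v = base ≤ height v

      upper-cut : ∀ v → Tall v → Cut v R
      upper-cut v t = cut-at v R ≤-refl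
        (lin 3 (λ k R l → R ⊕ (13 · k ⊕ κ 2) ≼ l ⇒ goal (R ⊕ (κ 1 ⊕ 10 · k) ≼ l)) k R (height v) t)

      -- If moreover `v′` is no lower than `v`, then `close` puts `v` next to the geodesic to `v′`,
      -- so `v` needs no leg of its own.
      _↝_ : Fin n → Fin n → Set
      v ↝ v′ = Σ[ t ∈ Tall v′ ] Cut.side (upper-cut v′ t) v ≡ true

      _↝?_ : ∀ v v′ → Dec (v ↝ v′)
      v ↝? v′ with base ≤? height v′
      ... | no ¬t = no (¬t ∘ proj₁)
      -- The cut is computed from the proof of `Tall v′`, so two such proofs have to be identified.
      ... | yes t = map′ (t ,_)
        (λ (t′ , eq) → subst (λ t → Cut.side (upper-cut v′ t) v ≡ true) (≤-irrelevant t′ t) eq)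
        (Cut.side (upper-cut v′ t) v Bool.≟ true)

      height-max : ∀ v → height v ≤ height tip
      height-max v = diametral root v

      -- Higher vertices come first. The index breaks ties, because the greedy selection says
      -- nothing about equal ranks.
      rank : Fin n → ℕ
      rank v = (height tip ∸ height v) * n + toℕ v

      rank-anti : ∀ {v v′} → height v < height v′ → rank v′ < rank v
      rank-anti {v} {v′} lt = begin-strict
        (height tip ∸ height v′) * n + toℕ v′   <⟨ +-monoʳ-< _ (Fin.toℕ<n v′) ⟩
        (height tip ∸ height v′) * n + n        ≡⟨ +-comm _ n ⟩
        suc (height tip ∸ height v′) * n        ≤⟨ *-monoˡ-≤ n (∸-monoʳ-< lt (height-max v′)) ⟩
        (height tip ∸ height v) * n             ≤⟨ m≤m+n _ (toℕ v) ⟩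
        rank v                                  ∎
        where open ≤-Reasoning

      rank-height : ∀ {v v′} → rank v′ < rank v → height v ≤ height v′
      rank-height lt = ≮⇒≥ λ h → <-asym lt (rank-anti h)

      rank-injective : ∀ {v v′} → rank v ≡ rank v′ → v ≡ v′
      rank-injective {v} {v′} eq with <-cmp (height v) (height v′)
      ... | tri< lt _ _ = ⊥-elim (<⇒≢ (rank-anti lt) (sym eq))
      ... | tri> _ _ gt = ⊥-elim (<⇒≢ (rank-anti gt) eq)
      ... | tri≈ _ h≡ _ = Fin.toℕ-injective (+-cancelˡ-≡ ((height tip ∸ height v) * n) _ _
        (trans eq (cong (λ h → (height tip ∸ h) * n + toℕ v′) (sym h≡))))

      bound : ℕ
      bound = height tip * n + n

      rank-bound : ∀ v → rank v < bound
      rank-bound v = +-mono-≤-< (*-monoˡ-≤ n (m∸n≤m (height tip) (height v))) (Fin.toℕ<n v)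

      selection : Greedy Tall _↝_ rank bound
      selection = greedy rank (λ v → base ≤? height v) _↝?_ bound

      open Greedy selection using (selected; sound; independent; dominating) public

      tall : ∀ v → T (selected v) → Tall v
      tall v = sound v (rank-bound v)

      R<base : ∀ {h} → base ≤ h → R < h
      R<base {h} = lin 3 (λ k R h → R ⊕ (13 · k ⊕ κ 2) ≼ h ⇒ goal (R ≺ h)) k R h

      dominated : ∀ z → Tall z → ∃[ v ] T (selected v) × (z ↝ v) × height z ≤ height v
      dominated z t with dominating z (rank-bound z) t
      ... | inj₁ s = z , s , (t , Cut.high (upper-cut z t) (self-near z) (R<base t)) , ≤-refl
      ... | inj₂ (v , s , lt , r) = v , s , r , rank-height lt

      -- The geodesic to `v` is cut once more, at height `j = height v - (10 k + 1)`, the highest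
      -- that `cut-at` allows. Above this cut, `z` is at most `10 k` from an end of a crossing edge,
      -- hence `13 k` from the geodesic. Below it, but above the cut at `R`, a `z` that is not near
      -- would have the foot of its exit as a branch too high for `branch-low`.
      close : ∀ v z → z ↝ v → height z ≤ height v → ∃[ i ] i ≤ height v × δ z (q v i) ≤ 13 * k
      close v z (t , above) z≤v with near? v z
      ... | yes (i , i≤ , d≤) = i , i≤ , ≤-trans d≤ (*-monoˡ-≤ k (m≤m+n 3 10))
      ... | no ¬near with m≤n⇒∃[o]m+o≡n (≤-trans (lin 2 (λ k R → goal (κ 1 ⊕ 10 · k ⊕ R ≼ R ⊕ (13 · k ⊕ κ 2))) k R) t)
      ...   | o , eq = result
        where
        C = upper-cut v t
        open Exit (leave v z ¬near)
        j = R + o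
        C′ : Cut v j
        C′ = cut-at v j (m≤m+n R o)
          (lin 4 (λ k R o l → κ 1 ⊕ 10 · k ⊕ R ⊕ o ≐ l ⇒ goal (R ⊕ o ⊕ (κ 1 ⊕ 10 · k) ≼ l)) k R o (height v) eq)
        gate-near : Near v gate
        gate-near = foot , foot≤ , near-gate
        result : ∃[ i ] i ≤ height v × δ z (q v i) ≤ 13 * k
        result with Cut.side C′ z in s′
        ... | true with Cut.descend C′ z s′
        ...   | y , (i , i≤ , d≤) , _ , hz = i , i≤ ,
          lin 9 (λ k R o l z zy yz yq zq → κ 1 ⊕ 10 · k ⊕ R ⊕ o ≐ l ⇒ z ≼ l ⇒ z ≐ κ 1 ⊕ (R ⊕ o) ⊕ yz ⇒ zy ≐ yz ⇒ yq ≼ 3 · k ⇒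
              zq ≼ zy ⊕ yq ⇒ goal (zq ≼ 13 · k)) k R o (height v) (height z) (δ z y) (δ y z) (δ y (q v i)) (δ z (q v i))
            eq z≤v hz (δ-sym z y) d≤ (δ-tri z y (q v i))
        result | false =
          let in≤ , foot≤in = near-height foot≤ near-gate
              in≤j = Cut.near-low C′ gate-near (trans (sym (same-side C′)) s′)
              R<in = Cut.near-high C gate-near (trans (sym (same-side C)) above)
          in ⊥-elim (lin 4 (λ k R i x → R ≺ x ⇒ x ≼ i ⊕ 3 · k ⇒ i ⊕ (6 · k ⊕ κ 1) ≼ R ⇒ false) k R foot (height gate) R<in in≤
            (branch-low v foot
              ( lin 4 (λ k R i x → 32 · k ⊕ κ 7 ≼ R ⇒ R ≺ x ⇒ x ≼ i ⊕ 3 · k ⇒ goal (κ 1 ⊕ 3 · k ≼ i))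
                  k R foot (height gate) R-large R<in in≤
              , lin 6 (λ k R o l i x → κ 1 ⊕ 10 · k ⊕ R ⊕ o ≐ l ⇒ x ≼ R ⊕ o ⇒ i ≼ x ⊕ 3 · k ⇒ goal (i ⊕ (κ 1 ⊕ 3 · k) ≼ l))
                  k R o (height v) foot (height gate) eq in≤j foot≤in
              , beyond , exact-beyond)))

      upper-len : Fin n → ℕ
      upper-len v = height v ∸ base

      upper-leg : Fin n → ℕ → Fin n
      upper-leg v i = q v (base + i)

      inside : ∀ {v} → Tall v → ∀ {i} → i ≤ upper-len v → base + i ≤ height v
      inside t i≤ = ≤-trans (+-monoʳ-≤ base i≤) (≤-reflexive (m+[n∸m]≡n t))

      upper-height : ∀ {v} → Tall v → ∀ {i} → i ≤ upper-len v → height (upper-leg v i) ≡ base + i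
      upper-height {v} t i≤ = q-height v _ (inside t i≤)

      upper-step : ∀ v → Tall v → ∀ i → i < upper-len v → upper-leg v i ~ upper-leg v (suc i)
      upper-step v t i i< = subst (λ x → q v (base + i) ~ q v x) (sym (+-suc base i))
        (q-step v (base + i) (≤-trans (≤-reflexive (sym (+-suc base i))) (inside t i<)))

      upper-straight : ∀ v → Tall v → ∀ i l → i + l ≤ upper-len v → l ≤ δ (upper-leg v i) (upper-leg v (i + l))
      upper-straight v t i l i+l≤ = subst (λ x → l ≤ δ (q v (base + i)) (q v x)) (+-assoc base i l)
        (q-straight v (base + i) l (subst (_≤ height v) (sym (+-assoc base i l)) (inside t i+l≤)))

      tall-leg : ∀ v → Tall v → ∀ {i} → i ≤ upper-len v → Tall (upper-leg v i)
      tall-leg v t i≤ = subst (base ≤_) (sym (upper-height t i≤)) (m≤m+n base _)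

      -- The whole leg lies above height `R`, where `high-step` rules out a change of sides.
      leg-side : ∀ {x} (C : Cut x R) v → Tall v → ∀ i → i ≤ upper-len v → Cut.side C (upper-leg v i) ≡ Cut.side C v
      leg-side C v t i i≤ = let d , eq = m≤n⇒∃[o]m+o≡n i≤ in go d i eq
        where
        go : ∀ d i → i + d ≡ upper-len v → Cut.side C (upper-leg v i) ≡ Cut.side C v
        go zero i eq = cong (Cut.side C) (trans (cong (q v) (trans (cong (base +_) (trans (sym (+-identityʳ i)) eq))
                                                                   (m+[n∸m]≡n t))) (q-end v))
        go (suc d) i eq = let i< = subst (i <_) eq (subst (i <_) (sym (+-suc i d)) (s≤s (m≤m+n i d))) in
          trans (Cut.high-step C (upper-step v t i i<) (R<base (tall-leg v t (<⇒≤ i<))) (R<base (tall-leg v t i<)))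
                (go d (suc i) (trans (sym (+-suc i d)) eq))

      -- By independence `v′`, and with it its leg, lies below the cut of the earlier `v`, whereas
      -- the leg of `v` lies above. A walk between the legs must come down to height `R` on one side
      -- and climb from `R + 1` on the other.
      upper-apart-< : ∀ v v′ → T (selected v) → T (selected v′) → rank v < rank v′ → ∀ i j → i ≤ upper-len v → j ≤ upper-len v′ →
                      i + j + (2 * (13 * k) + 3) ≤ δ (upper-leg v i) (upper-leg v′ j)
      upper-apart-< v v′ s s′ lt i j i≤ j≤ =
        lin 8 (λ k R i j a b d₀ d → R ⊕ (13 · k ⊕ κ 2) ⊕ j ≼ R ⊕ a ⇒ R ⊕ (13 · k ⊕ κ 2) ⊕ i ≼ κ 1 ⊕ R ⊕ b ⇒
            a ⊕ (κ 1 ⊕ b) ≐ d₀ ⇒ d₀ ≐ d ⇒ goal (i ⊕ j ⊕ (2 · (13 · k) ⊕ κ 3) ≼ d))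
          k R i j before after (δ y x) (δ x y)
          (subst₂ (λ a b → a ≤ b + before) (upper-height t′ j≤) height-lower
            (≤-trans (height-tri y lower) (+-monoʳ-≤ (height lower) (δ-min walk-before))))
          (subst₂ (λ a b → a ≤ b + after) (upper-height t i≤) height-upper
            (≤-trans (δ-tri root upper x) (+-monoʳ-≤ (height upper) (δ-min walk-after))))
          total (δ-sym y x)
        where
        t  = tall v s
        t′ = tall v′ s′
        x = upper-leg v i
        y = upper-leg v′ j
        C = upper-cut v t
        v′-low : Cut.side C v′ ≡ false
        v′-low with Cut.side C v′ in eq
        ... | false = refl
        ... | true  = ⊥-elim (independent v′ v (rank-bound v′) s′ s lt (t , eq))
        open Cut.Crossing (Cut.cross C (geodesic y x) (trans (leg-side C v′ t′ j j≤) v′-low)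
          (Cut.high C (q-near v (base + i) (inside t i≤)) (R<base (tall-leg v t i≤))))

      upper-apart : ∀ v v′ → T (selected v) → T (selected v′) → v ≢ v′ → ∀ i j → i ≤ upper-len v → j ≤ upper-len v′ →
                    i + j + (2 * (13 * k) + 3) ≤ δ (upper-leg v i) (upper-leg v′ j)
      upper-apart v v′ s s′ v≢v′ i j i≤ j≤ with <-cmp (rank v) (rank v′)
      ... | tri< lt _ _ = upper-apart-< v v′ s s′ lt i j i≤ j≤
      ... | tri≈ _ eq _ = ⊥-elim (v≢v′ (rank-injective eq))
      ... | tri> _ _ gt = subst₂ (λ a d → a + (2 * (13 * k) + 3) ≤ d) (+-comm j i) (δ-sym (upper-leg v′ j) (upper-leg v i))
                            (upper-apart-< v′ v s′ s gt j i j≤ i≤)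

      upper-cover : ∀ z → (∃[ v ] T (selected v) × ∃[ i ] i ≤ upper-len v × δ z (upper-leg v i) ≤ 13 * k)
                          ⊎ height z ≤ R + (26 * k + 1)
      upper-cover z with base ≤? height z
      ... | no ¬t = inj₂ (lin 3 (λ k R z → z ≺ R ⊕ (13 · k ⊕ κ 2) ⇒ goal (z ≼ R ⊕ (26 · k ⊕ κ 1))) k R (height z) (≰⇒> ¬t))
      ... | yes t with dominated z t
      ...   | v , s , z↝v , z≤v with close v z z↝v z≤v
      ...     | i , i≤ , d≤ with base ≤? i
      ...       | yes b≤i with m≤n⇒∃[o]m+o≡n b≤i
      ...         | o , refl = inj₁ (v , s , o , +-cancelˡ-≤ base o _ (≤-trans i≤ (≤-reflexive (sym (m+[n∸m]≡n (tall v s))))) , d≤)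
      upper-cover z | yes t | v , s , z↝v , z≤v | i , i≤ , d≤ | no b≰i = inj₂
        (lin 5 (λ k R z i d → i ≺ R ⊕ (13 · k ⊕ κ 2) ⇒ d ≼ 13 · k ⇒ z ≼ i ⊕ d ⇒ goal (z ≼ R ⊕ (26 · k ⊕ κ 1)))
          k R (height z) i (δ z (q v i)) (≰⇒> b≰i) d≤
          (subst (λ h → height z ≤ h + δ z (q v i)) (q-height v i i≤) (height-tri z (q v i))))

    Result : Set
    Result = ∃[ N ] Σ[ active ∈ (Fin N → Bool) ] LegSystem active (13 * k) (58 * k + 9)

    -- All branches low: the root as centre

    module Low (low : ∀ v i → Branch v i → i ≤ 26 * k + 6) where
      branch-low : ∀ v i → Branch v i → i + (6 * k + 1) ≤ 32 * k + 7
      branch-low v i b = lin 2 (λ k i → i ≼ 26 · k ⊕ κ 6 ⇒ goal (i ⊕ (6 · k ⊕ κ 1) ≼ 32 · k ⊕ κ 7)) k i (low v i b)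

      open Upper (32 * k + 7) ≤-refl branch-low

      result : Result
      result = n , selected , record
        { centre   = root
        ; len      = upper-len
        ; leg      = upper-leg
        ; step     = λ v s → upper-step v (tall v s)
        ; straight = λ v s → upper-straight v (tall v s)
        ; away     = λ v s i i≤ → subst (i + suc (13 * k) ≤_) (sym (upper-height (tall v s) i≤))
            (lin 2 (λ k i → goal (i ⊕ (κ 1 ⊕ 13 · k) ≼ 32 · k ⊕ κ 7 ⊕ (13 · k ⊕ κ 2) ⊕ i)) k i)
        ; start    = λ v s → subst (_≤ 58 * k + 9) (sym (upper-height (tall v s) z≤n))
            (lin 1 (λ k → goal (32 · k ⊕ κ 7 ⊕ (13 · k ⊕ κ 2) ⊕ κ 0 ≼ 58 · k ⊕ κ 9)) k)
        ; apart    = upper-apart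
        -- Heights up to `R + (26 k + 1) = 58 k + 8` are left to the centre, which fixes the radius
        -- `58 k + 9`.
        ; cover    = λ z → Sum.map₂ (lin 2 (λ k h → h ≼ 32 · k ⊕ κ 7 ⊕ (26 · k ⊕ κ 1) ⇒ goal (h ≺ 58 · k ⊕ κ 9)) k (height z))
            (upper-cover z)
        }

    -- The branches on the geodesic to v lie less than 12 k + 4 below the topmost
    -- one, and a cut keeps a margin of 5 k + 3 from them: 17 k + 6 is what remains
    -- between the cut at height j and the topmost branch.
    module High (v : Fin n) (j : ℕ) (j-large : 9 * k + 1 ≤ j) (branch : Branch v (j + (17 * k + 6)))
                (max : ∀ v′ i → Branch v′ i → i ≤ j + (17 * k + 6)) where
      R : ℕ
      R = j + (23 * k + 7)

      R-large : 32 * k + 7 ≤ R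
      R-large = lin 2 (λ k j → 9 · k ⊕ κ 1 ≼ j ⇒ goal (32 · k ⊕ κ 7 ≼ j ⊕ (23 · k ⊕ κ 7))) k j j-large

      branch-low : ∀ v i → Branch v i → i + (6 * k + 1) ≤ R
      branch-low v i b = lin 3 (λ k j i → i ≼ j ⊕ (17 · k ⊕ κ 6) ⇒ goal (i ⊕ (6 · k ⊕ κ 1) ≼ j ⊕ (23 · k ⊕ κ 7)))
        k j i (max v i b)

      open Upper R R-large branch-low

      v-height : j + (17 * k + 6) + suc (3 * k) ≤ height v
      v-height = proj₁ (proj₂ branch)

      branch-high : ∀ i → Branch v i → j + (5 * k + 3) ≤ i
      branch-high i b = lin 3 (λ k j i → j ⊕ (17 · k ⊕ κ 6) ≺ i ⊕ 4 · (κ 1 ⊕ 3 · k) ⇒ goal (j ⊕ (5 · k ⊕ κ 3) ≼ i)) k j i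
        (window v i (j + (17 * k + 6)) b branch)

      -- The foot of a vertex violating `Clear` is at most `e + 3 k + 2` above `j`, hence below all
      -- branches by `branch-high`. Yet `9 k + 1 ≤ j′` keeps it `3 k + 1` away from the root, so it
      -- is a branch. For `k = 0` the condition `Clear` is vacuous, hence the guard in the last
      -- hypothesis.
      lower-cut : ∀ j′ → j′ ≤ j → (1 ≤ k → 9 * k + 1 ≤ j′) → Cut v j′
      lower-cut j′ j′≤j large = MakeCut.cut no-cycle v j′ λ e z i 1≤k e≤ E lo hi →
        let z≤ , i≤ = exact-height E in
        lin 6 (λ k e i z j′ j → κ 1 ≼ k ⇒ 2 · e ≼ 3 · k ⊕ κ 1 ⇒ j′ ≼ j ⇒ z ≼ κ 1 ⊕ j′ ⊕ e ⇒ i ≼ z ⊕ (κ 1 ⊕ 3 · k) ⇒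
            j ⊕ (5 · k ⊕ κ 3) ≼ i ⇒ false) k e i (height z) j′ j 1≤k e≤ j′≤j hi i≤
          (branch-high i
            ( lin 5 (λ k e i z j′ → κ 1 ≼ k ⇒ 2 · e ≼ 3 · k ⊕ κ 1 ⇒ 9 · k ⊕ κ 1 ≼ j′ ⇒ j′ ≼ z ⊕ e ⇒
                z ≼ i ⊕ (κ 1 ⊕ 3 · k) ⇒ goal (κ 1 ⊕ 3 · k ≼ i)) k e i (height z) j′ 1≤k e≤ (large 1≤k) lo z≤
            , lin 7 (λ k e i z j′ j l → κ 1 ≼ k ⇒ 2 · e ≼ 3 · k ⊕ κ 1 ⇒ j′ ≼ j ⇒ z ≼ κ 1 ⊕ j′ ⊕ e ⇒ i ≼ z ⊕ (κ 1 ⊕ 3 · k) ⇒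
                j ⊕ (17 · k ⊕ κ 6) ⊕ (κ 1 ⊕ 3 · k) ≼ l ⇒ goal (i ⊕ (κ 1 ⊕ 3 · k) ≼ l))
                k e i (height z) j′ j (height v) 1≤k e≤ j′≤j hi i≤ v-height
            , z , E))

      C : Cut v j
      C = lower-cut j ≤-refl λ _ → j-large

      -- The minimum of `j` and `10 k`. A second cut at this height is low enough for its height to
      -- count within `13 k`, and its height `6 k` or more leaves below it every vertex within `3 k`
      -- of the first `3 k` steps of the geodesic. For `k = 0` the minimum is 0 and `9 k + 1` is out
      -- of reach.
      low-index : ∃[ j′ ] j′ ≤ j × j′ ≤ 10 * k × 6 * k ≤ j′ × (1 ≤ k → 9 * k + 1 ≤ j′)
      low-index with ≤-total j (10 * k)
      ... | inj₁ j≤ = j , ≤-refl , j≤ , lin 2 (λ k j → 9 · k ⊕ κ 1 ≼ j ⇒ goal (6 · k ≼ j)) k j j-large , λ _ → j-large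
      ... | inj₂ ≤j = 10 * k , ≤j , ≤-refl , *-monoˡ-≤ k (m≤m+n 6 4) ,
        lin 1 (λ k → κ 1 ≼ k ⇒ goal (9 · k ⊕ κ 1 ≼ 10 · k)) k

      j′ : ℕ
      j′ = proj₁ low-index

      j′≤j : j′ ≤ j
      j′≤j = proj₁ (proj₂ low-index)

      j′≤10k : j′ ≤ 10 * k
      j′≤10k = proj₁ (proj₂ (proj₂ low-index))

      6k≤j′ : 6 * k ≤ j′
      6k≤j′ = proj₁ (proj₂ (proj₂ (proj₂ low-index)))

      C′ : Cut v j′
      C′ = lower-cut j′ j′≤j (proj₂ (proj₂ (proj₂ (proj₂ low-index))))

      v-above : Cut.side C′ v ≡ true
      v-above = Cut.high C′ (self-near v) (lin 4 (λ k j′ j l → j′ ≼ j ⇒ j ⊕ (17 · k ⊕ κ 6) ⊕ (κ 1 ⊕ 3 · k) ≼ l ⇒ goal (j′ ≺ l))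
        k j′ j (height v) j′≤j v-height)

      -- Otherwise the way from tip to v would be too long.
      tip-above : Cut.side C′ tip ≡ true
      tip-above with Cut.side C′ tip in eq
      ... | true  = refl
      ... | false = ⊥-elim (
        lin 9 (λ k j′ j tip v b a d lo → j′ ≼ 10 · k ⇒ 9 · k ⊕ κ 1 ≼ j ⇒ j ⊕ (17 · k ⊕ κ 6) ⊕ (κ 1 ⊕ 3 · k) ≼ v ⇒
            lo ≐ j′ ⇒ tip ≼ lo ⊕ b ⇒ v ≼ κ 1 ⊕ j′ ⊕ a ⇒ b ⊕ (κ 1 ⊕ a) ≐ d ⇒ d ≼ tip ⇒ false)
          k j′ j (height tip) (height v) before after (δ tip v) (height lower) j′≤10k j-large v-height height-lower
          (≤-trans (height-tri tip lower) (+-monoʳ-≤ (height lower) (δ-min walk-before)))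
          (subst (λ h → height v ≤ h + after) height-upper
            (≤-trans (δ-tri root upper v) (+-monoʳ-≤ (height upper) (δ-min walk-after))))
          total (diametral tip v))
        where open Cut.Crossing (Cut.cross C′ (geodesic tip v) eq v-above)

      -- If `z` is not near, the foot of its exit is too low for a branch of this geodesic, so it is
      -- at most `3 k` and `z` lies below the cut at `j′` as well. A shortest path from `z` to `tip`
      -- crosses that cut. It is no longer than `height tip`, so the part before the crossing has at
      -- most `j′ ≤ 10 k` steps; another `3 k` lead to the geodesic.
      lower-close : ∀ z → Cut.side C z ≡ false → ∃[ i ] i ≤ height v × i ≤ j + 3 * k × δ z (q v i) ≤ 13 * k
      lower-close z below with near? v z
      ... | yes (i , i≤ , d≤) = i , i≤ ,
        ≤-trans (proj₂ (near-height i≤ d≤)) (+-monoˡ-≤ (3 * k) (Cut.near-low C (i , i≤ , d≤) below)) ,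
        ≤-trans d≤ (*-monoˡ-≤ k (m≤m+n 3 10))
      ... | no ¬near = let i , i≤ , d≤ = near-lower in i , i≤ ,
        lin 5 (λ k i j j′ lo → i ≼ lo ⊕ 3 · k ⇒ lo ≐ j′ ⇒ j′ ≼ j ⇒ goal (i ≼ j ⊕ 3 · k))
          k i j j′ (height lower) (proj₂ (near-height i≤ d≤)) height-lower j′≤j ,
        lin 12 (λ k b a d tip lo j′ zq zl lq u up → j′ ≼ 10 · k ⇒ b ⊕ (κ 1 ⊕ a) ≐ d ⇒ d ≼ tip ⇒ up ≐ κ 1 ⊕ j′ ⇒ tip ≼ up ⊕ u ⇒ u ≼ a ⇒
            zl ≼ b ⇒ lq ≼ 3 · k ⇒ zq ≼ zl ⊕ lq ⇒ goal (zq ≼ 13 · k))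
          k before after (δ z tip) (height tip) (height lower) j′ (δ z (q v i)) (δ z lower) (δ lower (q v i)) (δ upper tip) (height upper)
          j′≤10k total (diametral z tip) height-upper (δ-tri root upper tip) (δ-min walk-after)
          (δ-min walk-before) d≤ (δ-tri z lower (q v i))
        where
        open Exit (leave v z ¬near)
        gate-near : Near v gate
        gate-near = foot , foot≤ , near-gate
        gate-low : height gate ≤ j
        gate-low = Cut.near-low C gate-near (trans (sym (same-side C)) below)
        foot-low : foot ≤ 3 * k
        foot-low = ≮⇒≥ λ foot> → lin 4 (λ k j i x → x ≼ j ⇒ i ≼ x ⊕ 3 · k ⇒ j ⊕ (5 · k ⊕ κ 3) ≼ i ⇒ false)
          k j foot (height gate) gate-low (proj₂ (near-height foot≤ near-gate)) (branch-high foot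
            ( foot>
            , lin 5 (λ k j i x l → x ≼ j ⇒ i ≼ x ⊕ 3 · k ⇒ j ⊕ (17 · k ⊕ κ 6) ⊕ (κ 1 ⊕ 3 · k) ≼ l ⇒ goal (i ⊕ (κ 1 ⊕ 3 · k) ≼ l))
                k j foot (height gate) (height v) gate-low (proj₂ (near-height foot≤ near-gate)) v-height
            , beyond , exact-beyond))
        below′ : Cut.side C′ z ≡ false
        below′ = trans (same-side C′) (Cut.low C′ gate-near (≤-trans (proj₁ (near-height foot≤ near-gate))
          (≤-trans (lin 2 (λ k i → i ≼ 3 · k ⇒ goal (i ⊕ 3 · k ≼ 6 · k)) k foot foot-low) 6k≤j′)))
        open Cut.Crossing (Cut.cross C′ (geodesic z tip) below′ tip-above)

      centre : Fin n
      centre = q v j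

      j≤v : j ≤ height v
      j≤v = lin 3 (λ k j l → j ⊕ (17 · k ⊕ κ 6) ⊕ (κ 1 ⊕ 3 · k) ≼ l ⇒ goal (j ≼ l)) k j (height v) v-height

      centre-height : height centre ≡ j
      centre-height = q-height v j j≤v

      centre-distance : ∀ i → i ≤ height v → δ (q v i) centre + j ≤ i ⊎ δ (q v i) centre + i ≤ j
      centre-distance i i≤ with between i j
      ... | up l refl   = inj₂ (≤-trans (+-monoˡ-≤ i (q-distance v i l j≤v)) (≤-reflexive (+-comm l i)))
      ... | down l refl = inj₁ (subst (λ d → d + j ≤ j + l) (δ-sym (q v j) (q v (j + l)))
        (≤-trans (+-monoˡ-≤ j (q-distance v j l i≤)) (≤-reflexive (+-comm l j))))

      -- Go down `height z - (j + 1)` steps to an end of a crossing edge, then `3 k` to the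
      -- geodesic, and at most `3 k + 1` along it.
      above-distance : ∀ z → Cut.side C z ≡ true → δ centre z + j ≤ height z + 6 * k
      above-distance z above with Cut.descend C z above
      ... | y , (i , i≤ , d≤) , hy , hz =
        [ (λ le → lin 10 (λ k j cz z yz yq qc i y qy → z ≐ κ 1 ⊕ j ⊕ yz ⇒ y ≐ κ 1 ⊕ j ⇒ yq ≼ 3 · k ⇒ i ≼ y ⊕ 3 · k ⇒ qc ⊕ j ≼ i ⇒
              cz ≼ qc ⊕ (qy ⊕ yz) ⇒ qy ≐ yq ⇒ goal (cz ⊕ j ≼ z ⊕ 6 · k))
            k j (δ centre z) (height z) (δ y z) (δ y (q v i)) (δ (q v i) centre) i (height y) (δ (q v i) y) hz hy d≤ i≤y le tri sy)
        , (λ le → lin 10 (λ k j cz z yz yq qc i y qy → z ≐ κ 1 ⊕ j ⊕ yz ⇒ y ≐ κ 1 ⊕ j ⇒ yq ≼ 3 · k ⇒ y ≼ i ⊕ 3 · k ⇒ qc ⊕ i ≼ j ⇒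
              cz ≼ qc ⊕ (qy ⊕ yz) ⇒ qy ≐ yq ⇒ goal (cz ⊕ j ≼ z ⊕ 6 · k))
            k j (δ centre z) (height z) (δ y z) (δ y (q v i)) (δ (q v i) centre) i (height y) (δ (q v i) y) hz hy d≤ y≤i le tri sy)
        ]′ (centre-distance i i≤)
        where
        y≤i = proj₁ (near-height i≤ d≤)
        i≤y = proj₂ (near-height i≤ d≤)
        sy = δ-sym (q v i) y
        tri : δ centre z ≤ δ (q v i) centre + (δ (q v i) y + δ y z)
        tri = ≤-trans (δ-tri centre (q v i) z) (+-mono-≤ (≤-reflexive (δ-sym centre (q v i))) (δ-tri (q v i) y z))

      tall-above : ∀ z → Tall z → Cut.side C z ≡ true
      tall-above z t with Cut.side C z in eq
      ... | true  = refl
      ... | false with lower-close z eq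
      ...   | i , i≤ , i≤j , d≤ = ⊥-elim (lin 5 (λ k j i z d → j ⊕ (23 · k ⊕ κ 7) ⊕ (13 · k ⊕ κ 2) ≼ z ⇒ z ≼ i ⊕ d ⇒ i ≼ j ⊕ 3 · k ⇒
            d ≼ 13 · k ⇒ false) k j i (height z) (δ z (q v i)) t
          (subst (λ h → height z ≤ h + δ z (q v i)) (q-height v i i≤) (height-tri z (q v i))) i≤j d≤)

      low-base : ℕ
      low-base = j ∸ suc (13 * k)

      low-leg : ℕ → Fin n
      low-leg i = q v (low-base ∸ i)

      -- For smaller `j` there is no room for a leg `suc (13 * k)` away from the centre, and the
      -- central bag takes everything below the cut.
      long : Bool
      long = suc (13 * k) ≤ᵇ j

      low-base≡ : T long → low-base + suc (13 * k) ≡ j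
      low-base≡ t = m∸n+n≡m (≤ᵇ⇒≤ _ _ t)

      low-index≤ : ∀ i → low-base ∸ i ≤ height v
      low-index≤ i = ≤-trans (m∸n≤m low-base i) (≤-trans (m∸n≤m j (suc (13 * k))) j≤v)

      low-height : ∀ i → height (low-leg i) ≡ low-base ∸ i
      low-height i = q-height v (low-base ∸ i) (low-index≤ i)

      low-step : ∀ i → i < low-base → low-leg i ~ low-leg (suc i)
      low-step i i< = subst (λ x → q v x ~ low-leg (suc i)) (sym (∸-step i<)) (~-sym {G = G}
        (q-step v (low-base ∸ suc i) (subst (_≤ height v) (∸-step i<) (low-index≤ i))))

      low-straight : ∀ i l → i + l ≤ low-base → l ≤ δ (low-leg i) (low-leg (i + l))
      low-straight i l i+l≤ = lin 6 (λ b i l x y d → y ⊕ (i ⊕ l) ≐ b ⇒ x ⊕ i ≐ b ⇒ x ≼ y ⊕ d ⇒ goal (l ≼ d))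
        low-base i l (low-base ∸ i) (low-base ∸ (i + l)) (δ (low-leg i) (low-leg (i + l)))
        (m∸n+n≡m i+l≤) (m∸n+n≡m (≤-trans (m≤m+n i l) i+l≤))
        (subst₂ (λ x y → x ≤ y + δ (low-leg i) (low-leg (i + l))) (low-height i) (low-height (i + l)) (height-tri (low-leg i) (low-leg (i + l))))

      low-away : T long → ∀ i → i ≤ low-base → i + suc (13 * k) ≤ δ centre (low-leg i)
      low-away t i i≤ = lin 6 (λ k b i x d j → b ⊕ (κ 1 ⊕ 13 · k) ≐ j ⇒ x ⊕ i ≐ b ⇒ j ≼ x ⊕ d ⇒ goal (i ⊕ (κ 1 ⊕ 13 · k) ≼ d))
        k low-base i (low-base ∸ i) (δ centre (low-leg i)) j (low-base≡ t) (m∸n+n≡m i≤)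
        (subst₂ (λ x y → x ≤ y + δ centre (low-leg i)) centre-height (low-height i) (height-tri centre (low-leg i)))

      low-start : T long → δ centre (low-leg 0) ≤ 58 * k + 9
      low-start t = ≤-trans (subst (λ x → δ (q v x) (q v low-base) ≤ suc (13 * k)) (low-base≡ t)
          (subst (_≤ suc (13 * k)) (δ-sym (q v low-base) (q v (low-base + suc (13 * k))))
            (q-distance v low-base (suc (13 * k)) (subst (_≤ height v) (sym (low-base≡ t)) j≤v))))
        (lin 1 (λ k → goal (κ 1 ⊕ 13 · k ≼ 58 · k ⊕ κ 9)) k)

      low-apart : T long → ∀ v′ → T (selected v′) → ∀ i i′ → i ≤ low-base → i′ ≤ upper-len v′ →
                  i + i′ + (2 * (13 * k) + 3) ≤ δ (low-leg i) (upper-leg v′ i′)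
      low-apart t v′ s i i′ i≤ i′≤ =
        lin 9 (λ k j i i′ a b d x lb → lb ⊕ (κ 1 ⊕ 13 · k) ≐ j ⇒ x ⊕ i ≐ lb ⇒ j ≼ x ⊕ b ⇒
            j ⊕ (23 · k ⊕ κ 7) ⊕ (13 · k ⊕ κ 2) ⊕ i′ ≼ κ 1 ⊕ j ⊕ a ⇒ b ⊕ (κ 1 ⊕ a) ≐ d ⇒ goal (i ⊕ i′ ⊕ (2 · (13 · k) ⊕ κ 3) ≼ d))
          k j i i′ after before (δ x y) (low-base ∸ i) low-base (low-base≡ t) (m∸n+n≡m i≤)
          (subst₂ (λ a b → a ≤ b + before) height-lower (low-height i)
            (≤-trans (δ-tri root x lower) (+-monoʳ-≤ (height x) (δ-min walk-before))))
          (subst₂ (λ a b → a ≤ b + after) (upper-height (tall v′ s) i′≤) height-upper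
            (≤-trans (δ-tri root upper y) (+-monoʳ-≤ (height upper) (δ-min walk-after))))
          total
        where
        x = low-leg i
        y = upper-leg v′ i′
        open Cut.Crossing (Cut.cross C (geodesic x y)
          (Cut.low C (q-near v (low-base ∸ i) (low-index≤ i)) (subst (_≤ j) (sym (low-height i))
            (≤-trans (m∸n≤m low-base i) (m∸n≤m j (suc (13 * k))))))
          (tall-above y (tall-leg v′ (tall v′ s) i′≤)))

      active : Fin (suc n) → Bool
      active zero     = long
      active (suc v′) = selected v′

      len : Fin (suc n) → ℕ
      len zero     = low-base
      len (suc v′) = upper-len v′

      leg : Fin (suc n) → ℕ → Fin n
      leg zero     = low-leg
      leg (suc v′) = upper-leg v′

      central : ∀ z → Cut.side C z ≡ true → height z ≤ R + (26 * k + 1) → suc (δ centre z) ≤ 58 * k + 9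
      central z above z≤ = lin 4 (λ k j z d → d ⊕ j ≼ z ⊕ 6 · k ⇒ z ≼ j ⊕ (23 · k ⊕ κ 7) ⊕ (26 · k ⊕ κ 1) ⇒ goal (d ≺ 58 · k ⊕ κ 9))
        k j (height z) (δ centre z) (above-distance z above) z≤

      Covered : Fin n → Set
      Covered z = (∃[ a ] T (active a) × ∃[ i ] i ≤ len a × δ z (leg a i) ≤ 13 * k) ⊎ suc (δ centre z) ≤ 58 * k + 9

      lower-cover : ∀ z → Cut.side C z ≡ false → Covered z
      lower-cover z below with lower-close z below
      ... | i , i≤ , i≤j , d≤ with i + suc (13 * k) ≤? j
      ...   | yes i+r<j = inj₁ (zero , ≤⇒≤ᵇ (≤-trans (m≤n+m _ i) i+r<j) , low-base ∸ i , m∸n≤m low-base i ,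
              subst (λ x → δ z (q v x) ≤ 13 * k) (sym (m∸[m∸n]≡n (m+n≤o⇒m≤o∸n i i+r<j))) d≤)
      ...   | no ¬i+r<j = inj₂ (
        [ (λ le → lin 7 (λ k i j zc zq qc cz → zq ≼ 13 · k ⇒ qc ⊕ j ≼ i ⇒ i ≼ j ⊕ 3 · k ⇒ zc ≼ zq ⊕ qc ⇒ cz ≐ zc ⇒ goal (cz ≺ 58 · k ⊕ κ 9))
            k i j (δ z centre) (δ z (q v i)) (δ (q v i) centre) (δ centre z) d≤ le i≤j (δ-tri z (q v i) centre) (δ-sym centre z))
        , (λ le → lin 7 (λ k i j zc zq qc cz → zq ≼ 13 · k ⇒ qc ⊕ i ≼ j ⇒ j ≺ i ⊕ (κ 1 ⊕ 13 · k) ⇒ zc ≼ zq ⊕ qc ⇒ cz ≐ zc ⇒ goal (cz ≺ 58 · k ⊕ κ 9))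
            k i j (δ z centre) (δ z (q v i)) (δ (q v i) centre) (δ centre z) d≤ le (≰⇒> ¬i+r<j) (δ-tri z (q v i) centre) (δ-sym centre z))
        ]′ (centre-distance i i≤))

      covered : ∀ z → Covered z
      covered z with upper-cover z
      ... | inj₁ (v′ , s , i , i≤ , d≤) = inj₁ (suc v′ , s , i , i≤ , d≤)
      ... | inj₂ z≤ with Cut.side C z in eq
      ...   | true  = inj₂ (central z eq z≤)
      ...   | false = lower-cover z eq

      result : Result
      result = suc n , active , record
        { centre   = centre
        ; len      = len
        ; leg      = leg
        ; step     = λ { zero _ → low-step ; (suc v′) s → upper-step v′ (tall v′ s) }
        ; straight = λ { zero _ → low-straight ; (suc v′) s → upper-straight v′ (tall v′ s) }
        ; away     = λ { zero → low-away ; (suc v′) s i i≤ → upper-away v′ s i i≤ }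
        ; start    = λ { zero → low-start ; (suc v′) s → upper-start v′ s }
        ; apart    = apart
        ; cover    = covered
        }
        where
        upper-away : ∀ v′ → T (selected v′) → ∀ i → i ≤ upper-len v′ → i + suc (13 * k) ≤ δ centre (upper-leg v′ i)
        upper-away v′ s i i≤ = lin 4 (λ k i j d → j ⊕ (23 · k ⊕ κ 7) ⊕ (13 · k ⊕ κ 2) ⊕ i ≼ j ⊕ d ⇒ goal (i ⊕ (κ 1 ⊕ 13 · k) ≼ d))
          k i j (δ centre (upper-leg v′ i))
          (subst₂ (λ a b → a ≤ b + δ centre (upper-leg v′ i)) (upper-height (tall v′ s) i≤) centre-height (δ-tri root centre (upper-leg v′ i)))
        upper-start : ∀ v′ → T (selected v′) → δ centre (upper-leg v′ 0) ≤ 58 * k + 9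
        upper-start v′ s = lin 4 (λ k j z d → d ⊕ j ≼ z ⊕ 6 · k ⇒ z ≐ j ⊕ (23 · k ⊕ κ 7) ⊕ (13 · k ⊕ κ 2) ⊕ κ 0 ⇒ goal (d ≼ 58 · k ⊕ κ 9))
          k j (height x) (δ centre x) (above-distance x (tall-above x (tall-leg v′ t z≤n))) (upper-height t z≤n)
          where
          t = tall v′ s
          x = upper-leg v′ 0
        apart : ∀ a b → T (active a) → T (active b) → a ≢ b → ∀ i j → i ≤ len a → j ≤ len b →
                i + j + (2 * (13 * k) + 3) ≤ δ (leg a i) (leg b j)
        apart zero zero _ _ a≢b = ⊥-elim (a≢b refl)
        apart zero (suc v′) t s _ = low-apart t v′ s
        apart (suc v′) zero s t _ i j i≤ j≤ = subst₂ (λ a d → a + (2 * (13 * k) + 3) ≤ d) (+-comm j i)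
          (δ-sym (low-leg j) (upper-leg v′ i)) (low-apart t v′ s j i j≤ i≤)
        apart (suc v′) (suc v″) s s′ a≢b = upper-apart v′ v″ s s′ (a≢b ∘ cong suc)

    -- The threshold is `(9 k + 1) + (17 k + 6)`: subtracting the offset of the topmost branch
    -- leaves the `9 k + 1` that a cut at height `j` demands.
    HighBranch : ℕ → Set
    HighBranch i = 26 * k + 7 ≤ i × ∃[ v ] Branch v i

    highBranch? : ∀ i → Dec (HighBranch i)
    highBranch? i = (26 * k + 7 ≤? i) ×-dec Fin.any? λ v → branch? v i

    highBranch-bound : ∀ i → HighBranch i → i ≤ height tip
    highBranch-bound i (_ , v , _ , i+m≤ , _) = ≤-trans (m+n≤o⇒m≤o i i+m≤) (diametral root v)

    legs : Result
    legs with anyUpTo? highBranch? (suc (height tip))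
    ... | no none = Low.result λ v i b → ≮⇒≥ λ high →
            let high′ = ≤-trans (≤-reflexive (+-suc (26 * k) 6)) high , v , b
            in none (i , s≤s (highBranch-bound i high′) , high′)
    ... | yes (i , _ , high) with greatest highBranch? (height tip) highBranch-bound (i , high)
    ...   | top , (high′ , v , b) , top-max
      with m≤n⇒∃[o]m+o≡n (≤-trans (lin 1 (λ k → goal (17 · k ⊕ κ 6 ≼ 26 · k ⊕ κ 7)) k) high′)
    ...     | j , refl = High.result v j
              (lin 2 (λ k j → 26 · k ⊕ κ 7 ≼ 17 · k ⊕ κ 6 ⊕ j ⇒ goal (9 · k ⊕ κ 1 ≼ j)) k j high′)
              (subst (Branch v) (+-comm (17 * k + 6) j) b)
              λ v′ i b′ → subst (i ≤_) (+-comm (17 * k + 6) j) (bound v′ i b′)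
      where
      bound : ∀ v′ i → Branch v′ i → i ≤ 17 * k + 6 + j
      bound v′ i b′ with 26 * k + 7 ≤? i
      ... | yes le = top-max i (le , v′ , b′)
      ... | no ¬le = ≤-trans (<⇒≤ (≰⇒> ¬le)) high′

-- The star and its bags

module _ {n : ℕ} {P : Fin n → Set} (P? : ∀ v → Dec (P v)) where
  comprehension : Subset n
  comprehension = tabulate (does ∘ P?)

  ∈-comprehension⁺ : ∀ {v} → P v → v Subset.∈ comprehension
  ∈-comprehension⁺ {v} p = lookup⇒[]= v comprehension (trans (lookup∘tabulate (does ∘ P?) v) (dec-true (P? v) p))

  ∈-comprehension⁻ : ∀ {v} → v Subset.∈ comprehension → P v
  ∈-comprehension⁻ {v} m = does⁻ (P? v)
    (subst T (trans (sym ([]=⇒lookup m)) (lookup∘tabulate (does ∘ P?) v)) tt)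

module _ {V : Set} (G : Graph V) (P : V → Set) where
  lift-walk : ∀ {u v n} (w : Walk G u v n) (h : ∀ i → i ≤ n → P (at w i)) (pv : P v) →
              Walk (induced G P) (u , [ h 0 z≤n ]) (v , [ pv ]) n
  lift-walk []      h pv = []
  lift-walk (e ∷ w) h pv = e ∷ lift-walk w (λ i i≤ → h (suc i) (s≤s i≤)) pv

  lift-path : ∀ (q : ℕ → V) d → (∀ i → i < d → Graph._~_ G (q i) (q (suc i))) → (h : ∀ i → i ≤ d → P (q i)) →
              Walk (induced G P) (q 0 , [ h 0 z≤n ]) (q d , [ h d ≤-refl ]) d
  lift-path q zero    s h = []
  lift-path q (suc d) s h = s 0 z<s ∷ lift-path (q ∘ suc) d (λ i i< → s (suc i) (s≤s i<)) (λ i i≤ → h (suc i) (s≤s i≤))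

-- The star with legs of suc (m a) vertices each.  A vertex is coded by its leg
-- and its position on this leg, the innermost position being 0.
module SubdividedStarGraph (t : ℕ) (m : Fin t → ℕ) where
  data Code : Set where
    hub : Code
    on  : Fin t → ℕ → Code

  leg-of : Edge (star t) → Fin t
  leg-of (edge zero    zero    _ ())
  leg-of (edge zero    (suc a) _ _) = a
  leg-of (edge (suc _) zero    () _)
  leg-of (edge (suc _) (suc _) _ ())

  ray : Fin t → Edge (star t)
  ray a = edge zero (suc a) (s≤s z≤n) tt

  open Subdivide (star t) (m ∘ leg-of) public

  code : Vertex → Code
  code (inj₁ zero)    = hub
  code (inj₁ (suc a)) = on a (m a)
  code (inj₂ (e , j)) = on (leg-of e) (toℕ j)

  Valid : Code → Set
  Valid hub      = ⊤
  Valid (on a s) = s ≤ m a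

  valid : ∀ p → Valid (code p)
  valid (inj₁ zero)    = tt
  valid (inj₁ (suc a)) = ≤-refl
  valid (inj₂ (e , j)) = <⇒≤ (Fin.toℕ<n j)

  vertex : Code → Vertex
  vertex hub      = inj₁ zero
  vertex (on a s) = pt (ray a) (suc s)

  vertex-code : ∀ p → vertex (code p) ≡ p
  vertex-code (inj₁ zero)    = refl
  vertex-code (inj₁ (suc a)) = sym (at⇒pt target)
  vertex-code (inj₂ (edge zero (suc a) _ _ , j)) = sym (at⇒pt (inner j))
  vertex-code (inj₂ (edge zero zero _ () , j))
  vertex-code (inj₂ (edge (suc _) zero () _ , j))
  vertex-code (inj₂ (edge (suc _) (suc _) _ () , j))

  along : Fin t → ℕ → Code
  along a zero    = hub
  along a (suc s) = on a s

  at-code : ∀ {e i p} → At (star t) (m ∘ leg-of) e i p → code p ≡ along (leg-of e) i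
  at-code {edge zero (suc a) _ _} source    = refl
  at-code {edge zero (suc a) _ _} (inner j) = refl
  at-code {edge zero (suc a) _ _} target    = refl
  at-code {edge zero zero _ ()}
  at-code {edge (suc _) zero () _}
  at-code {edge (suc _) (suc _) _ ()}

  code-vertex : ∀ c → Valid c → code (vertex c) ≡ c
  code-vertex hub      _  = refl
  code-vertex (on a s) s≤ = at-code (pt-at (ray a) (suc s) (s≤s s≤))

  data Link : Code → Code → Set where
    first : ∀ a → Link hub (on a 0)
    later : ∀ a s → Link (on a s) (on a (suc s))

  linked : ∀ {p q} → Graph._~_ graph p q → Link (code p) (code q) ⊎ Link (code q) (code p)
  linked pq = Sum.map link link (~⇒next pq)
    where
    along-link : ∀ a i → Link (along a i) (along a (suc i))
    along-link a zero    = first a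
    along-link a (suc s) = later a s
    link : ∀ {p q} → Next (star t) (m ∘ leg-of) p q → Link (code p) (code q)
    link (e , i , at₀ , at₁) = subst₂ Link (sym (at-code at₀)) (sym (at-code at₁)) (along-link (leg-of e) i)

  link-adjacent : ∀ {c c′} → Link c c′ → Valid c′ → Graph._~_ graph (vertex c) (vertex c′)
  link-adjacent (first a)   _  = pt-step (ray a) 0 z≤n
  link-adjacent (later a s) s< = pt-step (ray a) (suc s) s<

  isStar : SubdividedStar graph
  isStar = t , isSubdivision λ _ → z≤n

  out : ∀ a s → s ≤ m a → Walk graph (vertex hub) (vertex (on a s)) (suc s)
  out a s s≤ = segment (pt (ray a)) 0 (suc s) λ i _ i< → pt-step (ray a) i (≤-trans (≤-pred i<) s≤)

  onward : ∀ a s l → s + l ≤ m a → Walk graph (vertex (on a s)) (vertex (on a (s + l))) l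
  onward a s l s+l≤ = segment (pt (ray a)) (suc s) l λ i _ i< → pt-step (ray a) i (≤-trans (≤-pred i<) s+l≤)

  depth : Code → ℕ
  depth hub      = 0
  depth (on a s) = suc s

  link-depth : ∀ {c c′} → Link c c′ → depth c′ ≡ suc (depth c)
  link-depth (first a)   = refl
  link-depth (later a s) = refl

  depth-walk : ∀ {p q d} → Walk graph p q d → depth (code q) ≤ depth (code p) + d
  depth-walk {p} [] = ≤-reflexive (sym (+-identityʳ _))
  depth-walk {p} {q} {suc d} (_∷_ {v = z} e w) = ≤-trans (depth-walk w)
    (≤-trans (+-monoˡ-≤ d (adjacent-depth (linked e))) (≤-reflexive (sym (+-suc (depth (code p)) d))))
    where
    adjacent-depth : ∀ {c c′} → Link c c′ ⊎ Link c′ c → depth c′ ≤ suc (depth c)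
    adjacent-depth (inj₁ l) = ≤-reflexive (link-depth l)
    adjacent-depth (inj₂ l) = m≤n⇒m≤1+n (≤-trans (n≤1+n _) (≤-reflexive (sym (link-depth l))))

  -- A walk can leave a leg only through its innermost vertex, which costs `suc s` steps to the hub;
  -- from there `depth-walk` counts the rest.
  through-hub : ∀ {p q d a b s s′} → Walk graph p q d → code p ≡ on a s → code q ≡ on b s′ → a ≢ b →
                suc s + suc s′ ≤ d
  through-hub [] p≡ q≡ a≢b with trans (sym p≡) q≡
  ... | refl = ⊥-elim (a≢b refl)
  through-hub {p} {q} {suc d} {a} {b} {s} {s′} (_∷_ {v = z} e w) p≡ q≡ a≢b = next-vertex (code z) refl (subst (λ c → Link c (code z) ⊎ Link (code z) c) p≡ (linked e))
    where
    next-vertex : ∀ c → code z ≡ c → Link (on a s) c ⊎ Link c (on a s) → suc s + suc s′ ≤ suc d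
    next-vertex _ z≡ (inj₁ (later a s)) = ≤-trans (n≤1+n _) (m≤n⇒m≤1+n (through-hub w z≡ q≡ a≢b))
    next-vertex _ z≡ (inj₂ (later a s)) = s≤s (through-hub w z≡ q≡ a≢b)
    next-vertex _ z≡ (inj₂ (first a))   = s≤s (subst₂ (λ c c′ → depth c′ ≤ depth c + d) z≡ q≡ (depth-walk w))

module Coarse (k : ℕ) {n : ℕ} (G : Graph (Fin n)) (connected : ∀ u v → ∃[ d ] Walk G u v d)
              {N : ℕ} {active : Fin N → Bool}
              (L : Star.LegSystem G connected active (13 * k) (58 * k + 9)) where
  open Graph G
  open Star G connected
  open LegSystem L
  open Enumeration (enumerate active) renaming (size to t; injective to item-injective)

  len′ : Fin t → ℕ
  len′ = len ∘ item

  leg′ : Fin t → ℕ → Fin n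
  leg′ = leg ∘ item

  r ρ : ℕ
  r = 13 * k
  ρ = 58 * k + 9

  leg-distance : ∀ a i l → i + l ≤ len′ a → δ (leg′ a i) (leg′ a (i + l)) ≤ l
  leg-distance a i l i+l≤ = δ-min (segment {G = G} (leg′ a) i l λ j _ j< → step (item a) (sound a) j (≤-trans j< i+l≤))

  apart′ : ∀ a b → a ≢ b → ∀ i j → i ≤ len′ a → j ≤ len′ b → i + j + (2 * r + 3) ≤ δ (leg′ a i) (leg′ b j)
  apart′ a b a≢b = apart (item a) (item b) (sound a) (sound b) (a≢b ∘ item-injective a b)

  cover′ : ∀ z → (∃[ a ] ∃[ i ] i ≤ len′ a × δ z (leg′ a i) ≤ r) ⊎ suc (δ centre z) ≤ ρ
  cover′ z with cover z
  ... | inj₂ le = inj₂ le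
  ... | inj₁ (a , s , i , i≤ , d≤) with covers a s
  ...   | a′ , refl = inj₁ (a′ , i , i≤ , d≤)

  -- The quasi-isometry

  module Isometry where
    open SubdividedStarGraph t len′

    is-star : SubdividedStar graph
    is-star = isStar

    Φ : Code → Fin n
    Φ hub      = centre
    Φ (on a s) = leg′ a s

    -- The ways from the starts of two legs to the centre cost `ρ` each; `r` is the distance of a
    -- covered vertex from its leg.
    C : ℕ
    C = 2 * ρ + r

    -- Distances in the star do not exceed those in `G`, by `away`, `straight` and `apart`. The
    -- error comes from the converse, as legs only start near the centre.
    Comparable : Code → Code → Set
    Comparable c c′ =
      (∃[ a ] Walk graph (vertex c) (vertex c′) a × a ≤ δ (Φ c) (Φ c′) + C) ×
      (∀ {d p q} → code p ≡ c → code q ≡ c′ → Walk graph p q d → δ (Φ c) (Φ c′) ≤ d + C)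

    comparable-sym : ∀ {c c′} → Comparable c c′ → Comparable c′ c
    comparable-sym {c} {c′} ((a , w , a≤) , upper) =
      (a , reverse w , subst (λ d → a ≤ d + C) (δ-sym (Φ c) (Φ c′)) a≤) ,
      λ {d} p≡ q≡ w → subst (_≤ d + C) (δ-sym (Φ c) (Φ c′)) (upper q≡ p≡ (reverse w))

    hub-leg : ∀ a s → s ≤ len′ a → Comparable hub (on a s)
    hub-leg a s s≤ =
      (suc s , out a s s≤ , ≤-trans (≤-trans (≤-reflexive (+-comm 1 s)) (≤-trans (+-monoʳ-≤ s (s≤s z≤n)) (away (item a) (sound a) s s≤))) (m≤m+n _ C)) ,
      λ {d} p≡ q≡ w → lin 6 (λ k s d c0 cs ls → κ 1 ⊕ s ≼ d ⇒ c0 ≼ 58 · k ⊕ κ 9 ⇒ ls ≼ s ⇒ cs ≼ c0 ⊕ ls ⇒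
          goal (cs ≼ d ⊕ (2 · (58 · k ⊕ κ 9) ⊕ 13 · k)))
        k s d (δ centre (leg′ a 0)) (δ centre (leg′ a s)) (δ (leg′ a 0) (leg′ a s))
        (subst₂ (λ c c′ → depth c′ ≤ depth c + d) p≡ q≡ (depth-walk w))
        (start (item a) (sound a)) (leg-distance a 0 s s≤) (δ-tri centre (leg′ a 0) (leg′ a s))

    same-leg : ∀ a s l → s + l ≤ len′ a → Comparable (on a s) (on a (s + l))
    same-leg a s l s+l≤ =
      (l , onward a s l s+l≤ , ≤-trans (straight (item a) (sound a) s l s+l≤) (m≤m+n _ C)) ,
      λ {d} p≡ q≡ w → ≤-trans (leg-distance a s l s+l≤) (≤-trans
        (+-cancelˡ-≤ (suc s) l d (subst₂ (λ c c′ → depth c′ ≤ depth c + d) p≡ q≡ (depth-walk w))) (m≤m+n d C))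

    two-legs : ∀ a b → a ≢ b → ∀ s s′ → s ≤ len′ a → s′ ≤ len′ b → Comparable (on a s) (on b s′)
    two-legs a b a≢b s s′ s≤ s′≤ =
      (suc s + suc s′ , reverse (out a s s≤) ++ out b s′ s′≤ ,
        lin 5 (λ k s s′ d c → s ⊕ s′ ⊕ (2 · (13 · k) ⊕ κ 3) ≼ d ⇒ goal (κ 1 ⊕ s ⊕ (κ 1 ⊕ s′) ≼ d ⊕ c))
          k s s′ (δ (leg′ a s) (leg′ b s′)) C (apart′ a b a≢b s s′ s≤ s′≤)) ,
      λ {d} p≡ q≡ w → lin 10 (λ k s s′ d c0 c0′ ls ls′ st m → κ 1 ⊕ s ⊕ (κ 1 ⊕ s′) ≼ d ⇒ c0 ≼ 58 · k ⊕ κ 9 ⇒ c0′ ≼ 58 · k ⊕ κ 9 ⇒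
          ls ≼ s ⇒ ls′ ≼ s′ ⇒ m ≼ ls ⊕ c0 ⇒ st ≼ m ⊕ (c0′ ⊕ ls′) ⇒ goal (st ≼ d ⊕ (2 · (58 · k ⊕ κ 9) ⊕ 13 · k)))
        k s s′ d (δ centre (leg′ a 0)) (δ centre (leg′ b 0)) (δ (leg′ a 0) (leg′ a s)) (δ (leg′ b 0) (leg′ b s′))
        (δ (leg′ a s) (leg′ b s′)) (δ (leg′ a s) centre)
        (through-hub w p≡ q≡ a≢b) (start (item a) (sound a)) (start (item b) (sound b))
        (leg-distance a 0 s s≤) (leg-distance b 0 s′ s′≤)
        (≤-trans (δ-tri (leg′ a s) (leg′ a 0) centre) (≤-reflexive (cong₂ _+_ (δ-sym (leg′ a s) (leg′ a 0)) (δ-sym (leg′ a 0) centre))))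
        (≤-trans (δ-tri (leg′ a s) centre (leg′ b s′)) (+-monoʳ-≤ _ (δ-tri centre (leg′ b 0) (leg′ b s′))))

    comparable : ∀ c c′ → Valid c → Valid c′ → Comparable c c′
    comparable hub      hub      _  _   = (0 , [] , z≤n) , λ _ _ _ → ≤-trans (≤-reflexive (δ-refl centre)) z≤n
    comparable hub      (on b s) _  s≤  = hub-leg b s s≤
    comparable (on a s) hub      s≤ _   = comparable-sym (hub-leg a s s≤)
    comparable (on a s) (on b s′) s≤ s′≤ with a Fin.≟ b
    ... | no a≢b   = two-legs a b a≢b s s′ s≤ s′≤
    ... | yes refl with between s s′
    ...   | up l refl   = same-leg a s l s′≤
    ...   | down l refl = comparable-sym (same-leg a s′ l s≤)

    quasi-isometric : QuasiIsometric 1 C graph G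
    quasi-isometric = record
      { φ     = Φ ∘ code
      ; lower = λ p q {d} (w , _) → let (a , w′ , a≤) , _ = comparable (code p) (code q) (valid p) (valid q) in
          Decide.walk⇒dist≤ graph search-vertex vertex-≟
            (subst₂ (λ p q → Walk graph p q a) (vertex-code p) (vertex-code q) w′)
            (≤-trans a≤ (≤-trans (+-monoˡ-≤ C (δ-min w)) (≤-reflexive (cong₂ _+_ (sym (*-identityˡ d)) (sym (*-identityˡ C))))))
      ; upper = λ p q {d} (w , _) → let _ , upper = comparable (code p) (code q) (valid p) (valid q) in
          Decide.walk⇒dist≤ G Fin.any? Fin._≟_ (geodesic (Φ (code p)) (Φ (code q)))
            (≤-trans (upper refl refl w) (≤-reflexive (cong (_+ C) (sym (*-identityˡ d)))))
      ; dense = dense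
      }
      where
      near-code : ∀ c → Valid c → ∀ z → δ z (Φ c) ≤ C → ∃[ p ] Dist≤ G z (Φ (code p)) C
      near-code c v z le = vertex c , subst (λ c → Dist≤ G z (Φ c) C) (sym (code-vertex c v))
        (Decide.walk⇒dist≤ G Fin.any? Fin._≟_ (geodesic z (Φ c)) le)
      dense : ∀ z → ∃[ p ] Dist≤ G z (Φ (code p)) C
      dense z with cover′ z
      ... | inj₁ (a , i , i≤ , d≤) = near-code (on a i) i≤ z (≤-trans d≤ (m≤n+m r (2 * ρ)))
      ... | inj₂ le = near-code hub tt z (≤-trans (≤-reflexive (δ-sym z centre))
        (≤-trans (<⇒≤ le) (≤-trans (m≤m+n ρ (ρ + 0)) (m≤m+n (2 * ρ) r))))

  -- The decomposition

  module Bags where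
    -- As span exceeds both ρ and 2 r + 2, the bags of a leg that contain a given
    -- vertex are at most two consecutive ones, among the first two if the central
    -- bag contains it too.
    half span : ℕ
    half = 29 * k + 5
    span = suc (58 * k + 9)

    pieces : Fin t → ℕ
    pieces a = len′ a / span

    open SubdividedStarGraph t pieces

    is-star : SubdividedStar graph
    is-star = isStar

    -- Consecutive pieces share an end position, so that their bags meet. The radius `suc r` in
    -- place of `r` takes in the neighbours of the vertices covered, which gives `edge-cover`.
    InBag : Code → Fin n → Set
    InBag hub      z = δ centre z ≤ ρ
    InBag (on a s) z = ∃[ i ] s * span ≤ i × i ≤ suc s * span × i ≤ len′ a × δ z (leg′ a i) ≤ suc r

    inBag? : ∀ c z → Dec (InBag c z)
    inBag? hub      z = δ centre z ≤? ρ
    inBag? (on a s) z = map′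
      (λ (i , i< , lo , hi , d≤) → i , lo , hi , ≤-pred i< , d≤) (λ (i , lo , hi , i≤ , d≤) → i , s≤s i≤ , lo , hi , d≤)
      (anyUpTo? (λ i → (s * span ≤? i) ×-dec (i ≤? suc s * span) ×-dec (δ z (leg′ a i) ≤? suc r)) (suc (len′ a)))

    bag : Vertex → Subset n
    bag p = comprehension (inBag? (code p))

    bag⁺ : ∀ {c z} → Valid c → InBag c z → z Subset.∈ bag (vertex c)
    bag⁺ {c} {z} v b = ∈-comprehension⁺ (inBag? (code (vertex c))) (subst (λ c → InBag c z) (sym (code-vertex c v)) b)

    bag⁻ : ∀ {p z} → z Subset.∈ bag p → InBag (code p) z
    bag⁻ {p} = ∈-comprehension⁻ (inBag? (code p))

    floor : ∀ i → (i / span) * span ≤ i × i ≤ suc (i / span) * span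
    floor i = m/n*n≤m i span , ≤-trans (≤-reflexive (m≡m%n+[m/n]*n i span)) (+-monoˡ-≤ ((i / span) * span) (<⇒≤ (m%n<n i span)))

    in-leg-bag : ∀ {a i z} → i ≤ len′ a → δ z (leg′ a i) ≤ suc r → ∃[ c ] Valid c × InBag c z
    in-leg-bag {a} {i} i≤ d≤ = on a (i / span) , /-monoˡ-≤ span i≤ , i , proj₁ (floor i) , proj₂ (floor i) , i≤ , d≤

    bagged : ∀ z → ∃[ c ] Valid c × InBag c z
    bagged z with cover′ z
    ... | inj₁ (a , i , i≤ , d≤) = in-leg-bag i≤ (m≤n⇒m≤1+n d≤)
    ... | inj₂ le = hub , tt , <⇒≤ le

    leg-distance-≤ : ∀ a i j z → δ z (leg′ a i) ≤ suc r → δ z (leg′ a j) ≤ suc r → i ≤ j → j ≤ len′ a → j ≤ i + (2 * r + 2)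
    leg-distance-≤ a i j z d≤ d′≤ i≤j j≤ with m≤n⇒∃[o]m+o≡n i≤j
    ... | l , refl = lin 6 (λ k i l d d₁ d₂ → l ≼ d ⇒ d ≼ d₁ ⊕ d₂ ⇒ d₁ ≼ κ 1 ⊕ 13 · k ⇒ d₂ ≼ κ 1 ⊕ 13 · k ⇒ goal (i ⊕ l ≼ i ⊕ (2 · (13 · k) ⊕ κ 2)))
      k i l (δ (leg′ a i) (leg′ a (i + l))) (δ z (leg′ a i)) (δ z (leg′ a (i + l)))
      (straight (item a) (sound a) i l j≤)
      (subst (λ d → δ (leg′ a i) (leg′ a (i + l)) ≤ d + δ z (leg′ a (i + l))) (δ-sym (leg′ a i) z) (δ-tri (leg′ a i) z (leg′ a (i + l))))
      d≤ d′≤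

    one-leg : ∀ {a b s s′ z} → InBag (on a s) z → InBag (on b s′) z → a ≡ b
    one-leg {a} {b} {s} {s′} {z} (i , _ , _ , i≤ , d≤) (j , _ , _ , j≤ , d′≤) with a Fin.≟ b
    ... | yes eq = eq
    ... | no a≢b = ⊥-elim (lin 7 (λ k i j d d₁ d₁′ d₂ → i ⊕ j ⊕ (2 · (13 · k) ⊕ κ 3) ≼ d ⇒ d ≼ d₁′ ⊕ d₂ ⇒ d₁′ ≐ d₁ ⇒ d₁ ≼ κ 1 ⊕ 13 · k ⇒
          d₂ ≼ κ 1 ⊕ 13 · k ⇒ false)
        k i j (δ (leg′ a i) (leg′ b j)) (δ z (leg′ a i)) (δ (leg′ a i) z) (δ z (leg′ b j))
        (apart′ a b a≢b i j i≤ j≤) (δ-tri (leg′ a i) z (leg′ b j)) (δ-sym (leg′ a i) z) d≤ d′≤)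

    consecutive : ∀ {a s s′ z} → InBag (on a s) z → InBag (on a s′) z → s′ ≤ suc s
    consecutive {a} {s} {s′} {z} (i , _ , i≤piece , i≤ , d≤) (j , piece≤j , _ , j≤ , d′≤) = ≮⇒≥ λ gap →
      let gap≤ = *-monoˡ-≤ span gap in
      lin 5 (λ k x y i j → (κ 1 ⊕ (58 · k ⊕ κ 9)) ⊕ (κ 1 ⊕ (58 · k ⊕ κ 9) ⊕ x) ≼ y ⇒ i ≼ κ 1 ⊕ (58 · k ⊕ κ 9) ⊕ x ⇒ y ≼ j ⇒
          j ≼ i ⊕ (2 · (13 · k) ⊕ κ 2) ⇒ false)
        k (s * span) (s′ * span) i j gap≤ i≤piece piece≤j
        (leg-distance-≤ a i j z d≤ d′≤ (lin 5 (λ k x y i j → (κ 1 ⊕ (58 · k ⊕ κ 9)) ⊕ (κ 1 ⊕ (58 · k ⊕ κ 9) ⊕ x) ≼ y ⇒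
            i ≼ κ 1 ⊕ (58 · k ⊕ κ 9) ⊕ x ⇒ y ≼ j ⇒ goal (i ≼ j)) k (s * span) (s′ * span) i j gap≤ i≤piece piece≤j) j≤)

    -- The summand `suc r` in `away` cancels the distance from `z` to the leg. What remains,
    -- `i ≤ ρ < span`, is a position in the first piece.
    hub-position : ∀ {a i z} → δ centre z ≤ ρ → i ≤ len′ a → δ z (leg′ a i) ≤ suc r → i ≤ ρ
    hub-position {a} {i} {z} c≤ i≤ d≤ = lin 5 (λ k i cz zi ci → i ⊕ (κ 1 ⊕ 13 · k) ≼ ci ⇒ ci ≼ cz ⊕ zi ⇒ cz ≼ 58 · k ⊕ κ 9 ⇒
        zi ≼ κ 1 ⊕ 13 · k ⇒ goal (i ≼ 58 · k ⊕ κ 9))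
      k i (δ centre z) (δ z (leg′ a i)) (δ centre (leg′ a i)) (away (item a) (sound a) i i≤) (δ-tri centre z (leg′ a i)) c≤ d≤

    hub-first : ∀ {a s z} → InBag hub z → InBag (on a s) z → InBag (on a 0) z
    hub-first {a} {s} {z} c≤ (i , _ , _ , i≤ , d≤) = i , z≤n ,
      ≤-trans (hub-position c≤ i≤ d≤) (≤-trans (n≤1+n ρ) (≤-reflexive (sym (+-identityʳ span)))) , i≤ , d≤

    Touching : Code → Code → Set
    Touching c c′ = c ≡ c′ ⊎ Link c c′ ⊎ Link c′ c

    leg-touching : ∀ {a b s s′ z} → InBag (on a s) z → InBag (on b s′) z → Touching (on a s) (on b s′)
    leg-touching {s = s} {s′} b b′ with one-leg {s = s} {s′} b b′
    leg-touching {a} {s = s} {s′} b b′ | refl with <-cmp s s′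
    ... | tri≈ _ refl _ = inj₁ refl
    ... | tri< lt _ _   = inj₂ (inj₁ (subst (Link (on a s) ∘ on a) (≤-antisym lt (consecutive b b′)) (later a s)))
    ... | tri> _ _ gt   = inj₂ (inj₂ (subst (Link (on a s′) ∘ on a) (≤-antisym gt (consecutive b′ b)) (later a s′)))

    -- The bags containing z all touch one of them.
    focus : ∀ z → ∃[ c ] Valid c × InBag c z × (∀ c′ → InBag c′ z → Touching c c′)
    focus z with Fin.any? (λ a → inBag? (on a 0) z)
    ... | yes (a , b) = on a 0 , z≤n , b , λ { hub _ → inj₂ (inj₂ (first a)) ; (on a′ s) b′ → leg-touching b b′ }
    ... | no none with inBag? hub z
    ...   | yes c≤ = hub , tt , c≤ , λ { hub _ → inj₁ refl ; (on a s) b → ⊥-elim (none (a , hub-first {s = s} c≤ b)) }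
    ...   | no ¬c≤ with bagged z
    ...     | hub , _ , c≤ = ⊥-elim (¬c≤ c≤)
    ...     | on a s , v , b = on a s , v , b , λ { hub c≤ → ⊥-elim (¬c≤ c≤) ; (on a′ s′) b′ → leg-touching b b′ }

    Copart : Fin n → Set
    Copart z = [ p ∈ Vertex ∣ z Subset.∈ bag p ]

    copart-graph : ∀ z → Graph (Copart z)
    copart-graph z = induced graph (λ p → z Subset.∈ bag p)

    focal : ∀ z → Σ[ f ∈ Copart z ] ∀ p → ∃[ d ] Walk (copart-graph z) f p d × d ≤ 1
    focal z with focus z
    ... | c , v , b , touching = (vertex c , [ bag⁺ v b ]) , λ (p , [ z∈ ]) →
      walk p z∈ (touching (code p) (bag⁻ (recompute (z ∈? bag p) z∈)))
      where
      walk : ∀ p .(z∈ : z Subset.∈ bag p) → Touching c (code p) →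
             ∃[ d ] Walk (copart-graph z) (vertex c , [ bag⁺ v b ]) (p , [ z∈ ]) d × d ≤ 1
      walk p z∈ (inj₁ eq) with trans (cong vertex eq) (vertex-code p)
      ... | refl = 0 , [] , z≤n
      walk p z∈ (inj₂ l) = 1 , adjacent l ∷ [] , ≤-refl
        where
        adjacent : Link c (code p) ⊎ Link (code p) c → Graph._~_ graph (vertex c) p
        adjacent (inj₁ l) = subst (Graph._~_ graph (vertex c)) (vertex-code p) (link-adjacent l (valid p))
        adjacent (inj₂ l) = ~-sym {G = graph} (subst (λ p → Graph._~_ graph p (vertex c)) (vertex-code p) (link-adjacent l v))

    decomposition : Decomposition graph G
    decomposition = record
      { bag = bag
      ; vertex-cover = λ z → let c , v , b = bagged z in vertex c , bag⁺ v b
      ; edge-cover = edge-cover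
      ; copart-connected = λ z → let f , walks = focal z in f , λ p q →
          let _ , w , _ = walks p ; _ , w′ , _ = walks q in _ , reverse w ++ w′
      }
      where
      edge-cover : ∀ u v → u ~ v → ∃[ h ] u Subset.∈ bag h × v Subset.∈ bag h
      edge-cover u v e with cover′ u
      ... | inj₂ le = vertex hub , bag⁺ {hub} tt (<⇒≤ le) , bag⁺ {hub} tt (≤-trans (δ-step centre e) le)
      ... | inj₁ (a , i , i≤ , d≤) =
        vertex (on a (i / span)) , bag⁺ {on a (i / span)} (/-monoˡ-≤ span i≤) (i , proj₁ (floor i) , proj₂ (floor i) , i≤ , m≤n⇒m≤1+n d≤) ,
          bag⁺ {on a (i / span)} (/-monoˡ-≤ span i≤) (i , proj₁ (floor i) , proj₂ (floor i) , i≤ , ≤-trans (δ-step′ (leg′ a i) e) (s≤s d≤))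

    on-leg : ∀ a i → δ (leg′ a i) (leg′ a i) ≤ suc r
    on-leg a i = subst (_≤ suc r) (sym (δ-refl (leg′ a i))) z≤n

    piece-start : ∀ {a s} → s ≤ pieces a → s * span ≤ len′ a
    piece-start {a} s≤ = ≤-trans (*-monoˡ-≤ span s≤) (m/n*n≤m (len′ a) span)

    common : ∀ {c c′} → Link c c′ → Valid c → Valid c′ → ∃[ z ] InBag c z × InBag c′ z
    common (first a)   _  _   = leg′ a 0 , start (item a) (sound a) , 0 , z≤n , z≤n , z≤n , on-leg a 0
    common (later a s) s≤ 1+s≤ = leg′ a (suc s * span) ,
      (suc s * span , m≤n+m (s * span) span , ≤-refl , piece-start 1+s≤ , on-leg a (suc s * span)) ,
      (suc s * span , ≤-refl , m≤n+m (suc s * span) span , piece-start 1+s≤ , on-leg a (suc s * span))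

    honest : Decomposition.Honest decomposition
    honest = (λ p → let z , b = nonempty (code p) (valid p) in z , in-bag p b) ,
             (λ p q e → let z , b , b′ = meet (linked e) (valid p) (valid q) in z , x∈p∩q⁺ (in-bag p b , in-bag q b′))
      where
      in-bag : ∀ p {z} → InBag (code p) z → z Subset.∈ bag p
      in-bag p = ∈-comprehension⁺ (inBag? (code p))
      nonempty : ∀ c → Valid c → ∃[ z ] InBag c z
      nonempty hub      _  = centre , subst (_≤ ρ) (sym (δ-refl centre)) z≤n
      nonempty (on a s) s≤ = leg′ a (s * span) , s * span , ≤-refl , m≤n+m (s * span) span , piece-start s≤ , on-leg a (s * span)
      meet : ∀ {c c′} → Link c c′ ⊎ Link c′ c → Valid c → Valid c′ → ∃[ z ] InBag c z × InBag c′ z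
      meet (inj₁ l) v v′ = common l v v′
      meet (inj₂ l) v v′ = let z , b , b′ = common l v′ v in z , b′ , b

    -- By `focal` each copart has a vertex at distance at most 1 from all its vertices.
    radial-spread : Decomposition.RadialSpread≤ decomposition (30 * k + 7)
    radial-spread z = centre⇒radius≤ (proj₁ (focal z) , λ p → let _ , w , d≤ = proj₂ (focal z) p in
        walk⇒dist≤ w (≤-trans d≤ (≤-trans (s≤s z≤n) (m≤n+m 7 (30 * k)))))
      where open Decide (copart-graph z) (search-refinement search-vertex (λ p → z ∈? bag p)) (refinement-≟ vertex-≟)

    Within : ℕ → Vertex → Set
    Within w p = ∃[ x ] Σ[ x∈ ∈ x Subset.∈ bag p ] ∀ z (z∈ : z Subset.∈ bag p) →
      ∃[ d ] Walk (induced G (λ v → v Subset.∈ bag p)) (x , [ x∈ ]) (z , [ z∈ ]) d × d ≤ w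

    within-hub : ∀ p → code p ≡ hub → Within ρ p
    within-hub p eq = centre , member (subst (_≤ ρ) (sym (δ-refl centre)) z≤n) , λ z z∈ →
      let z≤ρ = subst (λ c → InBag c z) eq (bag⁻ z∈) in
      δ centre z , lift-walk G _ (geodesic centre z)
        (λ i i≤ → member (subst (_≤ ρ) (sym (δ-at centre z i i≤)) (≤-trans i≤ z≤ρ))) z∈ , z≤ρ
      where
      member : ∀ {z} → δ centre z ≤ ρ → z Subset.∈ bag p
      member {z} le = ∈-comprehension⁺ (inBag? (code p)) (subst (λ c → InBag c z) (sym eq) le)

    -- From the middle of the piece go along the leg for at most `half` steps, then along a shortest
    -- path that stays within `suc r` of the leg vertex reached and hence in the bag. The sum is
    -- `42 k + 6`.
    within-leg : ∀ p a s → code p ≡ on a s → s ≤ pieces a → Within (half + suc r) p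
    within-leg p a s eq s≤ = leg′ a mid , member (≤-reflexive refl) mid-lo mid-hi mid-len (on-leg a mid) , λ z z∈ →
      let i , lo , hi , i≤ , d≤ = subst (λ c → InBag c z) eq (bag⁻ z∈)
          d₁ , w₁ , d₁≤ = to-mid i lo hi i≤ (member ≤-refl mid-lo mid-hi mid-len (on-leg a mid)) (member ≤-refl lo hi i≤ (on-leg a i))
          d≤′ = subst (_≤ suc r) (δ-sym z (leg′ a i)) d≤
      in d₁ + δ (leg′ a i) z ,
         w₁ ++ lift-walk G _ (geodesic (leg′ a i) z)
           (λ l l≤ → member ≤-refl lo hi i≤ (subst (_≤ suc r) (trans (sym (δ-at (leg′ a i) z l l≤)) (δ-sym (leg′ a i) _)) (≤-trans l≤ d≤′))) z∈ ,
         +-mono-≤ d₁≤ d≤′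
      where
      P : Fin n → Set
      P v = v Subset.∈ bag p
      member : ∀ {i i′ z} → i ≤ i′ → s * span ≤ i → i′ ≤ suc s * span → i′ ≤ len′ a → δ z (leg′ a i) ≤ suc r → P z
      member {i} {z = z} i≤i′ lo hi i≤ d≤ = ∈-comprehension⁺ (inBag? (code p))
        (subst (λ c → InBag c z) (sym eq) (i , lo , ≤-trans i≤i′ hi , ≤-trans i≤i′ i≤ , d≤))
      mid : ℕ
      -- The last piece of a leg may end before its middle.
      mid = (s * span + half) ⊓ len′ a
      mid-lo : s * span ≤ mid
      mid-lo = ⊓-glb (m≤m+n (s * span) half) (piece-start s≤)
      mid-len : mid ≤ len′ a
      mid-len = m⊓n≤n (s * span + half) (len′ a)
      mid-hi : mid ≤ suc s * span
      mid-hi = ≤-trans (m⊓n≤m (s * span + half) (len′ a))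
        (lin 2 (λ k x → goal (x ⊕ (29 · k ⊕ κ 5) ≼ κ 1 ⊕ (58 · k ⊕ κ 9) ⊕ x)) k (s * span))
      path : ∀ i l → s * span ≤ i → l + i ≤ suc s * span → l + i ≤ len′ a → ∀ .(pi : P (leg′ a i)) .(pj : P (leg′ a (l + i))) →
             Walk (induced G P) (leg′ a i , [ pi ]) (leg′ a (l + i) , [ pj ]) l
      path i l lo hi len≤ _ _ = lift-path G P (λ x → leg′ a (x + i)) l
        (λ x x< → step (item a) (sound a) (x + i) (≤-trans (+-monoˡ-≤ i x<) len≤))
        (λ x x≤ → member (+-monoˡ-≤ i x≤) (≤-trans lo (m≤n+m i x)) hi len≤ (on-leg a (x + i)))
      to-mid : ∀ i → s * span ≤ i → i ≤ suc s * span → i ≤ len′ a → (pm : P (leg′ a mid)) (pi : P (leg′ a i)) →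
               ∃[ d ] Walk (induced G P) (leg′ a mid , [ pm ]) (leg′ a i , [ pi ]) d × d ≤ half
      to-mid i lo hi i≤ pm pi with between mid i
      ... | up l refl = up-walk
        where
        up-walk : ∃[ d ] Walk (induced G P) (leg′ a mid , [ pm ]) (leg′ a (mid + l) , [ pi ]) d × d ≤ half
        up-walk = l , go (mid + l) (+-comm l mid) hi i≤ pi , bound
          where
          -- With the end position generalised, the equation can be matched together with the
          -- membership proof over it.
          go : ∀ x → l + mid ≡ x → x ≤ suc s * span → x ≤ len′ a → (px : P (leg′ a x)) →
               Walk (induced G P) (leg′ a mid , [ pm ]) (leg′ a x , [ px ]) l
          go _ refl hi i≤ px = path mid l mid-lo hi i≤ pm px
          bound : l ≤ half
          bound with ≤-total (s * span + half) (len′ a)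
          ... | inj₁ le = lin 4 (λ k x m l → m ≐ x ⊕ (29 · k ⊕ κ 5) ⇒ m ⊕ l ≼ κ 1 ⊕ (58 · k ⊕ κ 9) ⊕ x ⇒ goal (l ≼ 29 · k ⊕ κ 5))
                          k (s * span) mid l (m≤n⇒m⊓n≡m le) hi
          ... | inj₂ ge = lin 3 (λ k m l → m ⊕ l ≼ m ⇒ goal (l ≼ 29 · k ⊕ κ 5)) k mid l (≤-trans i≤ (≤-reflexive (sym (m≥n⇒m⊓n≡n ge))))
      ... | down l eq′ = l , reverse (go mid (trans (+-comm l i) (sym eq′)) mid-hi mid-len pm) ,
          lin 4 (λ k x i l → i ⊕ l ≼ x ⊕ (29 · k ⊕ κ 5) ⇒ x ≼ i ⇒ goal (l ≼ 29 · k ⊕ κ 5)) k (s * span) i l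
            (≤-trans (≤-reflexive (sym eq′)) (m⊓n≤m (s * span + half) (len′ a))) lo
        where
        go : ∀ x → l + i ≡ x → x ≤ suc s * span → x ≤ len′ a → (px : P (leg′ a x)) →
             Walk (induced G P) (leg′ a i , [ pi ]) (leg′ a x , [ px ]) l
        go _ refl hi x≤ px = path i l lo hi x≤ pi px

    within : ∀ p → Within ρ p
    within p = within-code (code p) refl (valid p)
      where
      within-code : ∀ c → code p ≡ c → Valid c → Within ρ p
      within-code hub      eq _  = within-hub p eq
      within-code (on a s) eq s≤ = let x , x∈ , walks = within-leg p a s eq s≤ in x , x∈ , λ z z∈ →
        let d , w , d≤ = walks z z∈ in
        d , w , ≤-trans d≤ (lin 1 (λ k → goal (29 · k ⊕ κ 5 ⊕ (κ 1 ⊕ 13 · k) ≼ 58 · k ⊕ κ 9)) k)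

    radial-width : Decomposition.RadialWidth≤ decomposition (58 * k + 9)
    radial-width p = let x , x∈ , walks = within p in
      centre⇒radius≤ ((x , [ x∈ ]) , λ (z , [ z∈ ]) →
        let d , w , d≤ = walks z (recompute (z ∈? bag p) z∈) in walk⇒dist≤ w d≤)
      where open Decide (induced G (λ v → v Subset.∈ bag p)) (search-refinement Fin.any? (λ z → z ∈? bag p)) (refinement-≟ Fin._≟_)

-- Choice of the root and conclusion

diametral-pair : ∀ {n} (δ : Fin (suc n) → Fin (suc n) → ℕ) →
                 ∃[ u ] ∃[ v ] ∀ x y → δ x y ≤ δ u v
diametral-pair δ = u , far u , λ x y → ≤-trans (proj₂ (argmax (δ x)) y) (max x)
  where
  far = λ x → proj₁ (argmax (δ x))
  widest = argmax (λ x → δ x (far x))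
  u = proj₁ widest
  max = proj₂ widest

leg-system : ∀ k n (G : Graph (Fin n)) (connected : Connected G) →
             ¬ ContainsGeodesicSubdivision k K³ G →
             ¬ ContainsQuasiGeodesicSubdivision 3 (3 * k) wrench G →
             ∃[ N ] Σ[ active ∈ (Fin N → Bool) ]
               Star.LegSystem G (proj₂ connected) active (13 * k) (58 * k + 9)
leg-system k (suc n) G (_ , walks) no-cycle no-wrench =
  let open Star G walks
      u , v , diametral = diametral-pair δ
  in Construction.legs k no-cycle no-wrench u v diametral

theorem4 : (k : ℕ) →
    ((n : ℕ) (G : Graph (Fin n)) → Connected G →
    ¬ ContainsGeodesicSubdivision k K³ G →
    ¬ ContainsQuasiGeodesicSubdivision 3 (3 * k) wrench G →
    Σ[ W ∈ Set ] Σ[ S ∈ Graph W ] SubdividedStar S ×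
    (Σ[ D ∈ Decomposition S G ]
    Decomposition.Honest D ×
    Decomposition.RadialWidth≤ D (58 * k + 9) ×
    Decomposition.RadialSpread≤ D (30 * k + 7)))
    ×
    (∃[ C ] ((n : ℕ) (G : Graph (Fin n)) → Connected G →
    ¬ ContainsGeodesicSubdivision k K³ G →
    ¬ ContainsQuasiGeodesicSubdivision 3 (3 * k) wrench G →
    Σ[ W ∈ Set ] Σ[ S ∈ Graph W ] SubdividedStar S × QuasiIsometric 1 C S G))
theorem4 k =
  (λ n G connected no-cycle no-wrench →
    let _ , _ , L = leg-system k n G connected no-cycle no-wrench
        open Coarse k G (proj₂ connected) L
    in _ , _ , Bags.is-star ,
       Bags.decomposition , Bags.honest , Bags.radial-width , Bags.radial-spread) ,
  (2 * (58 * k + 9) + 13 * k) ,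
  (λ n G connected no-cycle no-wrench →
    let _ , _ , L = leg-system k n G connected no-cycle no-wrench
        open Coarse k G (proj₂ connected) L
    in _ , _ , Isometry.is-star , Isometry.quasi-isometric)
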